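{- Let $K_4-e$ denote the graph obtained from $K_4$ by removing one edge. Then $[C_6]=\{C_6,D_6,(K_4-e)\cup K_2\}$, and $[C_{2n}]=\{C_{2n},D_{2n}\}$ for all integers $n\ge 2$ with $n\neq 3$.
   Context: All graphs are finite, undirected and simple, considered up to isomorphism. The independence polynomial of a graph $G$ is $i(G,x)=\sum_{k\ge 0} i_k x^k$, where $i_k$ is the number of independent sets (vertex sets inducing no edges) of size $k$. The independence equivalence class $[G]$ is the set of graphs $H$ with $i(H,x)=i(G,x)$. $C_n$ is the cycle on $n$ vertices, $\cup$ denotes disjoint union, and for $n\ge 3$, $D_n$ is the graph on vertices $u_1,\dots,u_n$ with edges $u_1u_2,u_1u_3,u_2u_3$ and $u_ju_{j+1}$ for $3\le j\le n-1$ (a triangle with a pendant path attached at one vertex, $n$ vertices in total). -}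

module Defs where

open import Data.Bool using (Bool; true; false; _∧_; _∨_; not; if_then_else_)
open import Data.Bool.Properties using (∨-comm)
open import Data.Nat using (ℕ; zero; suc; _+_; _*_; _≡ᵇ_; _≤ᵇ_)
open import Data.Fin using (Fin; toℕ; splitAt; _≟_)
open import Data.Fin.Subset using (Subset; ∣_∣)
open import Data.Sum using (inj₁; inj₂)
open import Data.List using (List; []; _∷_; map; _++_; allFin)
open import Data.Nat.ListAction using (sum)
open import Data.Bool.ListAction using (all)
open import Data.Vec using (Vec; lookup) renaming ([] to []ᵥ; _∷_ to _∷ᵥ_)
open import Function.Bundles using (_↔_; Inverse)
open import Relation.Nullary using (does; yes; no)
open import Relation.Binary.PropositionalEquality using (_≡_; refl; cong; cong₂)

record Graph (n : ℕ) : Set where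
  field
    adj    : Fin n → Fin n → Bool
    sym    : ∀ i j → adj i j ≡ adj j i
    irrefl : ∀ i → adj i i ≡ false
open Graph public

private
  ≟-sym : ∀ {n} (i j : Fin n) → does (i ≟ j) ≡ does (j ≟ i)
  ≟-sym i j with i ≟ j | j ≟ i
  ... | yes _ | yes _ = refl
  ... | no _  | no _  = refl
  ... | yes refl | no ¬p = Data.Empty.⊥-elim (¬p refl)
    where import Data.Empty
  ... | no ¬p | yes refl = Data.Empty.⊥-elim (¬p refl)
    where import Data.Empty

  ≟-refl : ∀ {n} (i : Fin n) → does (i ≟ i) ≡ true
  ≟-refl i with i ≟ i
  ... | yes _ = refl
  ... | no ¬p = Data.Empty.⊥-elim (¬p refl)
    where import Data.Empty

mkGraph : ∀ {n} → (Fin n → Fin n → Bool) → Graph n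
mkGraph E = record
  { adj    = λ i j → not (does (i ≟ j)) ∧ (E i j ∨ E j i)
  ; sym    = λ i j → cong₂ _∧_ (cong not (≟-sym i j)) (∨-comm (E i j) (E j i))
  ; irrefl = λ i → cong₂ (λ a b → not a ∧ b) (≟-refl i) (refl {x = E i i ∨ E i i})
  }

-- Cycle C_m on vertices 0,…,m-1 (intended for m ≥ 3): edges {a, a+1} and {m-1, 0}.
C : (m : ℕ) → Graph m
C m = mkGraph λ i j →
  (suc (toℕ i) ≡ᵇ toℕ j) ∨ ((suc (toℕ i) ≡ᵇ m) ∧ (toℕ j ≡ᵇ 0))

-- D_m (m ≥ 3): vertices u_1,…,u_m are 0,…,m-1; edges u1u2, u1u3, u2u3 and
-- u_j u_{j+1} for 3 ≤ j ≤ m-1 (in 0-based indices: {0,1},{0,2},{a,a+1} for a ≥ 1).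
D : (m : ℕ) → Graph m
D m = mkGraph λ i j →
  ((toℕ i ≡ᵇ 0) ∧ ((toℕ j ≡ᵇ 1) ∨ (toℕ j ≡ᵇ 2)))
  ∨ ((1 ≤ᵇ toℕ i) ∧ (suc (toℕ i) ≡ᵇ toℕ j))

K : (m : ℕ) → Graph m
K m = mkGraph λ _ _ → true

K4-e : Graph 4
K4-e = mkGraph λ i j → not (((toℕ i ≡ᵇ 2) ∧ (toℕ j ≡ᵇ 3)) ∨ ((toℕ i ≡ᵇ 3) ∧ (toℕ j ≡ᵇ 2)))

_∪_ : ∀ {m k} → Graph m → Graph k → Graph (m + k)
_∪_ {m} {k} G H = mkGraph λ i j → go (splitAt m i) (splitAt m j)
  where
  go : _ → _ → Bool
  go (inj₁ a) (inj₁ b) = adj G a b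
  go (inj₂ a) (inj₂ b) = adj H a b
  go _ _ = false

record _≅_ {m k : ℕ} (G : Graph m) (H : Graph k) : Set where
  field
    bij      : Fin m ↔ Fin k
    preserve : ∀ i j → adj H (Inverse.to bij i) (Inverse.to bij j) ≡ adj G i j

allSubsets : (n : ℕ) → List (Subset n)
allSubsets zero    = []ᵥ ∷ []
allSubsets (suc n) = map (true ∷ᵥ_) (allSubsets n) ++ map (false ∷ᵥ_) (allSubsets n)

isIndependent : ∀ {n} → Graph n → Subset n → Bool
isIndependent {n} G S =
  all (λ i → all (λ j → not (lookup S i ∧ lookup S j ∧ adj G i j)) (allFin n)) (allFin n)

indepCoeff : ∀ {n} → Graph n → ℕ → ℕ
indepCoeff {n} G k =
  sum (map (λ S → if isIndependent G S ∧ (∣ S ∣ ≡ᵇ k) then 1 else 0) (allSubsets n))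

SameIndepPoly : ∀ {m k} → Graph m → Graph k → Set
SameIndepPoly G H = ∀ r → indepCoeff G r ≡ indepCoeff H r

{-# OPTIONS --safe #-}
-- Only four facts about i(H,x) = i(C₂ₙ,x) are used: H has 2n vertices and 2n edges; by i₃ and
-- Goodman's identity Σ (deg v - 2)² is twice the number of triangles; there are exactly two
-- independent sets of size n and none larger.
--
-- Let A be one of these two sets.  A vertex v outside A with a single neighbour u in A makes
-- A - u + v the other one, so at most one such v exists and all others send two edges into A.
-- If there is none, these 2n edges are all edges of H: H is bipartite, hence 2-regular, a cycle:
-- if it were disconnected, exchanging A and its complement on one component would give a third set.
-- Otherwise let ab be the exchanged edge and W the n - 1 vertices outside A and b.  Counting edges
-- leaves two cases.  Either W is independent and one vertex c of W has one neighbour in A - a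
-- besides a and b: abc is the only triangle, exactly one vertex d of A has degree 1, and moving
-- the edge ac to ad gives a cycle, so H is D₂ₙ.  Or W contains a single edge ww′: a, b, w, w′
-- contribute 4 to the sum, so there are two triangles on ww′, which span a K₄ - e, while
-- exchanging A and W on the remaining vertices shows that only the edge ab is left.
module Submission where

open import Defs renaming (sym to adj-sym; irrefl to adj-irrefl)
open import Data.Bool using (Bool; true; false; T; _∧_; _∨_; not; if_then_else_)
import Data.Bool.Properties as Bool
open import Data.Bool.Properties using (T-≡; ∧-comm; ∨-comm; ∧-zeroʳ; ∧-identityʳ; ∨-identityʳ; not-involutive; ⇔→≡)
open import Data.Nat hiding (_≟_)
open import Data.Nat.Properties hiding (_≟_)
open import Relation.Binary.Definitions using (tri<; tri≈; tri>)
open import Data.Fin using (Fin; zero; suc; toℕ; fromℕ<; _≟_)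
open import Data.Product using (∃-syntax; _×_; _,_; proj₁; proj₂)
open import Data.Sum using (_⊎_; inj₁; inj₂; [_,_]′)
open import Data.Empty using (⊥)
open import Relation.Nullary using (¬_; Dec; yes; no; does; contradiction)
open import Relation.Nullary.Decidable using (dec-true; dec-false; _×-dec_)
open import Relation.Binary.PropositionalEquality using (_≡_; _≢_; refl; sym; trans; cong; cong₂; subst; subst₂; module ≡-Reasoning)
open import Function using (_∘_; id)
open import Function.Bundles using (_⇔_; mk⇔; _↔_; mk↔ₛ′; Inverse; Equivalence)
open import Algebra.Properties.Semiring.Sum +-*-semiring
  using (sum; sum-cong-≗; ∑-distrib-+; ∑-comm; *-distribˡ-sum; *-distribʳ-sum; sum-replicate-zero; sum-permute)
open import Data.Nat.Solver using (module +-*-Solver)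
open +-*-Solver using (solve; _:=_; _:+_; _:*_; con)
open import Data.Vec using (lookup; tabulate) renaming ([] to []ᵥ; _∷_ to _∷ᵥ_)
open import Data.Vec.Properties using (lookup∘tabulate; tabulate∘lookup; tabulate-cong; ∷-injective)
open import Data.Fin.Subset using (Subset; ∣_∣)
open import Data.List using (List; []; _∷_; map; _++_; allFin) renaming (lookup to lookupₗ)
open import Data.List.Properties using (map-++; map-∘; map-cong)
open import Data.List.Relation.Unary.All using (All; []; _∷_)
import Data.List.Relation.Unary.All as All
open import Data.List.Relation.Unary.All.Properties using (all⁺; all⁻)
open import Data.List.Relation.Unary.AllPairs using ([]; _∷_)
open import Data.List.Relation.Unary.Any using (here; there)
open import Data.List.Relation.Unary.Unique.Propositional using (Unique)
import Data.List.Relation.Unary.Unique.Propositional.Properties as Unique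
open import Data.List.Membership.Propositional using (_∈_)
open import Data.List.Membership.Propositional.Properties using (∈-allFin; ∈-map⁺; ∈-map⁻; ∈-++⁺ˡ; ∈-++⁺ʳ; ∈-lookup)
open import Data.Nat.ListAction using () renaming (sum to sumₗ)
open import Data.Nat.ListAction.Properties using (sum-++; sum-↭)
open import Data.Fin.Properties using (toℕ-injective; toℕ<n; toℕ-fromℕ<; injective⇒≤; any?)
open import Data.List.Relation.Binary.Permutation.Propositional using (_↭_)
open import Data.List.Relation.Binary.Permutation.Propositional.Properties using () renaming (map⁺ to ↭-map⁺)
open import Data.List.Relation.Binary.BagAndSetEquality using (∼bag⇒↭)
open import Data.List.Membership.Propositional.Properties.WithK using (unique∧set⇒bag)
open import Data.Fin.Permutation using (↔⇒≡)
open import Data.Fin.Patterns using (0F; 1F; 2F; 3F; 4F; 5F)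

-- The converse direction rests on vertex 0 of `C` and of `D`, on N vertices each: deleting it
-- leaves a path on N - 1 vertices, deleting its two neighbours as well leaves a path on N - 3, in
-- both graphs. Goodman's identity enters because i₃ counts triangles of the complement, while only
-- the total over a graph and its complement is determined by the degrees. Compared with the even
-- cycle, which is 2-regular and triangle-free, this makes the triangles pay for every deviation
-- from degree 2. Each case therefore first bounds the triangles, by a partition into three
-- independent classes, and reads off the degrees afterwards. Connectedness is never given. It is
-- extracted from the number of maximum independent sets: where a union of components is 2-regular
-- and each of its edges crosses between A and its complement, both sides are equally large, so A
-- can be flipped there without changing its size. The walk that builds the cycle asks for
-- connectedness in exactly this form.

⟦_⟧ : Bool → ℕ
⟦ b ⟧ = if b then 1 else 0

⟦⟧-∧ : ∀ a b → ⟦ a ∧ b ⟧ ≡ ⟦ a ⟧ * ⟦ b ⟧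
⟦⟧-∧ true  b = sym (+-identityʳ ⟦ b ⟧)
⟦⟧-∧ false b = refl

-- Finite sums of natural numbers

sum-mono : ∀ {n} {f g : Fin n → ℕ} → (∀ i → f i ≤ g i) → sum f ≤ sum g
sum-mono {zero}  h = z≤n
sum-mono {suc n} h = +-mono-≤ (h zero) (sum-mono (h ∘ suc))

sum-zero : ∀ {n} {f : Fin n → ℕ} → (∀ i → f i ≡ 0) → sum f ≡ 0
sum-zero {n} h = trans (sum-cong-≗ h) (sum-replicate-zero n)

sum-const : ∀ n c → sum {n} (λ _ → c) ≡ n * c
sum-const zero    c = refl
sum-const (suc n) c = cong (c +_) (sum-const n c)

δ : ∀ {n} → Fin n → Fin n → ℕ
δ i j = ⟦ does (i ≟ j) ⟧

δ-refl : ∀ {n} (i : Fin n) → δ i i ≡ 1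
δ-refl i = cong ⟦_⟧ (dec-true (i ≟ i) refl)

sum-δ : ∀ {n} (i : Fin n) (f : Fin n → ℕ) → sum (λ j → δ i j * f j) ≡ f i
sum-δ {suc n} zero    f = trans (cong₂ _+_ (+-identityʳ (f zero)) (sum-zero {n} (λ _ → refl))) (+-identityʳ _)
sum-δ {suc n} (suc i) f = sum-δ i (f ∘ suc)

sum-δ₁ : ∀ {n} (i : Fin n) → sum (δ i) ≡ 1
sum-δ₁ i = trans (sum-cong-≗ (λ j → sym (*-identityʳ (δ i j)))) (sum-δ i (λ _ → 1))

infixl 6 _∖_
-- The entry is set to 0 instead of being dropped, so that the index type stays the same and several
-- indices can be removed in succession.
_∖_ : ∀ {n} → (Fin n → ℕ) → Fin n → (Fin n → ℕ)
(f ∖ i) j = if does (i ≟ j) then 0 else f j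

∖-other : ∀ {n} (f : Fin n → ℕ) {i j : Fin n} → i ≢ j → (f ∖ i) j ≡ f j
∖-other f {i} {j} i≢j with i ≟ j
... | yes p = contradiction p i≢j
... | no  _ = refl

sum-extract : ∀ {n} (f : Fin n → ℕ) i → sum f ≡ f i + sum (f ∖ i)
sum-extract f i = begin
  sum f                                           ≡⟨ sum-cong-≗ split ⟩
  sum (λ j → δ i j * f j + (f ∖ i) j)             ≡⟨ ∑-distrib-+ (λ j → δ i j * f j) (f ∖ i) ⟩
  sum (λ j → δ i j * f j) + sum (f ∖ i)           ≡⟨ cong (_+ sum (f ∖ i)) (sum-δ i f) ⟩
  f i + sum (f ∖ i)                               ∎
  where
  open ≡-Reasoning
  split : ∀ j → f j ≡ δ i j * f j + (f ∖ i) j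
  split j with does (i ≟ j)
  ... | true  = sym (trans (+-identityʳ _) (+-identityʳ _))
  ... | false = refl

term≤sum : ∀ {n} (f : Fin n → ℕ) i → f i ≤ sum f
term≤sum f i = subst (f i ≤_) (sym (sum-extract f i)) (m≤m+n _ _)

sum≡0⇒≡0 : ∀ {n} {f : Fin n → ℕ} → sum f ≡ 0 → ∀ i → f i ≡ 0
sum≡0⇒≡0 {f = f} e i = n≤0⇒n≡0 (subst (f i ≤_) e (term≤sum f i))

positive-term : ∀ {n} (f : Fin n → ℕ) → 0 < sum f → ∃[ i ] 0 < f i
positive-term {suc n} f lt with f zero in eq
... | suc _ = zero , subst (0 <_) (sym eq) z<s
... | zero  with positive-term (f ∘ suc) lt
...   | i , p = suc i , p

-- A strict increase at `i` could not be made up for elsewhere, where f ≤ g as well.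
sum-squeeze : ∀ {n} {f g : Fin n → ℕ} → (∀ i → f i ≤ g i) → sum g ≤ sum f → ∀ i → f i ≡ g i
sum-squeeze {f = f} {g} f≤g Σg≤Σf i = ≤-antisym (f≤g i) (+-cancelʳ-≤ (sum (f ∖ i)) (g i) (f i) (begin
  g i + sum (f ∖ i)  ≤⟨ +-monoʳ-≤ (g i) (sum-mono le) ⟩
  g i + sum (g ∖ i)  ≡⟨ sym (sum-extract g i) ⟩
  sum g              ≤⟨ Σg≤Σf ⟩
  sum f              ≡⟨ sum-extract f i ⟩
  f i + sum (f ∖ i)  ∎))
  where
  open ≤-Reasoning
  le : ∀ j → (f ∖ i) j ≤ (g ∖ i) j
  le j with does (i ≟ j)
  ... | true  = z≤n
  ... | false = f≤g j

-- Counting independent sets by recursion on the vertices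

Relation : ℕ → Set
Relation n = Fin n → Fin n → Bool

tail₂ : ∀ {n} → Relation (suc n) → Relation n
tail₂ a i j = a (suc i) (suc j)

infix 4 _⊆_
_⊆_ : ∀ {n} → (Fin n → Bool) → (Fin n → Bool) → Set
S ⊆ U = ∀ i → S i ≡ true → U i ≡ true

Independent : ∀ {n} → Relation n → (Fin n → Bool) → Set
Independent a S = ∀ i j → S i ≡ true → S j ≡ true → a i j ≡ false

allowed : ∀ {n} → Relation (suc n) → (Fin (suc n) → Bool) → Fin n → Bool
allowed a p j = p (suc j) ∧ not (a zero (suc j))

-- The number of independent k-sets inside p, by deciding vertex 0 first; only the part of a
-- above the diagonal is read.
count : ∀ {n} → Relation n → (Fin n → Bool) → ℕ → ℕ
count         a p zero    = 1
count {zero}  a p (suc k) = 0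
count {suc n} a p (suc k) = ⟦ p zero ⟧ * count (tail₂ a) (allowed a p) k + count (tail₂ a) (p ∘ suc) (suc k)

-- The link between `isIndependent`, which tests all pairs, and `count`: a test of one set that
-- follows the recursion of `count`, with `p` as the set of vertices still permitted.
isGood : ∀ {n} → Relation n → (Fin n → Bool) → Subset n → Bool
isGood a p []ᵥ           = true
isGood a p (true  ∷ᵥ S) = p zero ∧ isGood (tail₂ a) (allowed a p) S
isGood a p (false ∷ᵥ S) = isGood (tail₂ a) (p ∘ suc) S

∧-true : ∀ {x y} → x ∧ y ≡ true → x ≡ true × y ≡ true
∧-true {true} {true} _ = refl , refl

not-true : ∀ {x} → not x ≡ true → x ≡ false
not-true {false} _ = refl

-- `isGood` reads `a i j` for i < j only; symmetry and irreflexivity supply the remaining entries of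
-- `Independent`.
isGood⇒ : ∀ {n} {a : Relation n} (p : Fin n → Bool) → (∀ i j → a i j ≡ a j i) → (∀ i → a i i ≡ false) →
  ∀ S → isGood a p S ≡ true → Independent a (lookup S) × lookup S ⊆ p
isGood⇒ p s r []ᵥ g = (λ ()) , (λ ())
isGood⇒ {suc n} {a} p s r (true ∷ᵥ S) g with ∧-true g
... | p0 , g′ with isGood⇒ (allowed a p) (λ i j → s (suc i) (suc j)) (r ∘ suc) S g′
...   | I , sub = I′ , sub′
  where
  I′ : Independent a (lookup (true ∷ᵥ S))
  I′ zero    zero    _ _ = r zero
  I′ zero    (suc j) _ u = not-true (proj₂ (∧-true (sub j u)))
  I′ (suc i) zero    t _ = trans (s (suc i) zero) (not-true (proj₂ (∧-true (sub i t))))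
  I′ (suc i) (suc j) t u = I i j t u
  sub′ : lookup (true ∷ᵥ S) ⊆ p
  sub′ zero    _ = p0
  sub′ (suc i) t = proj₁ (∧-true (sub i t))
isGood⇒ {suc n} {a} p s r (false ∷ᵥ S) g with isGood⇒ (p ∘ suc) (λ i j → s (suc i) (suc j)) (r ∘ suc) S g
... | I , sub = I′ , sub′
  where
  I′ : Independent a (lookup (false ∷ᵥ S))
  I′ (suc i) (suc j) t u = I i j t u
  sub′ : lookup (false ∷ᵥ S) ⊆ p
  sub′ (suc i) t = sub i t

⇒isGood : ∀ {n} {a : Relation n} (p : Fin n → Bool) → ∀ S → Independent a (lookup S) → lookup S ⊆ p → isGood a p S ≡ true
⇒isGood p []ᵥ I sub = refl
⇒isGood {suc n} {a} p (true ∷ᵥ S) I sub =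
  cong₂ _∧_ (sub zero refl) (⇒isGood (allowed a p) S (λ i j → I (suc i) (suc j))
    (λ i t → cong₂ (λ x y → x ∧ not y) (sub (suc i) t) (I zero (suc i) refl t)))
⇒isGood p (false ∷ᵥ S) I sub = ⇒isGood (p ∘ suc) S (λ i j → I (suc i) (suc j)) (λ i → sub (suc i))

T⇒≡ : ∀ {b} → T b → b ≡ true
T⇒≡ = Equivalence.to T-≡

≡⇒T : ∀ {b} → b ≡ true → T b
≡⇒T = Equivalence.from T-≡

isIndependent⇒ : ∀ {n} (G : Graph n) S → isIndependent G S ≡ true → Independent (adj G) (lookup S)
isIndependent⇒ {n} G S e i j t u =
  subst₂ (λ x y → not (x ∧ y ∧ adj G i j) ≡ true → adj G i j ≡ false) (sym t) (sym u) not-true (T⇒≡ entry)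
  where
  entry : T (not (lookup S i ∧ lookup S j ∧ adj G i j))
  entry = All.lookup (all⁺ _ (allFin n) (All.lookup (all⁺ _ (allFin n) (≡⇒T e)) (∈-allFin i))) (∈-allFin j)

⇒isIndependent : ∀ {n} (G : Graph n) S → Independent (adj G) (lookup S) → isIndependent G S ≡ true
⇒isIndependent {n} G S I =
  T⇒≡ (all⁻ _ (All.universal (λ i → all⁻ _ (All.universal (λ j → ≡⇒T (entry i j)) (allFin n))) (allFin n)))
  where
  entry : ∀ i j → not (lookup S i ∧ lookup S j ∧ adj G i j) ≡ true
  entry i j with lookup S i in t | lookup S j in u
  ... | false | _     = refl
  ... | true  | false = refl
  ... | true  | true  = cong not (I i j t u)

isIndependent≡isGood : ∀ {n} (G : Graph n) S → isIndependent G S ≡ isGood (adj G) (λ _ → true) S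
isIndependent≡isGood G S = ⇔→≡ (mk⇔
  (λ e → ⇒isGood _ S (isIndependent⇒ G S e) (λ _ _ → refl))
  (λ e → ⇒isIndependent G S (proj₁ (isGood⇒ _ (adj-sym G) (adj-irrefl G) S e))))

sumₗ-zero : ∀ {A : Set} (f : A → ℕ) xs → (∀ x → f x ≡ 0) → sumₗ (map f xs) ≡ 0
sumₗ-zero f []       h = refl
sumₗ-zero f (x ∷ xs) h = cong₂ _+_ (h x) (sumₗ-zero f xs h)

sum-allSubsets : ∀ {n} (f : Subset (suc n) → ℕ) →
  sumₗ (map f (allSubsets (suc n))) ≡
  sumₗ (map (f ∘ (true ∷ᵥ_)) (allSubsets n)) + sumₗ (map (f ∘ (false ∷ᵥ_)) (allSubsets n))
sum-allSubsets {n} f = begin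
  sumₗ (map f (xs ++ ys))                     ≡⟨ cong sumₗ (map-++ f xs ys) ⟩
  sumₗ (map f xs ++ map f ys)                 ≡⟨ sum-++ (map f xs) (map f ys) ⟩
  sumₗ (map f xs) + sumₗ (map f ys)           ≡⟨ cong₂ (λ u v → sumₗ u + sumₗ v) (sym (map-∘ (allSubsets n))) (sym (map-∘ (allSubsets n))) ⟩
  _                                           ∎
  where
  open ≡-Reasoning
  xs = map (true ∷ᵥ_) (allSubsets n)
  ys = map (false ∷ᵥ_) (allSubsets n)

sum-good : ∀ {n} (a : Relation n) p k →
  sumₗ (map (λ S → ⟦ isGood a p S ∧ (∣ S ∣ ≡ᵇ k) ⟧) (allSubsets n)) ≡ count a p k
sum-good {zero} a p zero = refl
sum-good {zero} a p (suc k) = refl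
sum-good {suc n} a p zero = trans (sum-allSubsets {n} _)
  (cong₂ _+_ (sumₗ-zero _ (allSubsets n) (λ S → cong ⟦_⟧ (∧-zeroʳ _))) (sum-good (tail₂ a) (p ∘ suc) zero))
sum-good {suc n} a p (suc k) = trans (sum-allSubsets {n} _)
  (cong₂ _+_ (with-zero (p zero)) (sum-good (tail₂ a) (p ∘ suc) (suc k)))
  where
  with-zero : ∀ b → sumₗ (map (λ S → ⟦ (b ∧ isGood (tail₂ a) (allowed a p) S) ∧ (∣ S ∣ ≡ᵇ k) ⟧) (allSubsets n))
    ≡ ⟦ b ⟧ * count (tail₂ a) (allowed a p) k
  with-zero true  = trans (sum-good (tail₂ a) (allowed a p) k) (sym (+-identityʳ _))
  with-zero false = sumₗ-zero _ (allSubsets n) (λ _ → refl)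

indepCoeff≡count : ∀ {n} (G : Graph n) k → indepCoeff G k ≡ count (adj G) (λ _ → true) k
indepCoeff≡count {n} G k = trans
  (cong sumₗ (map-cong (λ S → cong (λ b → ⟦ b ∧ (∣ S ∣ ≡ᵇ k) ⟧) (isIndependent≡isGood G S)) (allSubsets n)))
  (sum-good (adj G) (λ _ → true) k)

count-cong : ∀ {n} {a b : Relation n} {p q} → (∀ i j → a i j ≡ b i j) → (∀ i → p i ≡ q i) → ∀ k → count a p k ≡ count b q k
count-cong h g zero = refl
count-cong {zero} h g (suc k) = refl
count-cong {suc n} h g (suc k) = cong₂ _+_
  (cong₂ _*_ (cong ⟦_⟧ (g zero))
    (count-cong (λ i j → h (suc i) (suc j)) (λ j → cong₂ (λ x y → x ∧ not y) (g (suc j)) (h zero (suc j))) k))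
  (count-cong (λ i j → h (suc i) (suc j)) (g ∘ suc) (suc k))

-- The coefficients i₂ and i₃ as sums over pairs and triples

sum< : ∀ {n} → (Fin n → Fin n → ℕ) → ℕ
sum< {zero}  f = 0
sum< {suc n} f = sum (λ j → f zero (suc j)) + sum< (λ i j → f (suc i) (suc j))

sum<< : ∀ {n} → (Fin n → Fin n → Fin n → ℕ) → ℕ
sum<< {zero}  f = 0
sum<< {suc n} f = sum< (λ j k → f zero (suc j) (suc k)) + sum<< (λ i j k → f (suc i) (suc j) (suc k))

*-sum< : ∀ {n} c (f : Fin n → Fin n → ℕ) → c * sum< f ≡ sum< (λ i j → c * f i j)
*-sum< {zero}  c f = *-zeroʳ c
*-sum< {suc n} c f = trans (*-distribˡ-+ c _ (sum< (λ i j → f (suc i) (suc j))))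
  (cong₂ _+_ (*-distribˡ-sum {n} c _) (*-sum< c (λ i j → f (suc i) (suc j))))

count₁ : ∀ {n} (a : Relation n) p → count a p 1 ≡ sum (⟦_⟧ ∘ p)
count₁ {zero}  a p = refl
count₁ {suc n} a p = cong₂ _+_ (*-identityʳ _) (count₁ (tail₂ a) (p ∘ suc))

count₂ : ∀ {n} (a : Relation n) p → count a p 2 ≡ sum< (λ i j → ⟦ p i ⟧ * ⟦ p j ∧ not (a i j) ⟧)
count₂ {zero}  a p = refl
count₂ {suc n} a p = cong₂ _+_
  (trans (cong (⟦ p zero ⟧ *_) (count₁ (tail₂ a) (allowed a p))) (*-distribˡ-sum {n} ⟦ p zero ⟧ _))
  (count₂ (tail₂ a) (p ∘ suc))

-- The summand is lopsided because `allowed` restricts j by i, and then k by i and by j, in the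
-- order in which `count` decides the vertices.
count₃ : ∀ {n} (a : Relation n) p →
  count a p 3 ≡ sum<< (λ i j k → ⟦ p i ⟧ * (⟦ p j ∧ not (a i j) ⟧ * ⟦ (p k ∧ not (a i k)) ∧ not (a j k) ⟧))
count₃ {zero}  a p = refl
count₃ {suc n} a p = cong₂ _+_
  (trans (cong (⟦ p zero ⟧ *_) (count₂ (tail₂ a) (allowed a p))) (*-sum< {n} ⟦ p zero ⟧ _))
  (count₃ (tail₂ a) (p ∘ suc))

sum<-cong : ∀ {n} {f g : Fin n → Fin n → ℕ} → (∀ i j → i ≢ j → f i j ≡ g i j) → sum< f ≡ sum< g
sum<-cong {zero}  h = refl
sum<-cong {suc n} h = cong₂ _+_ (sum-cong-≗ (λ j → h zero (suc j) (λ ())))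
  (sum<-cong (λ i j i≢j → h (suc i) (suc j) (λ { refl → i≢j refl })))

sum<<-cong : ∀ {n} {f g : Fin n → Fin n → Fin n → ℕ} →
  (∀ i j k → i ≢ j → i ≢ k → j ≢ k → f i j k ≡ g i j k) → sum<< f ≡ sum<< g
sum<<-cong {zero}  h = refl
sum<<-cong {suc n} h = cong₂ _+_
  (sum<-cong (λ j k j≢k → h zero (suc j) (suc k) (λ ()) (λ ()) (λ { refl → j≢k refl })))
  (sum<<-cong (λ i j k p q r → h (suc i) (suc j) (suc k) (λ { refl → p refl }) (λ { refl → q refl }) (λ { refl → r refl })))

sum₂ : ∀ {n} → (Fin n → Fin n → ℕ) → ℕ
sum₂ f = sum (λ i → sum (f i))

sum₃ : ∀ {n} → (Fin n → Fin n → Fin n → ℕ) → ℕ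
sum₃ f = sum (λ i → sum₂ (f i))

sum₂-cong : ∀ {n} {f g : Fin n → Fin n → ℕ} → (∀ i j → f i j ≡ g i j) → sum₂ f ≡ sum₂ g
sum₂-cong h = sum-cong-≗ (λ i → sum-cong-≗ (h i))

sum₃-cong : ∀ {n} {f g : Fin n → Fin n → Fin n → ℕ} → (∀ i j k → f i j k ≡ g i j k) → sum₃ f ≡ sum₃ g
sum₃-cong h = sum-cong-≗ (λ i → sum₂-cong (h i))

sum₂-+ : ∀ {n} (f g : Fin n → Fin n → ℕ) → sum₂ (λ i j → f i j + g i j) ≡ sum₂ f + sum₂ g
sum₂-+ f g = trans (sum-cong-≗ (λ i → ∑-distrib-+ (f i) (g i))) (∑-distrib-+ (λ i → sum (f i)) (λ i → sum (g i)))

sum₃-+ : ∀ {n} (f g : Fin n → Fin n → Fin n → ℕ) → sum₃ (λ i j k → f i j k + g i j k) ≡ sum₃ f + sum₃ g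
sum₃-+ f g = trans (sum-cong-≗ (λ i → sum₂-+ (f i) (g i))) (∑-distrib-+ (λ i → sum₂ (f i)) (λ i → sum₂ (g i)))

sum₂-symmetric : ∀ {n} (f : Fin n → Fin n → ℕ) → (∀ i j → f i j ≡ f j i) → (∀ i → f i i ≡ 0) → sum₂ f ≡ 2 * sum< f
sum₂-symmetric {zero}  f s d = refl
sum₂-symmetric {suc n} f s d = begin
  (f zero zero + R) + sum (λ i → f (suc i) zero + sum (λ j → f (suc i) (suc j)))
    ≡⟨ cong₂ (λ x y → (x + R) + y) (d zero) (∑-distrib-+ (λ i → f (suc i) zero) _) ⟩
  R + (sum (λ i → f (suc i) zero) + sum₂ (λ i j → f (suc i) (suc j)))
    ≡⟨ cong₂ (λ x y → R + (x + y)) (sum-cong-≗ (λ i → s (suc i) zero)) (sum₂-symmetric f⁺ (λ i j → s (suc i) (suc j)) (d ∘ suc)) ⟩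
  R + (R + 2 * sum< f⁺)
    ≡⟨ solve 2 (λ r x → r :+ (r :+ con 2 :* x) := con 2 :* (r :+ x)) refl R (sum< f⁺) ⟩
  2 * (R + sum< f⁺) ∎
  where
  open ≡-Reasoning
  f⁺ = λ i j → f (suc i) (suc j)
  R = sum (λ j → f zero (suc j))

-- The two transpositions generate all permutations, so vanishing for i = j gives vanishing whenever
-- two arguments agree. Triples with vertex 0 in the first, second or third place contribute the
-- same `Z` each, and `Z` is twice a sum over j < k: hence 3 · 2 = 6.
sum₃-symmetric : ∀ {n} (f : Fin n → Fin n → Fin n → ℕ) →
  (∀ i j k → f i j k ≡ f j i k) → (∀ i j k → f i j k ≡ f i k j) → (∀ i k → f i i k ≡ 0) → sum₃ f ≡ 6 * sum<< f
sum₃-symmetric {zero}  f s t d = refl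
sum₃-symmetric {suc n} f s t d = begin
  sum₂ (f zero) + sum (λ i → sum₂ (f (suc i)))
    ≡⟨ cong₂ _+_ head-part (sum-cong-≗ tail-part) ⟩
  Z + sum (λ i → sum (f₀ i) + (sum (f₀ i) + sum₂ (f⁺ i)))
    ≡⟨ cong (Z +_) (trans (∑-distrib-+ (λ i → sum (f₀ i)) _) (cong (Z +_) (∑-distrib-+ (λ i → sum (f₀ i)) (λ i → sum₂ (f⁺ i))))) ⟩
  Z + (Z + (Z + sum₃ f⁺))
    ≡⟨ cong₂ (λ x y → x + (x + (x + y))) (sum₂-symmetric f₀ (λ j k → t zero (suc j) (suc k)) (λ j → trans (s _ _ _) (trans (t _ _ _) (d _ _))))
        (sum₃-symmetric f⁺ (λ i j k → s _ _ _) (λ i j k → t _ _ _) (λ i k → d _ _)) ⟩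
  2 * sum< f₀ + (2 * sum< f₀ + (2 * sum< f₀ + 6 * sum<< f⁺))
    ≡⟨ solve 2 (λ x y → con 2 :* x :+ (con 2 :* x :+ (con 2 :* x :+ con 6 :* y)) := con 6 :* (x :+ y)) refl (sum< f₀) (sum<< f⁺) ⟩
  6 * (sum< f₀ + sum<< f⁺) ∎
  where
  open ≡-Reasoning
  f⁺ = λ i j k → f (suc i) (suc j) (suc k)
  f₀ = λ j k → f zero (suc j) (suc k)
  Z = sum₂ f₀
  head-part : sum₂ (f zero) ≡ Z
  head-part = cong₂ _+_ (sum-zero (λ k → d zero k))
    (sum-cong-≗ (λ j → cong (_+ sum (f₀ j)) (trans (t zero (suc j) zero) (d zero (suc j)))))
  tail-part : ∀ i → sum₂ (f (suc i)) ≡ sum (f₀ i) + (sum (f₀ i) + sum₂ (f⁺ i))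
  tail-part i = cong₂ _+_
    (cong₂ _+_ (trans (s (suc i) zero zero) (trans (t _ _ _) (d zero (suc i)))) (sum-cong-≗ (λ k → s (suc i) zero (suc k))))
    (trans (∑-distrib-+ (λ j → f (suc i) (suc j) zero) (λ j → sum (f⁺ i j)))
      (cong (_+ sum₂ (f⁺ i)) (sum-cong-≗ (λ j → trans (t (suc i) (suc j) zero) (s _ _ _)))))

-- Adjacency in the complement graph. Excluding the diagonal lets sums over all tuples see distinct
-- vertices only.
nonAdj : ∀ {n} → Graph n → Fin n → Fin n → Bool
nonAdj G i j = not (does (i ≟ j)) ∧ not (adj G i j)

does-≟-sym : ∀ {n} (i j : Fin n) → does (i ≟ j) ≡ does (j ≟ i)
does-≟-sym i j = ⇔→≡ (mk⇔ (flip i j) (flip j i))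
  where
  flip : ∀ x y → does (x ≟ y) ≡ true → does (y ≟ x) ≡ true
  flip x y e with x ≟ y
  flip x y e | yes p = dec-true (y ≟ x) (sym p)
  flip x y () | no _

nonAdj-sym : ∀ {n} (G : Graph n) i j → nonAdj G i j ≡ nonAdj G j i
nonAdj-sym G i j = cong₂ (λ x y → not x ∧ not y) (does-≟-sym i j) (adj-sym G i j)

nonAdj-irrefl : ∀ {n} (G : Graph n) i → nonAdj G i i ≡ false
nonAdj-irrefl G i = cong (λ x → not x ∧ not (adj G i i)) (dec-true (i ≟ i) refl)

nonAdj-≢ : ∀ {n} (G : Graph n) {i j} → i ≢ j → not (adj G i j) ≡ nonAdj G i j
nonAdj-≢ G {i} {j} i≢j = cong (λ x → not x ∧ not (adj G i j)) (sym (dec-false (i ≟ j) i≢j))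

tri : Bool → Bool → Bool → ℕ
tri x y z = ⟦ x ⟧ * (⟦ y ⟧ * ⟦ z ⟧)

indepCoeff₁ : ∀ {n} (G : Graph n) → indepCoeff G 1 ≡ n
indepCoeff₁ {n} G = trans (indepCoeff≡count G 1) (trans (count₁ (adj G) _) (trans (sum-const n 1) (*-identityʳ n)))

indepCoeff₂ : ∀ {n} (G : Graph n) → 2 * indepCoeff G 2 ≡ sum₂ (λ i j → ⟦ nonAdj G i j ⟧)
indepCoeff₂ {n} G = trans
  (cong (2 *_) (trans (indepCoeff≡count G 2) (trans (count₂ (adj G) _)
    (sum<-cong (λ i j i≢j → trans (+-identityʳ _) (cong ⟦_⟧ (nonAdj-≢ G i≢j)))))))
  (sym (sum₂-symmetric (λ i j → ⟦ nonAdj G i j ⟧) (λ i j → cong ⟦_⟧ (nonAdj-sym G i j)) (λ i → cong ⟦_⟧ (nonAdj-irrefl G i))))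

tri-rot : ∀ x y z → tri x y z ≡ tri x z y
tri-rot x y z = cong (⟦ x ⟧ *_) (*-comm ⟦ y ⟧ ⟦ z ⟧)

tri-swap : ∀ x y z → tri x y z ≡ tri z y x
tri-swap false y false = refl
tri-swap false false true = refl
tri-swap false true true = refl
tri-swap true false false = refl
tri-swap true true false = refl
tri-swap true y true = refl

-- An independent triple is a triangle of the complement, met six times by the sum over all ordered
-- triples; in this unrestricted form the order of summation can be changed freely.
indepCoeff₃ : ∀ {n} (G : Graph n) →
  6 * indepCoeff G 3 ≡ sum₃ (λ i j k → tri (nonAdj G i j) (nonAdj G i k) (nonAdj G j k))
indepCoeff₃ {n} G = trans
  (cong (6 *_) (trans (indepCoeff≡count G 3) (trans (count₃ (adj G) _) (sum<<-cong convert))))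
  (sym (sum₃-symmetric f
    (λ i j k → trans (tri-rot (b i j) (b i k) (b j k)) (cong (λ x → tri x (b j k) (b i k)) (nonAdj-sym G i j)))
    (λ i j k → trans (cong (tri (b i j) (b i k)) (nonAdj-sym G j k)) (swap₁₂ (b i j) (b i k) (b k j)))
    (λ i k → cong (λ x → tri x (b i k) (b i k)) (nonAdj-irrefl G i))))
  where
  b = nonAdj G
  f = λ i j k → tri (b i j) (b i k) (b j k)
  swap₁₂ : ∀ x y z → tri x y z ≡ tri y x z
  swap₁₂ x y z = trans (tri-rot x y z) (trans (tri-swap x z y) (tri-rot y z x))
  convert : ∀ i j k → i ≢ j → i ≢ k → j ≢ k →
    1 * (⟦ not (adj G i j) ⟧ * ⟦ not (adj G i k) ∧ not (adj G j k) ⟧) ≡ f i j k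
  convert i j k p q r = trans (+-identityʳ _) (cong₂ _*_ (cong ⟦_⟧ (nonAdj-≢ G p))
    (trans (⟦⟧-∧ (not (adj G i k)) _) (cong₂ (λ x y → ⟦ x ⟧ * ⟦ y ⟧) (nonAdj-≢ G q) (nonAdj-≢ G r))))

-- Degrees, triangles and Goodman's identity

degIn : ∀ {n} → Graph n → (Fin n → Bool) → Fin n → ℕ
degIn G S v = sum (λ u → ⟦ S u ∧ adj G v u ⟧)

deg : ∀ {n} → Graph n → Fin n → ℕ
deg G v = sum (λ u → ⟦ adj G v u ⟧)

nonDeg : ∀ {n} → Graph n → Fin n → ℕ
nonDeg G v = sum (λ u → ⟦ nonAdj G v u ⟧)

-- Ordered triples are counted, so this is six times the number of triangles; the factors 3 and 6 in
-- the bounds below come from here.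
triangles : ∀ {n} → Graph n → ℕ
triangles G = sum₃ (λ i j k → tri (adj G i j) (adj G i k) (adj G j k))

unequal : ∀ {n} → Fin n → Fin n → ℕ
unequal i j = ⟦ not (does (i ≟ j)) ⟧

adj+nonAdj : ∀ {n} (G : Graph n) i j → ⟦ adj G i j ⟧ + ⟦ nonAdj G i j ⟧ ≡ unequal i j
adj+nonAdj G i j with i ≟ j
... | yes refl = cong (λ x → ⟦ x ⟧ + 0) (adj-irrefl G i)
... | no _ with adj G i j
...   | true  = refl
...   | false = refl

unequal-deg : ∀ {n} (i : Fin n) → sum (unequal i) + 1 ≡ n
unequal-deg {n} i = begin
  sum (unequal i) + 1              ≡⟨ cong (sum (unequal i) +_) (sym (sum-δ₁ i)) ⟩
  sum (unequal i) + sum (δ i)      ≡⟨ sym (∑-distrib-+ (unequal i) (δ i)) ⟩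
  sum (λ j → unequal i j + δ i j)  ≡⟨ sum-cong-≗ one ⟩
  sum {n} (λ _ → 1)                ≡⟨ trans (sum-const n 1) (*-identityʳ n) ⟩
  n                                ∎
  where
  open ≡-Reasoning
  one : ∀ j → unequal i j + δ i j ≡ 1
  one j with does (i ≟ j)
  ... | true  = refl
  ... | false = refl

deg+nonDeg : ∀ {n} (G : Graph n) v → deg G v + nonDeg G v ≡ sum (unequal v)
deg+nonDeg G v = trans (sym (∑-distrib-+ (λ u → ⟦ adj G v u ⟧) (λ u → ⟦ nonAdj G v u ⟧))) (sum-cong-≗ (adj+nonAdj G v))

degree-sum : ∀ {m} (G H : Graph m) → indepCoeff G 2 ≡ indepCoeff H 2 → sum (deg G) ≡ sum (deg H)
degree-sum {m} G H e = +-cancelʳ-≡ (sum (nonDeg G)) _ _ (begin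
  sum (deg G) + sum (nonDeg G)  ≡⟨ total G ⟩
  sum₂ (unequal {m})            ≡⟨ sym (total H) ⟩
  sum (deg H) + sum (nonDeg H)  ≡⟨ cong (sum (deg H) +_) (trans (sym (indepCoeff₂ H)) (trans (cong (2 *_) (sym e)) (indepCoeff₂ G))) ⟩
  sum (deg H) + sum (nonDeg G)  ∎)
  where
  open ≡-Reasoning
  total : ∀ (G : Graph _) → sum (deg G) + sum (nonDeg G) ≡ sum₂ (unequal {m})
  total G = trans (sym (∑-distrib-+ (deg G) (nonDeg G))) (sum-cong-≗ (deg+nonDeg G))

-- Goodman's identity: among three distinct vertices, the number of corners joining an edge to
-- a non-edge is 0 if the triple is homogeneous and 2 otherwise.
goodman : ∀ {n} (G : Graph n) →
  2 * (triangles G + 6 * indepCoeff G 3) + 6 * sum (λ v → deg G v * nonDeg G v)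
    ≡ 2 * sum₃ (λ (i j k : Fin n) → unequal i j * (unequal i k * unequal j k))
goodman {n} G = begin
  2 * (sum₃ A + 6 * indepCoeff G 3) + 6 * X
    ≡⟨ cong (λ x → 2 * (sum₃ A + x) + 6 * X) (indepCoeff₃ G) ⟩
  2 * (sum₃ A + sum₃ B) + 6 * X
    ≡⟨ solve 3 (λ a b x → con 2 :* (a :+ b) :+ con 6 :* x := ((a :+ b) :+ (a :+ b)) :+ ((x :+ x) :+ ((x :+ x) :+ (x :+ x)))) refl (sum₃ A) (sum₃ B) X ⟩
  ((sum₃ A + sum₃ B) + (sum₃ A + sum₃ B)) + ((X + X) + ((X + X) + (X + X)))
    ≡⟨ cong₂ _+_ (cong₂ _+_ (sym (sum₃-+ A B)) (sym (sum₃-+ A B)))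
         (cong₂ _+_ (cong₂ _+_ (sym c₁) (sym c₁′)) (cong₂ _+_ (cong₂ _+_ (sym c₂) (sym c₂′)) (cong₂ _+_ (sym c₃) (sym c₃′)))) ⟩
  (sum₃ AB + sum₃ AB) + ((sum₃ C₁ + sum₃ C₁′) + ((sum₃ C₂ + sum₃ C₂′) + (sum₃ C₃ + sum₃ C₃′)))
    ≡⟨ sym (cong₂ _+_ (sum₃-+ AB AB) (cong₂ _+_ (sum₃-+ C₁ C₁′) (cong₂ _+_ (sum₃-+ C₂ C₂′) (sum₃-+ C₃ C₃′)))) ⟩
  sum₃ (λ i j k → AB i j k + AB i j k) + (sum₃ D₁ + (sum₃ D₂ + sum₃ D₃))
    ≡⟨ cong (λ x → sum₃ (λ i j k → AB i j k + AB i j k) + (sum₃ D₁ + x)) (sym (sum₃-+ D₂ D₃)) ⟩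
  sum₃ (λ i j k → AB i j k + AB i j k) + (sum₃ D₁ + sum₃ (λ i j k → D₂ i j k + D₃ i j k))
    ≡⟨ cong (sum₃ (λ i j k → AB i j k + AB i j k) +_) (sym (sum₃-+ D₁ (λ i j k → D₂ i j k + D₃ i j k))) ⟩
  sum₃ (λ i j k → AB i j k + AB i j k) + sum₃ (λ i j k → D₁ i j k + (D₂ i j k + D₃ i j k))
    ≡⟨ sym (sum₃-+ (λ i j k → AB i j k + AB i j k) (λ i j k → D₁ i j k + (D₂ i j k + D₃ i j k))) ⟩
  sum₃ (λ i j k → (AB i j k + AB i j k) + (D₁ i j k + (D₂ i j k + D₃ i j k)))
    ≡⟨ sum₃-cong pointwise ⟩
  sum₃ (λ i j k → U i j k + U i j k)
    ≡⟨ trans (sum₃-+ U U) (cong (sum₃ U +_) (sym (+-identityʳ (sum₃ U)))) ⟩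
  2 * sum₃ U ∎
  where
  open ≡-Reasoning
  a b : Fin n → Fin n → ℕ
  a i j = ⟦ adj G i j ⟧
  b i j = ⟦ nonAdj G i j ⟧
  X = sum (λ v → deg G v * nonDeg G v)
  A B AB C₁ C₁′ C₂ C₂′ C₃ C₃′ D₁ D₂ D₃ U : Fin n → Fin n → Fin n → ℕ
  A i j k = a i j * (a i k * a j k)
  B i j k = b i j * (b i k * b j k)
  AB i j k = A i j k + B i j k
  -- The corners at i, at j and at k; the primed version exchanges edge and non-edge. Each of the
  -- six families sums to `X`.
  C₁ i j k = a i j * b i k
  C₁′ i j k = b i j * a i k
  C₂ i j k = a j i * b j k
  C₂′ i j k = b j i * a j k
  C₃ i j k = a k i * b k j
  C₃′ i j k = b k i * a k j
  D₁ i j k = C₁ i j k + C₁′ i j k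
  D₂ i j k = C₂ i j k + C₂′ i j k
  D₃ i j k = C₃ i j k + C₃′ i j k
  U i j k = unequal i j * (unequal i k * unequal j k)
  sum-* : ∀ (f g : Fin n → ℕ) → sum f * sum g ≡ sum₂ (λ i j → f i * g j)
  sum-* f g = trans (*-distribʳ-sum {n} (sum g) f) (sum-cong-≗ (λ i → *-distribˡ-sum {n} (f i) g))
  c₁ : sum₃ C₁ ≡ X
  c₁ = sum-cong-≗ (λ i → sym (sum-* (a i) (b i)))
  c₁′ : sum₃ C₁′ ≡ X
  c₁′ = sum-cong-≗ (λ i → trans (sym (sum-* (b i) (a i))) (*-comm (nonDeg G i) (deg G i)))
  c₂ : sum₃ C₂ ≡ X
  c₂ = trans (∑-comm (λ i j → sum (C₂ i j))) c₁
  c₂′ : sum₃ C₂′ ≡ X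
  c₂′ = trans (∑-comm (λ i j → sum (C₂′ i j))) c₁′
  c₃ : sum₃ C₃ ≡ X
  c₃ = trans (sum-cong-≗ (λ i → ∑-comm (λ j k → C₃ i j k)))
    (trans (∑-comm (λ i k → sum (λ j → C₃ i j k))) c₁)
  c₃′ : sum₃ C₃′ ≡ X
  c₃′ = trans (sum-cong-≗ (λ i → ∑-comm (λ j k → C₃′ i j k)))
    (trans (∑-comm (λ i k → sum (λ j → C₃′ i j k))) c₁′)
  -- The identity for one ordered triple, with the pairs ij, ik, jk described by Booleans: `e` for
  -- coincidence, `a` for adjacency. If two vertices coincide, both sides vanish; for distinct
  -- vertices both are 2.
  Balanced : Bool → Bool → Bool → Bool → Bool → Bool → Set
  Balanced e₁ a₁ e₂ a₂ e₃ a₃ =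
    ((⟦ a₁ ⟧ * (⟦ a₂ ⟧ * ⟦ a₃ ⟧) + ⟦ b₁ ⟧ * (⟦ b₂ ⟧ * ⟦ b₃ ⟧)) + (⟦ a₁ ⟧ * (⟦ a₂ ⟧ * ⟦ a₃ ⟧) + ⟦ b₁ ⟧ * (⟦ b₂ ⟧ * ⟦ b₃ ⟧)))
      + ((⟦ a₁ ⟧ * ⟦ b₂ ⟧ + ⟦ b₁ ⟧ * ⟦ a₂ ⟧)
        + ((⟦ a₁ ⟧ * ⟦ b₃ ⟧ + ⟦ b₁ ⟧ * ⟦ a₃ ⟧) + (⟦ a₂ ⟧ * ⟦ b₃ ⟧ + ⟦ b₂ ⟧ * ⟦ a₃ ⟧)))
      ≡ ⟦ not e₁ ⟧ * (⟦ not e₂ ⟧ * ⟦ not e₃ ⟧) + ⟦ not e₁ ⟧ * (⟦ not e₂ ⟧ * ⟦ not e₃ ⟧)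
    where
    b₁ = not e₁ ∧ not a₁
    b₂ = not e₂ ∧ not a₂
    b₃ = not e₃ ∧ not a₃
  ij-equal : ∀ e a → Balanced true false e a e a
  ij-equal true  true  = refl
  ij-equal true  false = refl
  ij-equal false true  = refl
  ij-equal false false = refl
  ik-equal : ∀ e a → Balanced e a true false e a
  ik-equal true  true  = refl
  ik-equal true  false = refl
  ik-equal false true  = refl
  ik-equal false false = refl
  jk-equal : ∀ e a → Balanced e a e a true false
  jk-equal true  true  = refl
  jk-equal true  false = refl
  jk-equal false true  = refl
  jk-equal false false = refl
  distinct : ∀ a₁ a₂ a₃ → Balanced false a₁ false a₂ false a₃
  distinct true  true  true  = refl
  distinct true  true  false = refl
  distinct true  false true  = refl
  distinct true  false false = refl
  distinct false true  true  = refl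
  distinct false true  false = refl
  distinct false false true  = refl
  distinct false false false = refl
  balanced : ∀ i j k → Balanced (does (i ≟ j)) (adj G i j) (does (i ≟ k)) (adj G i k) (does (j ≟ k)) (adj G j k)
  balanced i j k with i ≟ j in p
  ... | yes refl rewrite adj-irrefl G i = ij-equal (does (i ≟ k)) (adj G i k)
  ... | no _ with i ≟ k
  ...   | yes refl rewrite adj-irrefl G i | adj-sym G j i | does-≟-sym j i | cong does p = ik-equal false (adj G i j)
  ...   | no _ with j ≟ k
  ...     | yes refl rewrite adj-irrefl G j = jk-equal false (adj G i j)
  ...     | no _ = distinct (adj G i j) (adj G i k) (adj G j k)
  pointwise : ∀ i j k → (AB i j k + AB i j k) + (D₁ i j k + (D₂ i j k + D₃ i j k)) ≡ U i j k + U i j k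
  pointwise i j k
    rewrite adj-sym G j i | adj-sym G k i | adj-sym G k j
          | does-≟-sym j i | does-≟-sym k i | does-≟-sym k j = balanced i j k

-- Goodman's identity fixes `triangles` + 3X by the order and i₃, where X is the sum of `deg` ·
-- `nonDeg`. With Q the sum of the squared degrees, Q + X is (m - 1) times the degree sum and so
-- fixed by i₂. Hence `triangles` - 3Q is an invariant; the crosswise form avoids the subtraction.
degree-squares : ∀ {m} (G H : Graph m) → indepCoeff G 2 ≡ indepCoeff H 2 → indepCoeff G 3 ≡ indepCoeff H 3 →
  triangles G + 3 * sum (λ v → deg H v * deg H v) ≡ triangles H + 3 * sum (λ v → deg G v * deg G v)
degree-squares {m} G H e₂ e₃ = +-cancelʳ-≡ (3 * X G) _ _ (begin
  triangles G + 3 * Q H + 3 * X G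
    ≡⟨ solve 3 (λ t q x → t :+ con 3 :* q :+ con 3 :* x := t :+ con 3 :* x :+ con 3 :* q) refl (triangles G) (Q H) (X G) ⟩
  triangles G + 3 * X G + 3 * Q H
    ≡⟨ cong (_+ 3 * Q H) triangles+X ⟩
  triangles H + 3 * X H + 3 * Q H
    ≡⟨ solve 3 (λ t x q → t :+ con 3 :* x :+ con 3 :* q := t :+ con 3 :* (q :+ x)) refl (triangles H) (X H) (Q H) ⟩
  triangles H + 3 * (Q H + X H)
    ≡⟨ cong (λ x → triangles H + 3 * x) (trans (Q+X H) (trans (cong (_* (m ∸ 1)) (sym (degree-sum G H e₂))) (sym (Q+X G)))) ⟩
  triangles H + 3 * (Q G + X G)
    ≡⟨ solve 3 (λ t x q → t :+ con 3 :* (q :+ x) := t :+ con 3 :* q :+ con 3 :* x) refl (triangles H) (X G) (Q G) ⟩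
  triangles H + 3 * Q G + 3 * X G ∎)
  where
  open ≡-Reasoning
  Q X : Graph m → ℕ
  Q G = sum (λ v → deg G v * deg G v)
  X G = sum (λ v → deg G v * nonDeg G v)
  Q+X : ∀ G → Q G + X G ≡ sum (deg G) * (m ∸ 1)
  Q+X G = begin
    Q G + X G
      ≡⟨ sym (∑-distrib-+ (λ v → deg G v * deg G v) (λ v → deg G v * nonDeg G v)) ⟩
    sum (λ v → deg G v * deg G v + deg G v * nonDeg G v)
      ≡⟨ sum-cong-≗ (λ v → trans (sym (*-distribˡ-+ (deg G v) (deg G v) (nonDeg G v))) (cong (deg G v *_) (all-others v))) ⟩
    sum (λ v → deg G v * (m ∸ 1))
      ≡⟨ sym (*-distribʳ-sum {m} (m ∸ 1) (deg G)) ⟩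
    sum (deg G) * (m ∸ 1) ∎
    where
    all-others : ∀ v → deg G v + nonDeg G v ≡ m ∸ 1
    all-others v = trans (deg+nonDeg G v) (trans (sym (m+n∸n≡m _ 1)) (cong (_∸ 1) (unequal-deg v)))
  triangles+X : triangles G + 3 * X G ≡ triangles H + 3 * X H
  triangles+X = *-cancelˡ-≡ _ _ 2 (+-cancelʳ-≡ (2 * (6 * indepCoeff G 3)) _ _ (begin
    2 * (triangles G + 3 * X G) + 2 * (6 * indepCoeff G 3)
      ≡⟨ regroup (triangles G) (X G) (indepCoeff G 3) ⟩
    2 * (triangles G + 6 * indepCoeff G 3) + 6 * X G
      ≡⟨ trans (goodman G) (sym (goodman H)) ⟩
    2 * (triangles H + 6 * indepCoeff H 3) + 6 * X H
      ≡⟨ sym (regroup (triangles H) (X H) (indepCoeff H 3)) ⟩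
    2 * (triangles H + 3 * X H) + 2 * (6 * indepCoeff H 3)
      ≡⟨ cong (λ x → 2 * (triangles H + 3 * X H) + 2 * (6 * x)) (sym e₃) ⟩
    2 * (triangles H + 3 * X H) + 2 * (6 * indepCoeff G 3) ∎))
    where
    regroup : ∀ t x i → 2 * (t + 3 * x) + 2 * (6 * i) ≡ 2 * (t + 6 * i) + 6 * x
    regroup = solve 3 (λ t x i → con 2 :* (t :+ con 3 :* x) :+ con 2 :* (con 6 :* i) := con 2 :* (t :+ con 6 :* i) :+ con 6 :* x) refl

-- (d - 2)²
excess : ℕ → ℕ
excess 0 = 4
excess 1 = 1
excess (suc (suc k)) = k * k

excess-square : ∀ d → excess d + 4 * d ≡ d * d + 4
excess-square 0 = refl
excess-square 1 = refl
excess-square (suc (suc k)) =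
  solve 1 (λ k → k :* k :+ con 4 :* (con 2 :+ k) := (con 2 :+ k) :* (con 2 :+ k) :+ con 4) refl k

excess≡0 : ∀ d → excess d ≡ 0 → d ≡ 2
excess≡0 2 e = refl

-- As the degree sums agree, passing from deg² to (deg - 2)² changes both graphs in `degree-squares`
-- by the same amount; for `H` the excesses and the triangles are zero.
sum-excess : ∀ {m} (G H : Graph m) → indepCoeff G 2 ≡ indepCoeff H 2 → indepCoeff G 3 ≡ indepCoeff H 3 →
  (∀ v → deg H v ≡ 2) → triangles H ≡ 0 → 3 * sum (λ v → excess (deg G v)) ≡ triangles G
sum-excess {m} G H e₂ e₃ two no-tri = +-cancelʳ-≡ (3 * (4 * (m * 2))) _ _ (begin
  3 * E + 3 * (4 * (m * 2))                       ≡⟨ cong (λ x → 3 * E + 3 * (4 * x)) (sym degrees) ⟩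
  3 * E + 3 * (4 * sum (deg G))                   ≡⟨ sym (*-distribˡ-+ 3 E (4 * sum (deg G))) ⟩
  3 * (E + 4 * sum (deg G))                       ≡⟨ cong (3 *_) sum-square ⟩
  3 * (Q + m * 4)                                 ≡⟨ *-distribˡ-+ 3 Q (m * 4) ⟩
  3 * Q + 3 * (m * 4)                             ≡⟨ cong (_+ 3 * (m * 4)) (sym squares) ⟩
  triangles G + 3 * (m * 4) + 3 * (m * 4)         ≡⟨ solve 2 (λ t m → t :+ con 3 :* (m :* con 4) :+ con 3 :* (m :* con 4) := t :+ con 3 :* (con 4 :* (m :* con 2))) refl (triangles G) m ⟩
  triangles G + 3 * (4 * (m * 2))                 ∎)
  where
  open ≡-Reasoning
  E = sum (λ v → excess (deg G v))
  Q = sum (λ v → deg G v * deg G v)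
  degrees : sum (deg G) ≡ m * 2
  degrees = trans (degree-sum G H e₂) (trans (sum-cong-≗ two) (sum-const m 2))
  squares : triangles G + 3 * (m * 4) ≡ 3 * Q
  squares = trans (cong (λ x → triangles G + 3 * x) (sym (trans (sum-cong-≗ (λ v → cong (λ d → d * d) (two v))) (sum-const m 4))))
    (trans (degree-squares G H e₂ e₃) (cong (_+ 3 * Q) no-tri))
  sum-square : E + 4 * sum (deg G) ≡ Q + m * 4
  sum-square = begin
    E + 4 * sum (deg G)                            ≡⟨ cong (E +_) (*-distribˡ-sum {m} 4 (deg G)) ⟩
    E + sum (λ v → 4 * deg G v)                    ≡⟨ sym (∑-distrib-+ (λ v → excess (deg G v)) (λ v → 4 * deg G v)) ⟩
    sum (λ v → excess (deg G v) + 4 * deg G v)     ≡⟨ sum-cong-≗ (λ v → excess-square (deg G v)) ⟩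
    sum (λ v → deg G v * deg G v + 4)              ≡⟨ ∑-distrib-+ (λ v → deg G v * deg G v) (λ _ → 4) ⟩
    Q + sum {m} (λ _ → 4)                          ≡⟨ cong (Q +_) (sum-const m 4) ⟩
    Q + m * 4                                      ∎

-- Finite sets as Boolean predicates

card : ∀ {n} → (Fin n → Bool) → ℕ
card S = sum (λ u → ⟦ S u ⟧)

infixl 6 _−_ _⊕_
_−_ : ∀ {n} → (Fin n → Bool) → Fin n → (Fin n → Bool)
(S − x) u = not (does (x ≟ u)) ∧ S u

_⊕_ : ∀ {n} → (Fin n → Bool) → Fin n → (Fin n → Bool)
(S ⊕ x) u = does (x ≟ u) ∨ S u

true≢false : ∀ {b} → b ≡ true → b ≢ false
true≢false refl ()

¬true : ∀ {b} → b ≢ true → b ≡ false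
¬true {true}  h = contradiction refl h
¬true {false} h = refl

does-≟⇒≡ : ∀ {n} {x u : Fin n} → does (x ≟ u) ≡ true → x ≡ u
does-≟⇒≡ {x = x} {u} e with x ≟ u
does-≟⇒≡ e  | yes p = p
does-≟⇒≡ () | no _

−-∉ : ∀ {n} (S : Fin n → Bool) x → (S − x) x ≡ false
−-∉ S x = cong (λ b → not b ∧ S x) (dec-true (x ≟ x) refl)

−-other : ∀ {n} (S : Fin n → Bool) {x u} → x ≢ u → (S − x) u ≡ S u
−-other S {x} {u} p = cong (λ b → not b ∧ S u) (dec-false (x ≟ u) p)

∈− : ∀ {n} (S : Fin n → Bool) {x u} → (S − x) u ≡ true → x ≢ u × S u ≡ true
∈− S {x} e = (λ { refl → true≢false e (−-∉ S x) }) , proj₂ (∧-true e)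

⊕-∈ : ∀ {n} (S : Fin n → Bool) x → (S ⊕ x) x ≡ true
⊕-∈ S x = cong (_∨ S x) (dec-true (x ≟ x) refl)

⊕-other : ∀ {n} (S : Fin n → Bool) {x u} → x ≢ u → (S ⊕ x) u ≡ S u
⊕-other S {x} {u} p = cong (_∨ S u) (dec-false (x ≟ u) p)

∈⊕ : ∀ {n} (S : Fin n → Bool) {x u} → (S ⊕ x) u ≡ true → x ≡ u ⊎ S u ≡ true
∈⊕ S {x} {u} e with x ≟ u
... | yes p = inj₁ p
... | no _  = inj₂ e

∨-introʳ : ∀ {a b} → b ≡ true → a ∨ b ≡ true
∨-introʳ {true}  _ = refl
∨-introʳ {false} e = e

card-cong : ∀ {n} {S U : Fin n → Bool} → (∀ i → S i ≡ U i) → card S ≡ card U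
card-cong h = sum-cong-≗ (λ i → cong ⟦_⟧ (h i))

⟦⟧-mono : ∀ {a b} → (a ≡ true → b ≡ true) → ⟦ a ⟧ ≤ ⟦ b ⟧
⟦⟧-mono {true}  h = subst (λ b → 1 ≤ ⟦ b ⟧) (sym (h refl)) ≤-refl
⟦⟧-mono {false} h = z≤n

card-mono : ∀ {n} {S U : Fin n → Bool} → S ⊆ U → card S ≤ card U
card-mono h = sum-mono (λ i → ⟦⟧-mono (h i))

⟦⟧-injective : ∀ {a b} → ⟦ a ⟧ ≡ ⟦ b ⟧ → a ≡ b
⟦⟧-injective {true}  {true}  _ = refl
⟦⟧-injective {false} {false} _ = refl

⊆-card⇒≡ : ∀ {n} {S U : Fin n → Bool} → S ⊆ U → card U ≤ card S → ∀ i → S i ≡ U i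
⊆-card⇒≡ h le i = ⟦⟧-injective (sum-squeeze (λ j → ⟦⟧-mono (h j)) le i)

card-− : ∀ {n} (S : Fin n → Bool) {x} → S x ≡ true → card S ≡ suc (card (S − x))
card-− S {x} e = trans (sum-extract (λ u → ⟦ S u ⟧) x) (cong₂ _+_ (cong ⟦_⟧ e) (sum-cong-≗ step))
  where
  step : ∀ u → ((λ u → ⟦ S u ⟧) ∖ x) u ≡ ⟦ (S − x) u ⟧
  step u with does (x ≟ u)
  ... | true  = refl
  ... | false = refl

card-⊕ : ∀ {n} (S : Fin n → Bool) {x} → S x ≡ false → card (S ⊕ x) ≡ suc (card S)
card-⊕ S {x} e = trans (card-− (S ⊕ x) (⊕-∈ S x)) (cong suc (card-cong same))
  where
  same : ∀ u → (S ⊕ x − x) u ≡ S u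
  same u with x ≟ u
  ... | yes refl = sym e
  ... | no _ = refl

card≡0 : ∀ {n} {S : Fin n → Bool} → card S ≡ 0 → ∀ u → S u ≡ false
card≡0 e u = ⟦⟧-injective (sum≡0⇒≡0 e u)

card>0 : ∀ {n} (S : Fin n → Bool) → 0 < card S → ∃[ u ] S u ≡ true
card>0 S lt with positive-term (λ u → ⟦ S u ⟧) lt
... | u , p = u , ⟦⟧>0 p
  where
  ⟦⟧>0 : ∀ {b} → 0 < ⟦ b ⟧ → b ≡ true
  ⟦⟧>0 {true} _ = refl

∈⇒card>0 : ∀ {n} (S : Fin n → Bool) {u} → S u ≡ true → 0 < card S
∈⇒card>0 S e = subst (0 <_) (sym (card-− S e)) z<s

card≡1 : ∀ {n} (S : Fin n → Bool) → card S ≡ 1 → ∃[ x ] S x ≡ true × (∀ u → S u ≡ true → x ≡ u)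
card≡1 S e with card>0 S (subst (0 <_) (sym e) z<s)
... | x , Sx = x , Sx , only
  where
  only : ∀ u → S u ≡ true → x ≡ u
  only u Su with x ≟ u
  ... | yes p = p
  ... | no q  = contradiction (card≡0 (suc-injective (trans (sym (card-− S Sx)) e)) u)
    (true≢false (trans (−-other S q) Su))

card≡2 : ∀ {n} (S : Fin n → Bool) {x} → S x ≡ true → card S ≡ 2 →
  ∃[ y ] x ≢ y × S y ≡ true × (∀ u → S u ≡ true → x ≡ u ⊎ y ≡ u)
card≡2 S {x} Sx e with card≡1 (S − x) (suc-injective (trans (sym (card-− S Sx)) e))
... | y , Sy , only = y , proj₁ (∈− S {x} Sy) , proj₂ (∈− S {x} Sy) , only′
  where
  only′ : ∀ u → S u ≡ true → x ≡ u ⊎ y ≡ u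
  only′ u Su with x ≟ u
  ... | yes p = inj₁ p
  ... | no q  = inj₂ (only u (trans (−-other S q) Su))

card-pair : ∀ {n} (S : Fin n → Bool) {x y} → x ≢ y → S x ≡ true → S y ≡ true →
  (∀ u → S u ≡ true → x ≡ u ⊎ y ≡ u) → card S ≡ 2
card-pair S {x} {y} x≢y Sx Sy only = trans (card-− S Sx) (cong suc
  (trans (card-− (S − x) (trans (−-other S x≢y) Sy)) (cong suc (sum-zero empty))))
  where
  empty : ∀ u → ⟦ (S − x − y) u ⟧ ≡ 0
  empty u = cong ⟦_⟧ (¬true (λ e → case u e))
    where
    case : ∀ u → (S − x − y) u ≡ true → ⊥
    case u e with ∈− (S − x) e
    ... | y≢u , e′ with ∈− S e′
    ...   | x≢u , e″ = [ x≢u , y≢u ]′ (only u e″)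

tri-≡0 : ∀ {x y z} → ¬ (x ≡ true × y ≡ true × z ≡ true) → tri x y z ≡ 0
tri-≡0 {false} h = refl
tri-≡0 {true} {false} h = refl
tri-≡0 {true} {true} {false} h = refl
tri-≡0 {true} {true} {true} h = contradiction (refl , refl , refl) h

bipartite⇒no-triangles : ∀ {n} (G : Graph n) (side : Fin n → Bool) →
  (∀ i j → adj G i j ≡ true → side i ≢ side j) → triangles G ≡ 0
bipartite⇒no-triangles G side proper =
  sum-zero (λ i → sum-zero (λ j → sum-zero (λ k → tri-≡0 (λ (x , y , z) →
    odd (side i) (side j) (side k) (proper i j x) (proper i k y) (proper j k z)))))
  where
  odd : ∀ a b c → a ≢ b → a ≢ c → b ≢ c → ⊥
  odd true  true  c     p q r = p refl
  odd false false c     p q r = p refl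
  odd true  false true  p q r = q refl
  odd true  false false p q r = r refl
  odd false true  true  p q r = r refl
  odd false true  false p q r = q refl

card-single : ∀ {n} (S : Fin n → Bool) {x} → S x ≡ true → (∀ u → S u ≡ true → x ≡ u) → card S ≡ 1
card-single S {x} Sx only = trans (card-− S Sx) (cong suc (sum-zero (λ u → cong ⟦_⟧ (¬true (λ e →
  proj₁ (∈− S {x} e) (only u (proj₂ (∈− S {x} e))))))))

-- Paths and cycles

≡ᵇ-refl : ∀ n → (n ≡ᵇ n) ≡ true
≡ᵇ-refl n = T⇒≡ (≡⇒≡ᵇ n n refl)

≡ᵇ-true : ∀ {m n} → (m ≡ᵇ n) ≡ true → m ≡ n
≡ᵇ-true e = ≡ᵇ⇒≡ _ _ (≡⇒T e)

≡⇒≡ᵇ-true : ∀ {m n} → m ≡ n → (m ≡ᵇ n) ≡ true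
≡⇒≡ᵇ-true {m} refl = ≡ᵇ-refl m

≢⇒≡ᵇ-false : ∀ {m n} → m ≢ n → (m ≡ᵇ n) ≡ false
≢⇒≡ᵇ-false h = ¬true (h ∘ ≡ᵇ-true)

∨-true : ∀ {x y} → x ∨ y ≡ true → x ≡ true ⊎ y ≡ true
∨-true {true}  e = inj₁ refl
∨-true {false} e = inj₂ e

∨-introˡ : ∀ {x y} → x ≡ true → x ∨ y ≡ true
∨-introˡ refl = refl

-- The cyclic successor. Orienting the cycle keeps the two neighbours of a vertex apart, since
-- `Next` is functional in both directions.
Next : ∀ m → Fin m → Fin m → Set
Next m i j = suc (toℕ i) ≡ toℕ j ⊎ (suc (toℕ i) ≡ m × toℕ j ≡ 0)

C-adj⇒ : ∀ {m} (i j : Fin m) → adj (C m) i j ≡ true → Next m i j ⊎ Next m j i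
C-adj⇒ {m} i j e = [ inj₁ ∘ next i j , inj₂ ∘ next j i ]′ (∨-true (proj₂ (∧-true {not (does (i ≟ j))} e)))
  where
  next : ∀ i j → (suc (toℕ i) ≡ᵇ toℕ j) ∨ ((suc (toℕ i) ≡ᵇ m) ∧ (toℕ j ≡ᵇ 0)) ≡ true → Next m i j
  next i j h with ∨-true h
  ... | inj₁ h = inj₁ (≡ᵇ-true h)
  ... | inj₂ h = inj₂ (≡ᵇ-true (proj₁ (∧-true h)) , ≡ᵇ-true (proj₂ (∧-true h)))

⇒C-adj : ∀ {m} (i j : Fin m) → i ≢ j → Next m i j → adj (C m) i j ≡ true
⇒C-adj {m} i j i≢j h = cong₂ _∧_ (cong not (dec-false (i ≟ j) i≢j)) (∨-introˡ (arc h))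
  where
  arc : Next m i j → (suc (toℕ i) ≡ᵇ toℕ j) ∨ ((suc (toℕ i) ≡ᵇ m) ∧ (toℕ j ≡ᵇ 0)) ≡ true
  arc (inj₁ e)       = ∨-introˡ (≡⇒≡ᵇ-true e)
  arc (inj₂ (e , f)) = ∨-introʳ {suc (toℕ i) ≡ᵇ toℕ j} (cong₂ _∧_ (≡⇒≡ᵇ-true e) (≡⇒≡ᵇ-true f))

Next-≢ : ∀ {m} → 2 ≤ m → ∀ {i j} → Next m i j → i ≢ j
Next-≢ 2≤m (inj₁ e) refl = 1+n≢n e
Next-≢ (s≤s (s≤s _)) (inj₂ (e , f)) refl with trans (sym e) (cong suc f)
... | ()

exists-next : ∀ {m} (i : Fin m) → ∃[ j ] Next m i j
exists-next {m} i with m≤n⇒m<n∨m≡n (toℕ<n i)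
... | inj₁ lt = fromℕ< lt , inj₁ (sym (toℕ-fromℕ< lt))
exists-next {suc m} i | inj₂ eq = zero , inj₂ (eq , refl)

exists-previous : ∀ {m} (i : Fin m) → ∃[ j ] Next m j i
exists-previous {suc m} zero    = fromℕ< (n<1+n m) , inj₂ (cong suc (toℕ-fromℕ< (n<1+n m)) , refl)
exists-previous {suc m} (suc i) = fromℕ< lt , inj₁ (cong suc (toℕ-fromℕ< lt))
  where lt = <-trans (toℕ<n i) (n<1+n m)

Next-functional : ∀ {m} {i j k : Fin m} → Next m i j → Next m i k → j ≡ k
Next-functional (inj₁ e) (inj₁ f) = toℕ-injective (trans (sym e) f)
Next-functional {j = j} (inj₁ e) (inj₂ (f , _)) = contradiction (trans (sym e) f) (<⇒≢ (toℕ<n j))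
Next-functional {k = k} (inj₂ (f , _)) (inj₁ e) = contradiction (trans (sym e) f) (<⇒≢ (toℕ<n k))
Next-functional (inj₂ (_ , e)) (inj₂ (_ , f)) = toℕ-injective (trans e (sym f))

Next-injective : ∀ {m} {i j k : Fin m} → Next m i k → Next m j k → i ≡ j
Next-injective (inj₁ e) (inj₁ f) = toℕ-injective (suc-injective (trans e (sym f)))
Next-injective (inj₁ e) (inj₂ (_ , f)) = contradiction (trans (sym f) (sym e)) (λ ())
Next-injective (inj₂ (_ , f)) (inj₁ e) = contradiction (trans (sym f) (sym e)) (λ ())
Next-injective (inj₂ (e , _)) (inj₂ (f , _)) = toℕ-injective (suc-injective (trans e (sym f)))

-- For m = 2 the successor is also the predecessor. With three vertices the two differ, which is
-- what makes the degree in `C` equal to 2 and not 1.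
Next-asym : ∀ {m} → 3 ≤ m → ∀ {i j} → Next m i j → ¬ Next m j i
Next-asym _ {i} (inj₁ e) (inj₁ f) = contradiction (trans (cong suc e) f) (λ p → <⇒≢ (m<n⇒m<1+n (n<1+n (toℕ i))) (sym p))
Next-asym (s≤s (s≤s (s≤s _))) (inj₁ e) (inj₂ (f , g)) =
  contradiction (trans (sym f) (cong suc (trans (sym e) (cong suc g)))) (λ ())
Next-asym (s≤s (s≤s (s≤s _))) (inj₂ (f , g)) (inj₁ e) =
  contradiction (trans (sym f) (cong suc (trans (sym e) (cong suc g)))) (λ ())
Next-asym (s≤s (s≤s (s≤s _))) (inj₂ (f , g)) (inj₂ (f′ , g′)) =
  contradiction (trans (sym f) (cong suc g′)) (λ ())

deg-C : ∀ {m} → 3 ≤ m → (v : Fin m) → deg (C m) v ≡ 2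
deg-C {m} 3≤m v with exists-next v | exists-previous v
... | j , vj | k , kv = card-pair (adj (C m) v) (λ { refl → Next-asym 3≤m vj kv })
  (⇒C-adj v j (Next-≢ 2≤m vj) vj)
  (trans (adj-sym (C m) v k) (⇒C-adj k v (Next-≢ 2≤m kv) kv))
  (λ u e → [ (λ vu → inj₁ (Next-functional vj vu)) , (λ uv → inj₂ (Next-injective kv uv)) ]′ (C-adj⇒ v u e))
  where 2≤m = ≤-trans (n≤1+n 2) 3≤m

even : ℕ → Bool
even zero    = true
even (suc n) = not (even n)

even-double : ∀ n → even (n + n) ≡ true
even-double zero    = refl
even-double (suc n) = trans (cong (not ∘ even) (+-suc n n)) (trans (not-involutive _) (even-double n))

-- Vertices are coloured by parity; as m is even, the closing edge from m - 1 to 0 also joins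
-- different colours.
triangles-C : ∀ {m} → even m ≡ true → triangles (C m) ≡ 0
triangles-C {m} ev = bipartite⇒no-triangles (C m) (even ∘ toℕ)
  (λ i j e → [ flips , (λ h p → flips h (sym p)) ]′ (C-adj⇒ i j e))
  where
  flip≢ : ∀ {b} → not b ≢ b
  flip≢ {true} ()
  flip≢ {false} ()
  flips : ∀ {i j} → Next m i j → even (toℕ i) ≢ even (toℕ j)
  flips {i} (inj₁ e) p = flip≢ (trans (cong even e) (sym p))
  flips {i} (inj₂ (e , f)) p = flip≢ (trans (trans (cong even e) ev) (sym (trans p (cong even f))))

-- Independence polynomials of paths, cycles and the graphs D

path : ∀ n → Relation n
path n i j = (suc (toℕ i) ≡ᵇ toℕ j) ∨ (suc (toℕ j) ≡ᵇ toℕ i)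

-- The coefficients of the independence polynomial of the path on n vertices.
#path : ℕ → ℕ → ℕ
#path n = count (path n) (λ _ → true)

count-skip : ∀ {n} (a : Relation (suc n)) p → p zero ≡ false → ∀ k → count a p k ≡ count (tail₂ a) (p ∘ suc) k
count-skip a p e zero    = refl
count-skip a p e (suc k) = cong (λ b → ⟦ b ⟧ * count (tail₂ a) (allowed a p) k + count (tail₂ a) (p ∘ suc) (suc k)) e

-- Taking vertex 0 forbids only vertex 1 of what remains, so the count continues two vertices
-- further on.
count-path : ∀ {n} p k → count (path (suc (suc n))) p (suc k) ≡
  ⟦ p zero ⟧ * count (path n) (λ j → p (suc (suc j))) k + count (path (suc n)) (p ∘ suc) (suc k)
count-path {n} p k = cong (λ x → ⟦ p zero ⟧ * x + count (path (suc n)) (p ∘ suc) (suc k))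
  (trans (count-skip (path (suc n)) (allowed (path (suc (suc n))) p) (∧-zeroʳ _) k)
    (count-cong (λ _ _ → refl) (λ j → ∧-identityʳ _) k))

#path-rec : ∀ n k → #path (suc (suc n)) (suc k) ≡ #path n k + #path (suc n) (suc k)
#path-rec n k = trans (count-path {n} (λ _ → true) k) (cong (_+ #path (suc n) (suc k)) (+-identityʳ (#path n k)))

notLast : ∀ n → Fin n → Bool
notLast n j = not (suc (toℕ j) ≡ᵇ n)

-- `count` peels vertices off at the front and cannot drop the last one directly; instead both sides
-- are seen to obey the path recurrence.
count-notLast : ∀ n k → count (path (suc n)) (notLast (suc n)) k ≡ #path n k
count-notLast n zero = refl
count-notLast zero (suc k) = refl
count-notLast (suc zero) (suc k) = trans (count-path (notLast 2) k)
  (cong (λ x → 1 * x + 0) (count-cong {zero} (λ ()) (λ ()) k))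
count-notLast (suc (suc n)) (suc k) = trans (count-path (notLast (3 + n)) k)
  (trans (cong₂ _+_ (trans (+-identityʳ _) (count-notLast n k)) (count-notLast (suc n) (suc k))) (sym (#path-rec n k)))

path-loopless : ∀ {n} (i j : Fin n) → not (does (i ≟ j)) ∧ path n i j ≡ path n i j
path-loopless {n} i j with i ≟ j
... | no _     = refl
... | yes refl = sym (cong₂ _∨_ (≢⇒≡ᵇ-false {suc (toℕ i)} 1+n≢n) (≢⇒≡ᵇ-false {suc (toℕ i)} 1+n≢n))

-- A set with vertex 0 loses the two ends of the path 1, ..., r + 2, which leaves a path on r
-- vertices; a set without vertex 0 lives in the whole path.
count-C : ∀ r k → count (adj (C (3 + r))) (λ _ → true) (suc k) ≡ #path r k + #path (2 + r) (suc k)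
count-C r k = cong₂ _+_ (trans (+-identityʳ _) (trans (count-cong {p = p} tail-path (λ _ → refl) k)
    (trans (count-skip (path (2 + r)) p refl k)
      (trans (count-cong (λ _ _ → refl) inner k) (count-notLast r k)))))
  (count-cong {p = λ _ → true} tail-path (λ _ → refl) (suc k))
  where
  p = allowed (adj (C (3 + r))) (λ _ → true)
  tail-path : ∀ i j → tail₂ (adj (C (3 + r))) i j ≡ path (2 + r) i j
  tail-path i j = trans (cong (not (does (i ≟ j)) ∧_) (cong₂ _∨_ (drop i j) (drop j i))) (path-loopless i j)
    where
    drop : ∀ i j → (suc (toℕ i) ≡ᵇ toℕ j) ∨ ((suc (toℕ i) ≡ᵇ 2 + r) ∧ false) ≡ (suc (toℕ i) ≡ᵇ toℕ j)
    drop i j = trans (cong ((suc (toℕ i) ≡ᵇ toℕ j) ∨_) (∧-zeroʳ _)) (∨-identityʳ _)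
  inner : ∀ j → allowed (adj (C (3 + r))) (λ _ → true) (suc j) ≡ notLast (suc r) j
  inner j = cong not (∧-identityʳ _)

-- Here vertex 0 forbids the first two vertices of the same path instead of its two ends; again a
-- path on r vertices remains.
count-D : ∀ r k → count (adj (D (3 + r))) (λ _ → true) (suc k) ≡ #path r k + #path (2 + r) (suc k)
count-D r k = cong₂ _+_ (trans (+-identityʳ _) (trans (count-cong {p = p} tail-path (λ _ → refl) k)
    (trans (count-skip (path (2 + r)) p refl k)
      (count-skip (path (1 + r)) (p ∘ suc) refl k))))
  (count-cong {p = λ _ → true} tail-path (λ _ → refl) (suc k))
  where
  p = allowed (adj (D (3 + r))) (λ _ → true)
  tail-path : ∀ i j → tail₂ (adj (D (3 + r))) i j ≡ path (2 + r) i j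
  tail-path i j = path-loopless i j

SameIndepPoly-D-C : ∀ r → SameIndepPoly (D (3 + r)) (C (3 + r))
SameIndepPoly-D-C r k = trans (indepCoeff≡count (D (3 + r)) k) (trans (same k) (sym (indepCoeff≡count (C (3 + r)) k)))
  where
  same : ∀ k → count (adj (D (3 + r))) (λ _ → true) k ≡ count (adj (C (3 + r))) (λ _ → true) k
  same zero    = refl
  same (suc k) = trans (count-D r k) (sym (count-C r k))

-- An independent k-set with k ≥ 1 stretches over at least 2k - 1 vertices of the path.
#path-zero : ∀ n k → suc n < k + k → #path n k ≡ 0
#path-zero zero (suc k) lt = refl
#path-zero (suc zero) (suc zero) (s≤s (s≤s ()))
#path-zero (suc zero) (suc (suc k)) lt = refl
#path-zero (suc (suc n)) (suc k) lt = trans (#path-rec n k)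
  (cong₂ _+_ (#path-zero n k lt′) (#path-zero (suc n) (suc k) (<-trans (n<1+n (suc (suc n))) lt)))
  where
  lt′ : suc n < k + k
  lt′ = s<s⁻¹ (s<s⁻¹ (subst (suc (suc (suc n)) <_) (cong suc (+-suc k k)) lt))

-- On an odd path the alternating set containing both ends is the only one of this size. In the
-- recurrence, sets avoiding vertex 0 would have to fit into a path that is too short.
#path-top : ∀ j → #path (suc (j + j)) (suc j) ≡ 1
#path-top zero    = refl
#path-top (suc j) = trans (cong (λ x → #path (suc (suc x)) (suc (suc j))) (+-suc j j))
  (trans (#path-rec (suc (j + j)) (suc j)) (cong₂ _+_ (#path-top j) (#path-zero (suc (suc (j + j))) (suc (suc j)) lt)))
  where
  lt : suc (suc (suc (j + j))) < suc (suc j) + suc (suc j)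
  lt = ≤-reflexive (solve 1 (λ j → con 4 :+ (j :+ j) := con 2 :+ j :+ (con 2 :+ j)) refl j)

-- Both terms of `count-C` are top coefficients of odd paths: one alternating set contains vertex 0,
-- the other avoids it.
indepCoeff-C-top : ∀ t → indepCoeff (C (4 + (t + t))) (2 + t) ≡ 2
indepCoeff-C-top t = trans (indepCoeff≡count (C (4 + (t + t))) (2 + t)) (trans (count-C (suc (t + t)) (suc t))
  (cong₂ _+_ (#path-top t) (trans (cong (λ x → #path (2 + x) (2 + t)) (sym (+-suc t t))) (#path-top (suc t)))))

indepCoeff-C-above : ∀ t → indepCoeff (C (4 + (t + t))) (3 + t) ≡ 0
indepCoeff-C-above t = trans (indepCoeff≡count (C (4 + (t + t))) (3 + t)) (trans (count-C (suc (t + t)) (2 + t))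
  (cong₂ _+_ (#path-zero (suc (t + t)) (2 + t) (≤-trans (n≤1+n _) (≤-reflexive (solve 1 (λ t → con 4 :+ (t :+ t) := con 2 :+ t :+ (con 2 :+ t)) refl t))))
    (#path-zero (3 + (t + t)) (3 + t) (≤-trans (n≤1+n _) (≤-reflexive (solve 1 (λ t → con 6 :+ (t :+ t) := con 3 :+ t :+ (con 3 :+ t)) refl t))))))

-- From values of coefficients to actual independent sets

∈-allSubsets : ∀ {n} (S : Subset n) → S ∈ allSubsets n
∈-allSubsets []ᵥ = here refl
∈-allSubsets (true  ∷ᵥ S) = ∈-++⁺ˡ (∈-map⁺ _ (∈-allSubsets S))
∈-allSubsets (false ∷ᵥ S) = ∈-++⁺ʳ _ (∈-map⁺ _ (∈-allSubsets S))

allSubsets-unique : ∀ n → Unique (allSubsets n)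
allSubsets-unique zero    = [] ∷ []
allSubsets-unique (suc n) = Unique.++⁺
  (Unique.map⁺ (proj₂ ∘ ∷-injective) (allSubsets-unique n))
  (Unique.map⁺ (proj₂ ∘ ∷-injective) (allSubsets-unique n))
  (λ (p , q) → disjoint p q)
  where
  disjoint : ∀ {S} → S ∈ map (true ∷ᵥ_) (allSubsets n) → S ∈ map (false ∷ᵥ_) (allSubsets n) → ⊥
  disjoint p q with ∈-map⁻ _ p | ∈-map⁻ _ q
  ... | _ , _ , refl | _ , _ , ()

module _ {A : Set} (P : A → Bool) where
  weight : List A → ℕ
  weight xs = sumₗ (map (λ x → ⟦ P x ⟧) xs)

  weight≡0 : ∀ xs → weight xs ≡ 0 → ∀ {y} → y ∈ xs → P y ≡ false
  weight≡0 (x ∷ xs) e (here refl) = ⟦⟧-injective (m+n≡0⇒m≡0 ⟦ P x ⟧ e)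
  weight≡0 (x ∷ xs) e (there y∈)  = weight≡0 xs (m+n≡0⇒n≡0 ⟦ P x ⟧ e) y∈

  weight≡1 : ∀ xs → weight xs ≡ 1 → ∃[ x ] x ∈ xs × P x ≡ true × (∀ {y} → y ∈ xs → P y ≡ true → y ≡ x)
  weight≡1 (x ∷ xs) e with P x in Px
  ... | true  = x , here refl , Px , only
    where
    only : ∀ {y} → y ∈ x ∷ xs → P y ≡ true → y ≡ x
    only (here y≡x) _ = y≡x
    only (there y∈) Py = contradiction (weight≡0 xs (suc-injective e) y∈) (true≢false Py)
  ... | false with weight≡1 xs e
  ...   | z , z∈ , Pz , only = z , there z∈ , Pz , only′
    where
    only′ : ∀ {y} → y ∈ x ∷ xs → P y ≡ true → y ≡ z
    only′ (here refl) Py = contradiction Px (true≢false Py)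
    only′ (there y∈) Py = only y∈ Py

  -- `weight` counts positions in the list; uniqueness turns two positions into two different
  -- elements.
  weight≡2 : ∀ xs → Unique xs → weight xs ≡ 2 →
    ∃[ x ] ∃[ x′ ] x ≢ x′ × P x ≡ true × P x′ ≡ true × (∀ {y} → y ∈ xs → P y ≡ true → y ≡ x ⊎ y ≡ x′)
  weight≡2 (x ∷ xs) (x∉ ∷ u) e with P x in Px
  ... | true  with weight≡1 xs (suc-injective e)
  ...   | z , z∈ , Pz , only = x , z , All.lookup x∉ z∈ , Px , Pz , only′
    where
    only′ : ∀ {y} → y ∈ x ∷ xs → P y ≡ true → y ≡ x ⊎ y ≡ z
    only′ (here y≡x) _ = inj₁ y≡x
    only′ (there y∈) Py = inj₂ (only y∈ Py)
  weight≡2 (x ∷ xs) (x∉ ∷ u) e | false with weight≡2 xs u e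
  ...   | z , z′ , z≢z′ , Pz , Pz′ , only = z , z′ , z≢z′ , Pz , Pz′ , only′
    where
    only′ : ∀ {y} → y ∈ x ∷ xs → P y ≡ true → y ≡ z ⊎ y ≡ z′
    only′ (here refl) Py = contradiction Px (true≢false Py)
    only′ (there y∈) Py = only y∈ Py

card-lookup : ∀ {n} (S : Subset n) → card (lookup S) ≡ ∣ S ∣
card-lookup []ᵥ = refl
card-lookup (true  ∷ᵥ S) = cong suc (card-lookup S)
card-lookup (false ∷ᵥ S) = card-lookup S

Independent-cong : ∀ {n} {a : Relation n} {S U : Fin n → Bool} → (∀ i → S i ≡ U i) → Independent a S → Independent a U
Independent-cong h I i j t u = I i j (trans (h i) t) (trans (h j) u)

counted : ∀ {n} → Graph n → ℕ → Subset n → Bool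
counted G k S = isIndependent G S ∧ (∣ S ∣ ≡ᵇ k)

counted⇒ : ∀ {n} (G : Graph n) k S → counted G k S ≡ true → Independent (adj G) (lookup S) × card (lookup S) ≡ k
counted⇒ G k S e = isIndependent⇒ G S (proj₁ (∧-true e)) , trans (card-lookup S) (≡ᵇ-true (proj₂ (∧-true e)))

⇒counted : ∀ {n} (G : Graph n) k S → Independent (adj G) S → card S ≡ k → counted G k (tabulate S) ≡ true
⇒counted G k S I e = cong₂ _∧_
  (⇒isIndependent G (tabulate S) (Independent-cong (λ i → sym (lookup∘tabulate S i)) I))
  (≡⇒≡ᵇ-true {∣ tabulate S ∣} (trans (sym (card-lookup (tabulate S))) (trans (card-cong (lookup∘tabulate S)) e)))

no-independent-set : ∀ {n} (G : Graph n) k → indepCoeff G k ≡ 0 → ∀ S → Independent (adj G) S → card S ≢ k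
no-independent-set {n} G k e S I c =
  true≢false (⇒counted G k S I c) (weight≡0 (counted G k) (allSubsets n) e (∈-allSubsets (tabulate S)))

-- The structural argument uses predicates, compared pointwise, while the coefficient counts
-- vectors, compared by equality; `tabulate` and `lookup` carry the distinction of the two sets
-- across.
two-independent-sets : ∀ {n} (G : Graph n) k → indepCoeff G k ≡ 2 →
  ∃[ A ] ∃[ B ] Independent (adj G) A × card A ≡ k × Independent (adj G) B × card B ≡ k × ¬ (∀ i → A i ≡ B i)
    × (∀ S → Independent (adj G) S → card S ≡ k → (∀ i → S i ≡ A i) ⊎ (∀ i → S i ≡ B i))
two-independent-sets {n} G k e with weight≡2 (counted G k) (allSubsets n) (allSubsets-unique n) e
... | A , B , A≢B , PA , PB , only =
  lookup A , lookup B , proj₁ (counted⇒ G k A PA) , proj₂ (counted⇒ G k A PA) ,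
  proj₁ (counted⇒ G k B PB) , proj₂ (counted⇒ G k B PB) ,
  (λ h → A≢B (trans (sym (tabulate∘lookup A)) (trans (tabulate-cong h) (tabulate∘lookup B)))) ,
  (λ S I c → [ inj₁ ∘ at S A , inj₂ ∘ at S B ]′ (only (∈-allSubsets (tabulate S)) (⇒counted G k S I c)))
  where
  at : ∀ S U → tabulate S ≡ U → ∀ i → S i ≡ lookup U i
  at S U p i = trans (sym (lookup∘tabulate S i)) (cong (λ V → lookup V i) p)

-- Isomorphism invariance and the exceptional graph on six vertices

-- Relabelling takes the list of all subsets, complete and free of duplicates, to another such list,
-- which is therefore a permutation of it.
sum-bijection : ∀ {m} (τ σ : Fin m → Fin m) → (∀ i → τ (σ i) ≡ i) → (∀ i → σ (τ i) ≡ i) → (f : Subset m → ℕ) →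
  sumₗ (map f (allSubsets m)) ≡ sumₗ (map (λ S → f (tabulate (λ i → lookup S (τ i)))) (allSubsets m))
sum-bijection {m} τ σ τσ στ f = trans (sum-↭ (↭-map⁺ f relabelled)) (cong sumₗ (sym (map-∘ (allSubsets m))))
  where
  move : (Fin m → Fin m) → Subset m → Subset m
  move τ S = tabulate (λ i → lookup S (τ i))
  inverse : ∀ {τ σ : Fin m → Fin m} → (∀ i → τ (σ i) ≡ i) → ∀ S → move σ (move τ S) ≡ S
  inverse {τ} {σ} h S = trans (tabulate-cong (λ i → trans (lookup∘tabulate _ (σ i)) (cong (lookup S) (h i)))) (tabulate∘lookup S)
  relabelled : allSubsets m ↭ map (move τ) (allSubsets m)
  relabelled = ∼bag⇒↭ (unique∧set⇒bag (allSubsets-unique m)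
    (Unique.map⁺ (λ {S} {U} e → trans (sym (inverse τσ S)) (trans (cong (move σ) e) (inverse τσ U))) (allSubsets-unique m))
    (λ {S} → mk⇔ (λ _ → subst (_∈ map (move τ) (allSubsets m)) (inverse στ S) (∈-map⁺ _ (∈-allSubsets (move σ S))))
                 (λ _ → ∈-allSubsets S)))

≅⇒SameIndepPoly : ∀ {m k} (G : Graph m) (H : Graph k) → G ≅ H → SameIndepPoly G H
≅⇒SameIndepPoly {m} {k} G H iso r with ↔⇒≡ (_≅_.bij iso)
... | refl = trans (sum-bijection τ σ τσ στ _)
  (cong sumₗ (map-cong (λ S → cong ⟦_⟧ (same S)) (allSubsets m)))
  where
  open _≅_ iso
  τ = Inverse.to bij
  σ = Inverse.from bij
  τσ : ∀ i → τ (σ i) ≡ i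
  τσ i = Inverse.inverseˡ bij refl
  στ : ∀ i → σ (τ i) ≡ i
  στ i = Inverse.inverseʳ bij refl
  same : ∀ S → counted G r (tabulate (λ i → lookup S (τ i))) ≡ counted H r S
  same S = cong₂ _∧_
    (⇔→≡ (mk⇔
      (λ e → ⇒isIndependent H S (λ i j t u → trans (sym (trans (cong₂ (adj H) (τσ i) (τσ j)) refl))
        (trans (preserve (σ i) (σ j)) (isIndependent⇒ G (tabulate (λ i → lookup S (τ i))) e (σ i) (σ j) (pull i t) (pull j u)))))
      (λ e → ⇒isIndependent G (tabulate (λ i → lookup S (τ i))) (λ i j t u → trans (sym (preserve i j))
        (isIndependent⇒ H S e (τ i) (τ j) (trans (sym (lookup∘tabulate _ i)) t) (trans (sym (lookup∘tabulate _ j)) u))))))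
    (cong (_≡ᵇ r) (trans (sym (card-lookup (tabulate (λ i → lookup S (τ i))))) (trans (card-cong {U = lookup S ∘ τ} (lookup∘tabulate _))
      (trans (sym (sum-permute (λ i → ⟦ lookup S i ⟧) bij)) (card-lookup S)))))
    where
    pull : ∀ i {b} → lookup S i ≡ b → lookup (tabulate (λ i → lookup S (τ i))) (σ i) ≡ b
    pull i t = trans (lookup∘tabulate _ (σ i)) (trans (cong (lookup S) (τσ i)) t)

-- The coefficients up to 6 are compared by evaluation; beyond that no set is large enough in either
-- graph.
SameIndepPoly-K4-e∪K2 : SameIndepPoly (K4-e ∪ K 2) (C 6)
SameIndepPoly-K4-e∪K2 0 = refl
SameIndepPoly-K4-e∪K2 1 = refl
SameIndepPoly-K4-e∪K2 2 = refl
SameIndepPoly-K4-e∪K2 3 = refl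
SameIndepPoly-K4-e∪K2 4 = refl
SameIndepPoly-K4-e∪K2 5 = refl
SameIndepPoly-K4-e∪K2 6 = refl
SameIndepPoly-K4-e∪K2 (suc (suc (suc (suc (suc (suc (suc r))))))) = begin
  indepCoeff (K4-e ∪ K 2) (7 + r)                    ≡⟨ indepCoeff≡count (K4-e ∪ K 2) (7 + r) ⟩
  count (adj (K4-e ∪ K 2)) (λ _ → true) (7 + r)      ≡⟨ trans (beyond 6 (adj (K4-e ∪ K 2)) (λ _ → true) r) (sym (beyond 6 (adj (C 6)) (λ _ → true) r)) ⟩
  count (adj (C 6)) (λ _ → true) (7 + r)             ≡⟨ sym (indepCoeff≡count (C 6) (7 + r)) ⟩
  indepCoeff (C 6) (7 + r)                           ∎
  where
  open ≡-Reasoning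
  beyond : ∀ n (a : Relation n) p r → count a p (suc n + r) ≡ 0
  beyond zero    a p r = refl
  beyond (suc n) a p r = cong₂ _+_ (trans (cong (⟦ p zero ⟧ *_) (beyond n (tail₂ a) (allowed a p) r)) (*-zeroʳ ⟦ p zero ⟧))
    (trans (cong (count (tail₂ a) (p ∘ suc)) (cong suc (sym (+-suc n r)))) (beyond n (tail₂ a) (p ∘ suc) (suc r)))

card≡2-only : ∀ {n} (S : Fin n → Bool) {x y} → x ≢ y → S x ≡ true → S y ≡ true → card S ≡ 2 →
  ∀ u → S u ≡ true → x ≡ u ⊎ y ≡ u
card≡2-only S x≢y Sx Sy e u Su with card≡2 S Sx e
... | z , _ , _ , only with only _ Sy | only u Su
...   | inj₁ x≡y | _        = contradiction x≡y x≢y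
...   | inj₂ _   | inj₁ x≡u = inj₁ x≡u
...   | inj₂ z≡y | inj₂ z≡u = inj₂ (trans (sym z≡y) z≡u)

-- A 2-regular graph in which every union of components avoiding v₀ is empty is a cycle: walk
-- along it without turning back, starting with v₀ v₁.
module Walk {N : ℕ} (G : Graph N) (two : (v : Fin N) → deg G v ≡ 2) (3≤N : 3 ≤ N)
  {v₀ v₁ : Fin N} (v₀v₁ : adj G v₀ v₁ ≡ true)
  (connected : (U : Fin N → Bool) → ((i j : Fin N) → adj G i j ≡ true → U i ≡ true → U j ≡ true) →
    U v₀ ≡ false → (i : Fin N) → U i ≡ false)
  where

  -- The state of the walk is a directed edge: the vertex reached does not determine the next one
  -- without the neighbour it was reached from.
  record Arc : Set where
    constructor arc
    field
      {source target} : Fin N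
      edge : adj G source target ≡ true
  open Arc

  onward : (e : Arc) → ∃[ y ] source e ≢ y × adj G (target e) y ≡ true
    × (∀ u → adj G (target e) u ≡ true → source e ≡ u ⊎ y ≡ u)
  onward e = card≡2 (adj G (target e)) (trans (adj-sym G (target e) (source e)) (edge e)) (two (target e))

  walk : ℕ → Arc
  walk zero    = arc v₀v₁
  walk (suc i) = arc (proj₁ (proj₂ (proj₂ (onward (walk i)))))

  v : ℕ → Fin N
  v i = source (walk i)

  v-edge : ∀ i → adj G (v i) (v (suc i)) ≡ true
  v-edge i = edge (walk i)

  v-turn : ∀ i → v i ≢ v (suc (suc i))
  v-turn i = proj₁ (proj₂ (onward (walk i)))

  v-neighbours : ∀ i u → adj G (v (suc i)) u ≡ true → v i ≡ u ⊎ v (suc (suc i)) ≡ u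
  v-neighbours i = proj₂ (proj₂ (proj₂ (onward (walk i))))

  v-loop : ∀ i → v i ≢ v (suc i)
  v-loop i e = true≢false (v-edge i) (trans (cong (adj G (v i)) (sym e)) (adj-irrefl G (v i)))

  Distinct : ℕ → Set
  Distinct k = ∀ i j → i < j → j < k → v i ≢ v j

  -- If v (i + 1) = v (k + 1) were a first repetition, then v k, being adjacent to it, would be v i
  -- or v (i + 2), which is an earlier repetition. The cases where these indices are too close to k
  -- are excluded by looplessness and by never turning back.
  closes-at-start : ∀ i k → Distinct k → i < k → v i ≡ v k → i ≡ 0
  closes-at-start zero    k       d i<k e = refl
  closes-at-start (suc i) (suc k) d (s≤s i<k) e
    with v-neighbours i (v k) (trans (adj-sym G (v (suc i)) (v k)) (trans (cong (adj G (v k)) e) (v-edge k)))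
  ... | inj₁ p = contradiction p (d i k i<k (n<1+n k))
  ... | inj₂ p with m≤n⇒m<n∨m≡n i<k
  ...   | inj₂ refl = contradiction e (v-loop k)
  ...   | inj₁ lt with m≤n⇒m<n∨m≡n lt
  ...     | inj₁ lt′ = contradiction p (d (suc (suc i)) k lt′ (n<1+n k))
  ...     | inj₂ refl = contradiction e (v-turn (suc i))

  -- `v-neighbours` covers only vertices with a predecessor on the walk; once the walk has closed, v
  -- k is the predecessor of v 0.
  start-neighbours : ∀ k → Distinct (suc k) → v 0 ≡ v (suc k) → ∀ u → adj G (v 0) u ≡ true → v 1 ≡ u ⊎ v k ≡ u
  start-neighbours zero d e = contradiction e (v-loop 0)
  start-neighbours (suc zero) d e = contradiction e (v-turn 0)
  start-neighbours (suc (suc k)) d e u =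
    card≡2-only (adj G (v 0)) (d 1 (2 + k) (s≤s (s≤s z≤n)) (n<1+n (2 + k))) (v-edge 0) last-edge (two (v 0)) u
    where
    last-edge : adj G (v 0) (v (2 + k)) ≡ true
    last-edge = trans (adj-sym G (v 0) (v (2 + k))) (trans (cong (adj G (v (2 + k))) e) (v-edge (2 + k)))

  Visited : ℕ → Fin N → Set
  Visited k u = ∃[ i ] v (toℕ {suc k} i) ≡ u

  visited? : ∀ k u → Dec (Visited k u)
  visited? k u = any? (λ i → v (toℕ {suc k} i) ≟ u)

  -- In a closed walk both neighbours of every visited vertex are visited, so the missed vertices
  -- form a union of components avoiding v₀, to which `connected` applies.
  all-visited : ∀ k → Distinct (suc k) → v 0 ≡ v (suc k) → ∀ u → ∃[ i ] i < suc k × v i ≡ u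
  all-visited k d e u with visited? k u in decided
  ... | yes (i , p) = toℕ i , toℕ<n i , p
  ... | no _ = contradiction (connected missed closed start-visited u) (true≢false (cong (not ∘ does) decided))
    where
    missed : Fin N → Bool
    missed u = not (does (visited? k u))
    ⇒missed : ∀ u → ¬ Visited k u → missed u ≡ true
    ⇒missed u h = cong not (dec-false (visited? k u) h)
    missed⇒ : ∀ u → missed u ≡ true → ¬ Visited k u
    missed⇒ u m h = true≢false m (cong not (dec-true (visited? k u) h))
    start-visited : missed v₀ ≡ false
    start-visited = cong not (dec-true (visited? k v₀) (zero , refl))
    at : ∀ i {u} → i < suc k → v i ≡ u → Visited k u
    at i lt p = fromℕ< lt , trans (cong v (toℕ-fromℕ< lt)) p
    neighbour-visited : ∀ i → i < suc k → ∀ u → adj G (v i) u ≡ true → Visited k u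
    neighbour-visited zero lt u a with start-neighbours k d e u a
    ... | inj₂ p = at k (n<1+n k) p
    ... | inj₁ p = at 1 (s≤s (n≢0⇒n>0 (λ k≡0 → v-loop 0 (trans e (cong (v ∘ suc) k≡0))))) p
    neighbour-visited (suc i) lt u a with v-neighbours i u a
    ... | inj₁ p = at i (<-trans (n<1+n i) lt) p
    ... | inj₂ p with m≤n⇒m<n∨m≡n lt
    ...   | inj₁ lt′ = at (2 + i) lt′ p
    ...   | inj₂ refl = at 0 z<s (trans e p)
    closed : ∀ i j → adj G i j ≡ true → missed i ≡ true → missed j ≡ true
    closed i j a m = ⇒missed j (λ (x , p) → missed⇒ i m
      (neighbour-visited (toℕ x) (toℕ<n x) i (trans (adj-sym G _ i) (trans (cong (adj G i) p) a))))

  few-visited : ∀ k → Distinct (suc k) → v 0 ≡ v (suc k) → N ≤ suc k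
  few-visited k d e = injective⇒≤ {f = index} (λ {x} {y} p →
    trans (sym (index-v x)) (trans (cong (v ∘ toℕ) p) (index-v y)))
    where
    index : Fin N → Fin (suc k)
    index u = fromℕ< (proj₁ (proj₂ (all-visited k d e u)))
    index-v : ∀ u → v (toℕ (index u)) ≡ u
    index-v u = trans (cong v (toℕ-fromℕ< (proj₁ (proj₂ (all-visited k d e u))))) (proj₂ (proj₂ (all-visited k d e u)))

  -- A first repetition would close the walk at v₀, and a walk that closes before step N would have
  -- visited all vertices in fewer than N steps.
  distinct : ∀ k → k ≤ N → Distinct k
  distinct (suc k) k<N i j i<j (s≤s j≤k) with m≤n⇒m<n∨m≡n j≤k
  ... | inj₁ j<k  = distinct k (<⇒≤ k<N) i j i<j j<k
  distinct (suc zero)    k<N i j () (s≤s j≤k) | inj₂ refl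
  distinct (suc (suc k)) k<N i j i<j (s≤s j≤k) | inj₂ refl = λ p →
    let d = distinct (suc k) (<⇒≤ k<N)
        i≡0 = closes-at-start i (suc k) d i<j p
    in <⇒≱ k<N (few-visited k d (trans (cong v (sym i≡0)) p))

  v-injective : ∀ {i j} → i < N → j < N → v i ≡ v j → i ≡ j
  v-injective {i} {j} i<N j<N p with <-cmp i j
  ... | tri< lt _ _ = contradiction p (distinct N ≤-refl i j lt j<N)
  ... | tri≈ _ e _  = e
  ... | tri> _ _ lt = contradiction (sym p) (distinct N ≤-refl j i lt i<N)

  -- By the pigeonhole principle v N repeats one of the N earlier vertices, and `closes-at-start`
  -- says which one.
  v-closed : v 0 ≡ v N
  v-closed with any? (λ i → v (toℕ {N} i) ≟ v N)
  ... | yes (i , p) = trans (cong v (sym (closes-at-start (toℕ i) N (distinct N ≤-refl) (toℕ<n i) p))) p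
  ... | no none = contradiction (injective⇒≤ {m = suc N} {f = v ∘ toℕ} (λ {x} {y} p → toℕ-injective (inj p))) 1+n≰n
    where
    fresh : ∀ {i} → i < N → v i ≢ v N
    fresh lt p = none (fromℕ< lt , trans (cong v (toℕ-fromℕ< lt)) p)
    inj : ∀ {x y : Fin (suc N)} → v (toℕ x) ≡ v (toℕ y) → toℕ x ≡ toℕ y
    inj {x} {y} p with m≤n⇒m<n∨m≡n (s≤s⁻¹ (toℕ<n x)) | m≤n⇒m<n∨m≡n (s≤s⁻¹ (toℕ<n y))
    ... | inj₁ lx | inj₁ ly = v-injective lx ly p
    ... | inj₁ lx | inj₂ ey = contradiction (trans p (cong v ey)) (fresh lx)
    ... | inj₂ ex | inj₁ ly = contradiction (trans (sym p) (cong v ex)) (fresh ly)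
    ... | inj₂ ex | inj₂ ey = trans ex (sym ey)

  φ : Fin N → Fin N
  φ i = v (toℕ i)

  φ-injective : ∀ {i j} → φ i ≡ φ j → i ≡ j
  φ-injective {i} {j} p = toℕ-injective (v-injective (toℕ<n i) (toℕ<n j) p)

  last-neighbours : ∀ u → adj G (v 0) u ≡ true → v 1 ≡ u ⊎ (∃[ k ] suc k ≡ N × v k ≡ u)
  last-neighbours = at N refl (≤-trans (s≤s z≤n) 3≤N)
    where
    at : ∀ M → M ≡ N → 0 < M → ∀ u → adj G (v 0) u ≡ true → v 1 ≡ u ⊎ (∃[ k ] suc k ≡ N × v k ≡ u)
    at (suc k) refl _ u a = [ inj₁ , (λ p → inj₂ (k , refl , p)) ]′ (start-neighbours k (distinct N ≤-refl) v-closed u a)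

  visit : ∀ u → ∃[ i ] φ i ≡ u
  visit = at N refl (≤-trans (s≤s z≤n) 3≤N)
    where
    at : ∀ M → M ≡ N → 0 < M → ∀ u → ∃[ i ] φ i ≡ u
    at (suc k) refl _ u with all-visited k (distinct N ≤-refl) v-closed u
    ... | i , lt , p = fromℕ< lt , trans (cong v (toℕ-fromℕ< lt)) p

  bijection : Fin N ↔ Fin N
  bijection = mk↔ₛ′ φ (λ u → proj₁ (visit u)) (λ u → proj₂ (visit u)) (λ i → φ-injective (proj₂ (visit (φ i))))

  edge⇒Next : ∀ i j → adj G (φ i) (φ j) ≡ true → Next N i j ⊎ Next N j i
  edge⇒Next i j = at (toℕ i) (toℕ j) refl refl
    where
    -- The positions become variables to be matched on: position 0 has its predecessor at the far
    -- end and is served by `last-neighbours`.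
    at : ∀ x y → x ≡ toℕ i → y ≡ toℕ j → adj G (v x) (v y) ≡ true → Next N i j ⊎ Next N j i
    at zero y x≡ y≡ a with last-neighbours (v y) a
    ... | inj₁ p = inj₁ (inj₁ (trans (cong suc (sym x≡)) (trans (v-injective (≤-trans (s≤s (s≤s z≤n)) 3≤N) (subst (_< N) (sym y≡) (toℕ<n j)) p) y≡)))
    ... | inj₂ (k , refl , p) = inj₂ (inj₂ (cong suc (trans (sym y≡) (sym (v-injective (n<1+n k) (subst (_< N) (sym y≡) (toℕ<n j)) p))) , sym x≡))
    at (suc x) y x≡ y≡ a with v-neighbours x (v y) a
    ... | inj₁ p = inj₂ (inj₁ (trans (cong suc (trans (sym y≡) (sym (v-injective x<N y<N p)))) x≡))
      where
      x<N = <-trans (n<1+n x) (subst (_< N) (sym x≡) (toℕ<n i))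
      y<N = subst (_< N) (sym y≡) (toℕ<n j)
    ... | inj₂ p with m≤n⇒m<n∨m≡n (toℕ<n i)
    ...   | inj₁ lt = inj₁ (inj₁ (trans (trans (cong suc (sym x≡)) (v-injective (subst (λ z → suc z < N) (sym x≡) lt) y<N p)) y≡))
      where y<N = subst (_< N) (sym y≡) (toℕ<n j)
    ...   | inj₂ eq = inj₁ (inj₂ (eq , trans (sym y≡) (sym (v-injective (≤-trans (s≤s z≤n) 3≤N) y<N v0≡))))
      where
      y<N = subst (_< N) (sym y≡) (toℕ<n j)
      v0≡ : v 0 ≡ v y
      v0≡ = trans v-closed (trans (cong v (trans (sym eq) (cong suc (sym x≡)))) p)

  Next⇒edge : ∀ i j → Next N i j → adj G (φ i) (φ j) ≡ true
  Next⇒edge i j (inj₁ e) = subst (λ y → adj G (φ i) (v y) ≡ true) e (v-edge (toℕ i))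
  Next⇒edge i j (inj₂ (e , f)) = trans (cong (adj G (φ i)) (trans (cong v f) (trans v-closed (cong v (sym e))))) (v-edge (toℕ i))

  φ-preserves : ∀ i j → adj G (φ i) (φ j) ≡ adj (C N) i j
  φ-preserves i j = ⇔→≡ (mk⇔
    (λ a → [ joined i j , (λ h → trans (adj-sym (C N) i j) (joined j i h)) ]′ (edge⇒Next i j a))
    (λ a → [ Next⇒edge i j , (λ h → trans (adj-sym G (φ i) (φ j)) (Next⇒edge j i h)) ]′ (C-adj⇒ i j a)))
    where
    joined : ∀ i j → Next N i j → adj (C N) i j ≡ true
    joined i j h = ⇒C-adj i j (Next-≢ (≤-trans (n≤1+n 2) 3≤N) h) h

-- Sums over a set of vertices

sumOver : ∀ {n} → (Fin n → Bool) → (Fin n → ℕ) → ℕ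
sumOver S f = sum (λ v → ⟦ S v ⟧ * f v)

∁ : ∀ {n} → (Fin n → Bool) → (Fin n → Bool)
∁ S v = not (S v)

∈∁ : ∀ {n} (S : Fin n → Bool) {v} → S v ≡ false → ∁ S v ≡ true
∈∁ S e = cong not e

∈∁⇒ : ∀ {n} (S : Fin n → Bool) {v} → ∁ S v ≡ true → S v ≡ false
∈∁⇒ S = not-true

⟦⟧*-mono : ∀ b {x y} → (b ≡ true → x ≤ y) → ⟦ b ⟧ * x ≤ ⟦ b ⟧ * y
⟦⟧*-mono true  h = *-monoʳ-≤ 1 (h refl)
⟦⟧*-mono false h = z≤n

⟦⟧*-cong : ∀ b {x y} → (b ≡ true → x ≡ y) → ⟦ b ⟧ * x ≡ ⟦ b ⟧ * y
⟦⟧*-cong true  h = cong (1 *_) (h refl)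
⟦⟧*-cong false h = refl

sumOver-mono : ∀ {n} (S : Fin n → Bool) {f g} → (∀ v → S v ≡ true → f v ≤ g v) → sumOver S f ≤ sumOver S g
sumOver-mono S h = sum-mono (λ v → ⟦⟧*-mono (S v) (h v))

sumOver-cong : ∀ {n} (S : Fin n → Bool) {f g} → (∀ v → S v ≡ true → f v ≡ g v) → sumOver S f ≡ sumOver S g
sumOver-cong S h = sum-cong-≗ (λ v → ⟦⟧*-cong (S v) (h v))

sumOver-+ : ∀ {n} (S : Fin n → Bool) f g → sumOver S (λ v → f v + g v) ≡ sumOver S f + sumOver S g
sumOver-+ S f g = trans (sum-cong-≗ (λ v → *-distribˡ-+ ⟦ S v ⟧ (f v) (g v)))
  (∑-distrib-+ (λ v → ⟦ S v ⟧ * f v) (λ v → ⟦ S v ⟧ * g v))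

sumOver-const : ∀ {n} (S : Fin n → Bool) c → sumOver S (λ _ → c) ≡ card S * c
sumOver-const {n} S c = sym (*-distribʳ-sum {n} c (λ v → ⟦ S v ⟧))

sumOver-⟦⟧ : ∀ {n} (S U : Fin n → Bool) → sumOver S (λ v → ⟦ U v ⟧) ≡ card (λ v → S v ∧ U v)
sumOver-⟦⟧ S U = sum-cong-≗ (λ v → sym (⟦⟧-∧ (S v) (U v)))

sumOver-− : ∀ {n} (S : Fin n → Bool) f {x} → S x ≡ true → sumOver S f ≡ f x + sumOver (S − x) f
sumOver-− S f {x} Sx = trans (sum-extract (λ v → ⟦ S v ⟧ * f v) x)
  (cong₂ _+_ (trans (cong (λ b → ⟦ b ⟧ * f x) Sx) (*-identityˡ (f x))) (sum-cong-≗ step))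
  where
  step : ∀ u → ((λ v → ⟦ S v ⟧ * f v) ∖ x) u ≡ ⟦ (S − x) u ⟧ * f u
  step u with does (x ≟ u)
  ... | true  = refl
  ... | false = refl

sumOver-term : ∀ {n} (S : Fin n → Bool) f {x} → S x ≡ true → f x ≤ sumOver S f
sumOver-term S f {x} Sx = subst (f x ≤_) (sym (sumOver-− S f Sx)) (m≤m+n (f x) _)

sumOver-term₂ : ∀ {n} (S : Fin n → Bool) f {x y} → S x ≡ true → S y ≡ true → x ≢ y → f x + f y ≤ sumOver S f
sumOver-term₂ S f {x} {y} Sx Sy x≢y = subst (f x + f y ≤_) (sym (sumOver-− S f Sx))
  (+-monoʳ-≤ (f x) (sumOver-term (S − x) f (trans (−-other S x≢y) Sy)))

sumOver-term₃ : ∀ {n} (S : Fin n → Bool) f {x y z} → S x ≡ true → S y ≡ true → S z ≡ true → x ≢ y → x ≢ z → y ≢ z →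
  f x + (f y + f z) ≤ sumOver S f
sumOver-term₃ S f {x} {y} {z} Sx Sy Sz x≢y x≢z y≢z = subst (f x + (f y + f z) ≤_) (sym (sumOver-− S f Sx))
  (+-monoʳ-≤ (f x) (sumOver-term₂ (S − x) f (trans (−-other S x≢y) Sy) (trans (−-other S x≢z) Sz) y≢z))

sumOver≡0⇒ : ∀ {n} (S : Fin n → Bool) f → sumOver S f ≡ 0 → ∀ v → S v ≡ true → f v ≡ 0
sumOver≡0⇒ S f e v Sv = n≤0⇒n≡0 (subst (f v ≤_) e (sumOver-term S f Sv))

sumOver>0 : ∀ {n} (S : Fin n → Bool) f → 0 < sumOver S f → ∃[ v ] S v ≡ true × 0 < f v
sumOver>0 S f lt with positive-term (λ v → ⟦ S v ⟧ * f v) lt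
... | v , p = v , both (S v) (f v) p
  where
  both : ∀ b x → 0 < ⟦ b ⟧ * x → b ≡ true × 0 < x
  both true x p = refl , subst (0 <_) (*-identityˡ x) p

sum-partition : ∀ {n} (S : Fin n → Bool) f → sum f ≡ sumOver S f + sumOver (∁ S) f
sum-partition S f = trans (sum-cong-≗ (λ v → either (S v) (f v)))
  (∑-distrib-+ (λ v → ⟦ S v ⟧ * f v) (λ v → ⟦ ∁ S v ⟧ * f v))
  where
  either : ∀ b x → x ≡ ⟦ b ⟧ * x + ⟦ not b ⟧ * x
  either true  x = sym (trans (+-identityʳ _) (+-identityʳ x))
  either false x = sym (+-identityʳ x)

card-∁ : ∀ {n} (S : Fin n → Bool) → card S + card (∁ S) ≡ n
card-∁ {n} S = begin
  card S + card (∁ S)                                 ≡⟨ cong₂ _+_ (sym (one S)) (sym (one (∁ S))) ⟩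
  sumOver S (λ _ → 1) + sumOver (∁ S) (λ _ → 1)       ≡⟨ sym (sum-partition S (λ _ → 1)) ⟩
  sum {n} (λ _ → 1)                                   ≡⟨ trans (sum-const n 1) (*-identityʳ n) ⟩
  n                                                   ∎
  where
  open ≡-Reasoning
  one : ∀ S → sumOver S (λ _ → 1) ≡ card S
  one S = trans (sumOver-const S 1) (*-identityʳ (card S))

-- Degrees into a set, double counting and triangles

module Degrees {N : ℕ} (G : Graph N) where

  degIn-sumOver : ∀ S v → degIn G S v ≡ sumOver S (λ u → ⟦ adj G v u ⟧)
  degIn-sumOver S v = sym (sumOver-⟦⟧ S (adj G v))

  double-count : ∀ S U → sumOver S (degIn G U) ≡ sumOver U (degIn G S)
  double-count S U = begin
    sumOver S (degIn G U)                             ≡⟨ expand S U ⟩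
    sum₂ (λ v u → ⟦ S v ⟧ * (⟦ U u ⟧ * ⟦ adj G v u ⟧)) ≡⟨ ∑-comm (λ v u → ⟦ S v ⟧ * (⟦ U u ⟧ * ⟦ adj G v u ⟧)) ⟩
    sum₂ (λ u v → ⟦ S v ⟧ * (⟦ U u ⟧ * ⟦ adj G v u ⟧)) ≡⟨ sum₂-cong turn ⟩
    sum₂ (λ u v → ⟦ U u ⟧ * (⟦ S v ⟧ * ⟦ adj G u v ⟧)) ≡⟨ sym (expand U S) ⟩
    sumOver U (degIn G S)                             ∎
    where
    open ≡-Reasoning
    expand : ∀ S U → sumOver S (degIn G U) ≡ sum₂ (λ v u → ⟦ S v ⟧ * (⟦ U u ⟧ * ⟦ adj G v u ⟧))
    expand S U = sum-cong-≗ (λ v → trans (cong (⟦ S v ⟧ *_) (degIn-sumOver U v)) (*-distribˡ-sum {N} ⟦ S v ⟧ _))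
    turn : ∀ u v → ⟦ S v ⟧ * (⟦ U u ⟧ * ⟦ adj G v u ⟧) ≡ ⟦ U u ⟧ * (⟦ S v ⟧ * ⟦ adj G u v ⟧)
    turn u v = trans (cong (λ b → ⟦ S v ⟧ * (⟦ U u ⟧ * ⟦ b ⟧)) (adj-sym G v u))
      (solve 3 (λ s u a → s :* (u :* a) := u :* (s :* a)) refl ⟦ S v ⟧ ⟦ U u ⟧ ⟦ adj G u v ⟧)

  deg-partition : ∀ S v → deg G v ≡ degIn G S v + degIn G (∁ S) v
  deg-partition S v = trans (sum-partition S (λ u → ⟦ adj G v u ⟧))
    (sym (cong₂ _+_ (degIn-sumOver S v) (degIn-sumOver (∁ S) v)))

  degIn-− : ∀ S {x} → S x ≡ true → ∀ v → degIn G S v ≡ ⟦ adj G v x ⟧ + degIn G (S − x) v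
  degIn-− S {x} Sx v = trans (degIn-sumOver S v)
    (trans (sumOver-− S (λ u → ⟦ adj G v u ⟧) Sx) (cong (⟦ adj G v x ⟧ +_) (sym (degIn-sumOver (S − x) v))))

  degIn-⊕ : ∀ S {x} → S x ≡ false → ∀ v → degIn G (S ⊕ x) v ≡ ⟦ adj G v x ⟧ + degIn G S v
  degIn-⊕ S {x} Sx v = trans (degIn-− (S ⊕ x) (⊕-∈ S x) v) (cong (⟦ adj G v x ⟧ +_) (card-cong same))
    where
    same : ∀ u → (S ⊕ x − x) u ∧ adj G v u ≡ S u ∧ adj G v u
    same u with x ≟ u
    ... | yes refl = cong (_∧ adj G v x) (sym Sx)
    ... | no _ = refl

  degIn≡deg : ∀ S v → (∀ u → adj G v u ≡ true → S u ≡ true) → degIn G S v ≡ deg G v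
  degIn≡deg S v h = card-cong same
    where
    same : ∀ u → S u ∧ adj G v u ≡ adj G v u
    same u with adj G v u in e
    ... | true  = trans (∧-identityʳ (S u)) (h u e)
    ... | false = ∧-zeroʳ (S u)

  degIn≡0 : ∀ S v → (∀ u → adj G v u ≡ true → S u ≡ false) → degIn G S v ≡ 0
  degIn≡0 S v h = sum-zero empty
    where
    empty : ∀ u → ⟦ S u ∧ adj G v u ⟧ ≡ 0
    empty u with adj G v u in e
    ... | true  = cong ⟦_⟧ (trans (∧-identityʳ (S u)) (h u e))
    ... | false = cong ⟦_⟧ (∧-zeroʳ (S u))

  degIn≡0⇒ : ∀ S v → degIn G S v ≡ 0 → ∀ u → adj G v u ≡ true → S u ≡ false
  degIn≡0⇒ S v e u a = trans (sym (trans (cong (S u ∧_) a) (∧-identityʳ (S u)))) (card≡0 e u)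

  Independent-degIn : ∀ {S} → Independent (adj G) S → ∀ v → S v ≡ true → degIn G S v ≡ 0
  Independent-degIn {S} I v Sv = degIn≡0 S v (λ u a → ¬true (λ Su → true≢false a (I v u Sv Su)))

  -- Every edge has at most one end in an independent set.
  edge-count : ∀ S → Independent (adj G) S →
    sum (deg G) ≡ 2 * sumOver (∁ S) (degIn G S) + sumOver (∁ S) (degIn G (∁ S))
  edge-count S I = begin
    sum (deg G)
      ≡⟨ sum-partition S (deg G) ⟩
    sumOver S (deg G) + sumOver (∁ S) (deg G)
      ≡⟨ cong₂ _+_ (sumOver-cong S (λ v Sv → trans (deg-partition S v) (cong (_+ degIn G (∁ S) v) (Independent-degIn I v Sv))))
           (trans (sumOver-cong (∁ S) (λ v _ → deg-partition S v)) (sumOver-+ (∁ S) (degIn G S) (degIn G (∁ S)))) ⟩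
    sumOver S (degIn G (∁ S)) + (sumOver (∁ S) (degIn G S) + sumOver (∁ S) (degIn G (∁ S)))
      ≡⟨ cong (_+ (e + r)) (double-count S (∁ S)) ⟩
    e + (e + r)
      ≡⟨ solve 2 (λ e r → e :+ (e :+ r) := con 2 :* e :+ r) refl e r ⟩
    2 * e + r ∎
    where
    open ≡-Reasoning
    e = sumOver (∁ S) (degIn G S)
    r = sumOver (∁ S) (degIn G (∁ S))

  -- The edges between X and Y number twice the size of X and also twice the size of Y.
  balanced-card : ∀ X Y → (∀ v → X v ≡ true → degIn G Y v ≡ 2) → (∀ v → Y v ≡ true → degIn G X v ≡ 2) → card X ≡ card Y
  balanced-card X Y hX hY = *-cancelʳ-≡ _ _ 2 (begin
    card X * 2              ≡⟨ sym (sumOver-const X 2) ⟩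
    sumOver X (λ _ → 2)     ≡⟨ sym (sumOver-cong X hX) ⟩
    sumOver X (degIn G Y)   ≡⟨ double-count X Y ⟩
    sumOver Y (degIn G X)   ≡⟨ sumOver-cong Y hY ⟩
    sumOver Y (λ _ → 2)     ≡⟨ sumOver-const Y 2 ⟩
    card Y * 2              ∎)
    where open ≡-Reasoning

  -- The triangles of a properly 3-coloured graph are rainbow.
  triangles≤ : (colour : Fin N → Fin 3) → (∀ i j → adj G i j ≡ true → colour i ≢ colour j) →
    (F : Fin N → Fin N → Fin N → ℕ) →
    (∀ i j k → colour i ≡ zero → colour j ≡ suc zero → colour k ≡ suc (suc zero) →
      adj G i j ≡ true → adj G i k ≡ true → adj G j k ≡ true → 1 ≤ F i j k) →
    triangles G ≤ 6 * sum₃ F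
  triangles≤ colour proper F rainbow = ≤-trans (sum-mono (λ i → sum-mono (λ j → sum-mono (pointwise i j)))) (≤-reflexive total)
    where
    open ≡-Reasoning
    F₁ F₂ F₃ F₄ F₅ F₆ : Fin N → Fin N → Fin N → ℕ
    F₁ i j k = F i j k
    F₂ i j k = F i k j
    F₃ i j k = F j i k
    F₄ i j k = F j k i
    F₅ i j k = F k i j
    F₆ i j k = F k j i
    -- Of the six orders of a rainbow triangle just one lists the colours as 0, 1, 2. For it
    -- `rainbow` gives a positive summand, and each of the six summands has total `sum₃ F`.
    R : Fin N → Fin N → Fin N → ℕ
    R i j k = (F₁ i j k + F₂ i j k) + ((F₃ i j k + F₄ i j k) + (F₅ i j k + F₆ i j k))
    s₂ : sum₃ F₂ ≡ sum₃ F
    s₂ = sum-cong-≗ (λ i → ∑-comm (λ j k → F i k j))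
    s₃ : sum₃ F₃ ≡ sum₃ F
    s₃ = ∑-comm (λ i j → sum (F j i))
    s₄ : sum₃ F₄ ≡ sum₃ F
    s₄ = trans (∑-comm (λ i j → sum (λ k → F j k i))) s₂
    s₅ : sum₃ F₅ ≡ sum₃ F
    s₅ = trans (sum-cong-≗ (λ i → ∑-comm (λ j k → F k i j))) s₃
    s₆ : sum₃ F₆ ≡ sum₃ F
    s₆ = trans (sum-cong-≗ (λ i → ∑-comm (λ j k → F k j i))) s₄
    total : sum₃ R ≡ 6 * sum₃ F
    total = begin
      sum₃ R
        ≡⟨ sum₃-+ (λ i j k → F₁ i j k + F₂ i j k) (λ i j k → (F₃ i j k + F₄ i j k) + (F₅ i j k + F₆ i j k)) ⟩
      sum₃ (λ i j k → F₁ i j k + F₂ i j k) + sum₃ (λ i j k → (F₃ i j k + F₄ i j k) + (F₅ i j k + F₆ i j k))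
        ≡⟨ cong₂ _+_ (sum₃-+ F₁ F₂) (trans (sum₃-+ (λ i j k → F₃ i j k + F₄ i j k) (λ i j k → F₅ i j k + F₆ i j k))
             (cong₂ _+_ (sum₃-+ F₃ F₄) (sum₃-+ F₅ F₆))) ⟩
      (sum₃ F + sum₃ F₂) + ((sum₃ F₃ + sum₃ F₄) + (sum₃ F₅ + sum₃ F₆))
        ≡⟨ cong₂ _+_ (cong (sum₃ F +_) s₂) (cong₂ _+_ (cong₂ _+_ s₃ s₄) (cong₂ _+_ s₅ s₆)) ⟩
      (sum₃ F + sum₃ F) + ((sum₃ F + sum₃ F) + (sum₃ F + sum₃ F))
        ≡⟨ solve 1 (λ f → (f :+ f) :+ ((f :+ f) :+ (f :+ f)) := con 6 :* f) refl (sum₃ F) ⟩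
      6 * sum₃ F ∎
    flip : ∀ {i j} → adj G i j ≡ true → adj G j i ≡ true
    flip {i} {j} a = trans (adj-sym G j i) a
    into₁ : ∀ {a b c} → 1 ≤ a → 1 ≤ a + b + c
    into₁ le = ≤-trans le (≤-trans (m≤m+n _ _) (m≤m+n _ _))
    into₂ : ∀ {a b c} → 1 ≤ b → 1 ≤ a + b + c
    into₂ {a} le = ≤-trans le (≤-trans (m≤n+m _ a) (m≤m+n _ _))
    into₃ : ∀ {a b} → 1 ≤ b → 1 ≤ a + b
    into₃ {a} le = ≤-trans le (m≤n+m _ a)
    pointwise : ∀ i j k → tri (adj G i j) (adj G i k) (adj G j k) ≤ R i j k
    pointwise i j k with adj G i j in ij | adj G i k in ik | adj G j k in jk
    ... | false | _ | _ = z≤n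
    ... | true | false | _ = z≤n
    ... | true | true | false = z≤n
    ... | true | true | true with colour i in ci | colour j in cj | colour k in ck
                                | proper i j ij | proper i k ik | proper j k jk
    ...   | zero | zero | _ | p | _ | _ = contradiction refl p
    ...   | zero | suc _ | zero | _ | p | _ = contradiction refl p
    ...   | zero | suc zero | suc zero | _ | _ | p = contradiction refl p
    ...   | zero | suc (suc zero) | suc (suc zero) | _ | _ | p = contradiction refl p
    ...   | suc zero | suc zero | _ | p | _ | _ = contradiction refl p
    ...   | suc (suc zero) | suc (suc zero) | _ | p | _ | _ = contradiction refl p
    ...   | suc zero | _ | suc zero | _ | p | _ = contradiction refl p
    ...   | suc (suc zero) | _ | suc (suc zero) | _ | p | _ = contradiction refl p
    ...   | suc _ | zero | zero | _ | _ | p = contradiction refl p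
    ...   | suc zero | suc (suc zero) | suc (suc zero) | _ | _ | p = contradiction refl p
    ...   | suc (suc zero) | suc zero | suc zero | _ | _ | p = contradiction refl p
    ...   | zero | suc zero | suc (suc zero) | _ | _ | _ = into₁ {b = F₂ i j k} (rainbow i j k ci cj ck ij ik jk)
    ...   | zero | suc (suc zero) | suc zero | _ | _ | _ = into₂ {F₁ i j k} (rainbow i k j ci ck cj ik ij (flip jk))
    ...   | suc zero | zero | suc (suc zero) | _ | _ | _ = into₃ {F₁ i j k + F₂ i j k} (into₁ {b = F₄ i j k} (rainbow j i k cj ci ck (flip ij) jk ik))
    ...   | suc (suc zero) | zero | suc zero | _ | _ | _ = into₃ {F₁ i j k + F₂ i j k} (into₂ {F₃ i j k} (rainbow j k i cj ck ci jk (flip ij) (flip ik)))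
    ...   | suc zero | suc (suc zero) | zero | _ | _ | _ = into₃ {F₁ i j k + F₂ i j k} (into₃ {F₃ i j k + F₄ i j k} (≤-trans (rainbow k i j ck ci cj (flip ik) (flip jk) ij) (m≤m+n _ _)))
    ...   | suc (suc zero) | suc zero | zero | _ | _ | _ = into₃ {F₁ i j k + F₂ i j k} (into₃ {F₃ i j k + F₄ i j k} (into₃ {F₅ i j k} (rainbow k j i ck cj ci (flip jk) (flip ik) (flip ij))))

  triangles≤-tripartite : (X Y Z : Fin N → Bool) → (∀ v → X v ≡ false → Y v ≡ false → Z v ≡ true) →
    Independent (adj G) X → Independent (adj G) Y → Independent (adj G) Z →
    (F : Fin N → Fin N → Fin N → ℕ) →
    (∀ i j k → X i ≡ true → Y j ≡ true → Z k ≡ true → adj G i j ≡ true → adj G i k ≡ true → adj G j k ≡ true → 1 ≤ F i j k) →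
    triangles G ≤ 6 * sum₃ F
  triangles≤-tripartite X Y Z cover IX IY IZ F h = triangles≤ colour proper F
    (λ i j k ci cj ck → h i j k (first i ci) (second j cj) (third k ck))
    where
    colour : Fin N → Fin 3
    colour v = if X v then zero else if Y v then suc zero else suc (suc zero)
    first : ∀ v → colour v ≡ zero → X v ≡ true
    first v e with X v | Y v
    first v e  | true  | _     = refl
    first v () | false | true
    first v () | false | false
    second : ∀ v → colour v ≡ suc zero → Y v ≡ true
    second v e with X v | Y v
    second v () | true  | _
    second v e  | false | true  = refl
    second v () | false | false
    third : ∀ v → colour v ≡ suc (suc zero) → Z v ≡ true
    third v e with X v in Xv | Y v in Yv
    third v () | true  | _
    third v () | false | true
    third v e  | false | false = cover v Xv Yv
    proper : ∀ i j → adj G i j ≡ true → colour i ≢ colour j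
    proper i j a e with colour i in ci | colour j in cj
    proper i j a refl | zero | _ = true≢false a (IX i j (first i ci) (first j cj))
    proper i j a refl | suc zero | _ = true≢false a (IY i j (second i ci) (second j cj))
    proper i j a refl | suc (suc zero) | _ = true≢false a (IZ i j (third i ci) (third j cj))

sum₃-product : ∀ {n} (f g h : Fin n → ℕ) → sum₃ (λ i j k → f i * (g j * h k)) ≡ sum f * (sum g * sum h)
sum₃-product {n} f g h = begin
  sum₃ (λ i j k → f i * (g j * h k))
    ≡⟨ sum₂-cong (λ i j → trans (sym (*-distribˡ-sum {n} (f i) (λ k → g j * h k))) (cong (f i *_) (sym (*-distribˡ-sum {n} (g j) h)))) ⟩
  sum₂ (λ i j → f i * (g j * sum h))
    ≡⟨ sum-cong-≗ (λ i → trans (sym (*-distribˡ-sum {n} (f i) (λ j → g j * sum h))) (cong (f i *_) (sym (*-distribʳ-sum {n} (sum h) g)))) ⟩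
  sum (λ i → f i * (sum g * sum h))
    ≡⟨ sym (*-distribʳ-sum {n} (sum g * sum h) f) ⟩
  sum f * (sum g * sum h) ∎
  where open ≡-Reasoning

-- Exchanging an edge

pair : ∀ {n} → Fin n → Fin n → Relation n
pair x y i j = (does (x ≟ i) ∧ does (y ≟ j)) ∨ (does (y ≟ i) ∧ does (x ≟ j))

pair-sym : ∀ {n} (x y i j : Fin n) → pair x y i j ≡ pair x y j i
pair-sym x y i j = trans (∨-comm (does (x ≟ i) ∧ does (y ≟ j)) (does (y ≟ i) ∧ does (x ≟ j)))
  (cong₂ _∨_ (∧-comm (does (y ≟ i)) (does (x ≟ j))) (∧-comm (does (x ≟ i)) (does (y ≟ j))))

pair⇒ : ∀ {n} {x y i j : Fin n} → pair x y i j ≡ true → (x ≡ i × y ≡ j) ⊎ (y ≡ i × x ≡ j)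
pair⇒ {x = x} {y} {i} {j} e with ∨-true {does (x ≟ i) ∧ does (y ≟ j)} e
... | inj₁ h = inj₁ (does-≟⇒≡ (proj₁ (∧-true h)) , does-≟⇒≡ (proj₂ (∧-true {does (x ≟ i)} h)))
... | inj₂ h = inj₂ (does-≟⇒≡ (proj₁ (∧-true h)) , does-≟⇒≡ (proj₂ (∧-true {does (y ≟ i)} h)))

⇒pair : ∀ {n} (x y : Fin n) → pair x y x y ≡ true
⇒pair x y = ∨-introˡ (cong₂ _∧_ (dec-true (x ≟ x) refl) (dec-true (y ≟ y) refl))

pair-left : ∀ {n} {x y : Fin n} → x ≢ y → ∀ j → pair x y x j ≡ does (y ≟ j)
pair-left {x = x} {y} x≢y j = trans (cong₂ (λ u v → (u ∧ does (y ≟ j)) ∨ (v ∧ does (x ≟ j)))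
  (dec-true (x ≟ x) refl) (dec-false (y ≟ x) (x≢y ∘ sym))) (∨-identityʳ _)

pair-right : ∀ {n} {x y : Fin n} → x ≢ y → ∀ j → pair x y y j ≡ does (x ≟ j)
pair-right {x = x} {y} x≢y j = cong₂ (λ u v → (u ∧ does (y ≟ j)) ∨ (v ∧ does (x ≟ j)))
  (dec-false (x ≟ y) x≢y) (dec-true (y ≟ y) refl)

pair-off : ∀ {n} {x y i : Fin n} → x ≢ i → y ≢ i → ∀ j → pair x y i j ≡ false
pair-off {x = x} {y} {i} x≢i y≢i j = cong₂ (λ u v → (u ∧ does (y ≟ j)) ∨ (v ∧ does (x ≟ j)))
  (dec-false (x ≟ i) x≢i) (dec-false (y ≟ i) y≢i)

pair-injective : ∀ {m n} (φ : Fin m → Fin n) → (∀ {i j} → φ i ≡ φ j → i ≡ j) → ∀ x y i j →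
  pair (φ x) (φ y) (φ i) (φ j) ≡ pair x y i j
pair-injective φ inj x y i j =
  cong₂ _∨_ (cong₂ _∧_ (same x i) (same y j)) (cong₂ _∧_ (same y i) (same x j))
  where
  same : ∀ x i → does (φ x ≟ φ i) ≡ does (x ≟ i)
  same x i with x ≟ i
  ... | yes e = dec-true (φ x ≟ φ i) (cong φ e)
  ... | no h  = dec-false (φ x ≟ φ i) (h ∘ inj)

replaceEdge : ∀ {n} (G : Graph n) {x z : Fin n} (y : Fin n) → x ≢ z → Graph n
replaceEdge G {x} {z} y x≢z = record
  { adj    = λ i j → (adj G i j ∧ not (pair x y i j)) ∨ pair x z i j
  ; sym    = λ i j → cong₂ _∨_ (cong₂ (λ u v → u ∧ not v) (adj-sym G i j) (pair-sym x y i j)) (pair-sym x z i j)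
  ; irrefl = λ i → cong₂ _∨_ (cong (_∧ not (pair x y i i)) (adj-irrefl G i))
      (¬true (λ e → [ (λ (p , q) → x≢z (trans p (sym q))) , (λ (p , q) → x≢z (trans q (sym p))) ]′ (pair⇒ {x = x} {z} e)))
  }

-- Moving the edge back restores `G` because xy was an edge and xz was not. Together with `D-from-C`
-- this carries an isomorphism from the modified graph to a cycle back to the original graph.
replaceEdge-undo : ∀ {n} (G : Graph n) {x z : Fin n} (y : Fin n) (x≢z : x ≢ z) → adj G x y ≡ true → adj G x z ≡ false →
  ∀ i j → adj G i j ≡ (adj (replaceEdge G y x≢z) i j ∧ not (pair x z i j)) ∨ pair x y i j
replaceEdge-undo G {x} {z} y x≢z xy xz i j = bool (adj G i j) (pair x y i j) (pair x z i j)
  (λ e → [ (λ { (refl , refl) → xy }) , (λ { (refl , refl) → trans (adj-sym G i j) xy }) ]′ (pair⇒ {x = x} {y} e))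
  (λ e → [ (λ { (refl , refl) → xz }) , (λ { (refl , refl) → trans (adj-sym G i j) xz }) ]′ (pair⇒ {x = x} {z} e))
  where
  bool : ∀ g u v → (u ≡ true → g ≡ true) → (v ≡ true → g ≡ false) → g ≡ (((g ∧ not u) ∨ v) ∧ not v) ∨ u
  bool true  u     true  hu hv = contradiction (hv refl) λ ()
  bool true  true  false hu hv = refl
  bool true  false false hu hv = refl
  bool false true  v     hu hv = contradiction (hu refl) λ ()
  bool false false true  hu hv = refl
  bool false false false hu hv = refl

D-adj⇔ : ∀ {N} (i j : Fin N) → adj (D N) i j ≡ true ⇔
  ((suc (toℕ i) ≡ toℕ j ⊎ (toℕ i ≡ 0 × toℕ j ≡ 2)) ⊎ (suc (toℕ j) ≡ toℕ i ⊎ (toℕ j ≡ 0 × toℕ i ≡ 2)))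
D-adj⇔ {N} i j = mk⇔
  (λ e → [ inj₁ ∘ arc⇒ (toℕ i) (toℕ j) , inj₂ ∘ arc⇒ (toℕ j) (toℕ i) ]′ (∨-true (proj₂ (∧-true {not (does (i ≟ j))} e))))
  (λ h → cong₂ _∧_ (cong not (dec-false (i ≟ j) (distinct h)))
    ([ ∨-introˡ ∘ ⇒arc (toℕ i) (toℕ j) , ∨-introʳ {E (toℕ i) (toℕ j)} ∘ ⇒arc (toℕ j) (toℕ i) ]′ h))
  where
  E : ℕ → ℕ → Bool
  E i j = ((i ≡ᵇ 0) ∧ ((j ≡ᵇ 1) ∨ (j ≡ᵇ 2))) ∨ ((1 ≤ᵇ i) ∧ (suc i ≡ᵇ j))
  Arc : ℕ → ℕ → Set
  Arc i j = suc i ≡ j ⊎ (i ≡ 0 × j ≡ 2)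
  arc⇒ : ∀ i j → E i j ≡ true → Arc i j
  arc⇒ zero (suc zero) e = inj₁ refl
  arc⇒ zero (suc (suc zero)) e = inj₂ (refl , refl)
  arc⇒ (suc i) j e = inj₁ (≡ᵇ-true e)
  ⇒arc : ∀ i j → Arc i j → E i j ≡ true
  ⇒arc zero    .1 (inj₁ refl) = refl
  ⇒arc (suc i) .(suc (suc i)) (inj₁ refl) = ≡ᵇ-refl i
  ⇒arc .0 .2 (inj₂ (refl , refl)) = refl
  distinct : Arc (toℕ i) (toℕ j) ⊎ Arc (toℕ j) (toℕ i) → i ≢ j
  distinct (inj₁ (inj₁ e)) refl = 1+n≢n e
  distinct (inj₂ (inj₁ e)) refl = 1+n≢n e
  distinct (inj₁ (inj₂ (e , f))) refl = contradiction (trans (sym e) f) λ ()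
  distinct (inj₂ (inj₂ (e , f))) refl = contradiction (trans (sym e) f) λ ()

-- Replacing the closing edge of the cycle by the chord from 0 to 2 leaves the path 0, 1, ..., N - 1
-- with a triangle on its first three vertices: this is `D N` in its own labelling.
D-from-C : ∀ {N} → 3 ≤ N → {i₀ i₂ iₗ : Fin N} → toℕ i₀ ≡ 0 → toℕ i₂ ≡ 2 → suc (toℕ iₗ) ≡ N → ∀ i j →
  adj (D N) i j ≡ (adj (C N) i j ∧ not (pair i₀ iₗ i j)) ∨ pair i₀ i₂ i j
D-from-C {N} 3≤N {i₀} {i₂} {iₗ} e₀ e₂ eₗ i j = ⇔→≡ (mk⇔
  (λ e → [ forth i j , (λ h → trans (symmetric i j) (forth j i h)) ]′ (Equivalence.to (D-adj⇔ i j) e))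
  (λ e → Equivalence.from (D-adj⇔ i j) (back e)))
  where
  R : Relation N
  R i j = (adj (C N) i j ∧ not (pair i₀ iₗ i j)) ∨ pair i₀ i₂ i j
  symmetric : ∀ i j → R i j ≡ R j i
  symmetric i j = cong₂ _∨_ (cong₂ (λ u v → u ∧ not v) (adj-sym (C N) i j) (pair-sym i₀ iₗ i j)) (pair-sym i₀ i₂ i j)
  back : R i j ≡ true → (suc (toℕ i) ≡ toℕ j ⊎ (toℕ i ≡ 0 × toℕ j ≡ 2)) ⊎ (suc (toℕ j) ≡ toℕ i ⊎ (toℕ j ≡ 0 × toℕ i ≡ 2))
  back e with ∨-true {adj (C N) i j ∧ not (pair i₀ iₗ i j)} e
  ... | inj₂ h with pair⇒ {x = i₀} {i₂} h
  ...   | inj₁ (refl , refl) = inj₁ (inj₂ (e₀ , e₂))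
  ...   | inj₂ (refl , refl) = inj₂ (inj₂ (e₀ , e₂))
  back e | inj₁ h with C-adj⇒ i j (proj₁ (∧-true h)) | not-true (proj₂ (∧-true {adj (C N) i j} h))
  ... | inj₁ (inj₁ f)       | _ = inj₁ (inj₁ f)
  ... | inj₂ (inj₁ f)       | _ = inj₂ (inj₁ f)
  ... | inj₁ (inj₂ (f , g)) | absent = contradiction absent (true≢false (trans (pair-sym i₀ iₗ i j)
    (subst₂ (λ u v → pair i₀ iₗ u v ≡ true) (toℕ-injective (trans e₀ (sym g))) (toℕ-injective (suc-injective (trans eₗ (sym f)))) (⇒pair i₀ iₗ))))
  ... | inj₂ (inj₂ (f , g)) | absent = contradiction absent (true≢false
    (subst₂ (λ u v → pair i₀ iₗ u v ≡ true) (toℕ-injective (trans e₀ (sym g))) (toℕ-injective (suc-injective (trans eₗ (sym f)))) (⇒pair i₀ iₗ)))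
  forth : ∀ i j → suc (toℕ i) ≡ toℕ j ⊎ (toℕ i ≡ 0 × toℕ j ≡ 2) → R i j ≡ true
  forth i j (inj₁ f) = ∨-introˡ (cong₂ _∧_ (⇒C-adj i j (Next-≢ (≤-trans (n≤1+n 2) 3≤N) {i} {j} (inj₁ f)) (inj₁ f))
    (cong not (¬true (λ h → [ wrap , beyond ]′ (pair⇒ {x = i₀} {iₗ} h)))))
    where
    wrap : ¬ (i₀ ≡ i × iₗ ≡ j)
    wrap (refl , refl) = <⇒≢ 3≤N (trans (cong suc (trans (cong suc (sym e₀)) f)) eₗ)
    beyond : ¬ (iₗ ≡ i × i₀ ≡ j)
    beyond (refl , refl) = contradiction (trans f e₀) λ ()
  forth i j (inj₂ (f , g)) = ∨-introʳ {adj (C N) i j ∧ not (pair i₀ iₗ i j)}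
    (subst₂ (λ u v → pair i₀ i₂ u v ≡ true) (toℕ-injective (trans e₀ (sym f))) (toℕ-injective (trans e₂ (sym g))) (⇒pair i₀ i₂))

lookup-injective : ∀ {A : Set} {xs : List A} → Unique xs → ∀ i j → lookupₗ xs i ≡ lookupₗ xs j → i ≡ j
lookup-injective (_  ∷ _) zero    zero    e = refl
lookup-injective (x∉ ∷ _) zero    (suc j) e = contradiction e (All.lookup x∉ (∈-lookup j))
lookup-injective (x∉ ∷ _) (suc i) zero    e = contradiction (sym e) (All.lookup x∉ (∈-lookup i))
lookup-injective (_  ∷ u) (suc i) (suc j) e = cong suc (lookup-injective u i j e)

≅-sym : ∀ {m k} {G : Graph m} {H : Graph k} → G ≅ H → H ≅ G
≅-sym {H = H} iso = record
  { bij      = mk↔ₛ′ (Inverse.from bij) (Inverse.to bij) (λ _ → Inverse.inverseʳ bij refl) (λ _ → Inverse.inverseˡ bij refl)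
  ; preserve = λ i j → trans (sym (preserve (Inverse.from bij i) (Inverse.from bij j)))
      (cong₂ (adj H) (Inverse.inverseˡ bij refl) (Inverse.inverseˡ bij refl))
  }
  where open _≅_ iso

-- Graphs with the invariants of an even cycle

Maximum : ∀ {N} → Graph N → ℕ → (Fin N → Bool) → Set
Maximum G n S = Independent (adj G) S × card S ≡ n

-- What is used of a graph with the independence polynomial of C₂ₙ.
record CycleLike {N : ℕ} (G : Graph N) (n : ℕ) : Set where
  field
    order    : N ≡ n + n
    2≤n      : 2 ≤ n
    size     : sum (deg G) ≡ 4 * n
    excesses : 3 * sum (λ v → excess (deg G v)) ≡ triangles G
    above    : ∀ S → Independent (adj G) S → card S ≢ suc n
    two      : ∀ P Q S → Maximum G n P → Maximum G n Q → Maximum G n S → ¬ (∀ i → P i ≡ Q i) →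
               (∀ i → S i ≡ P i) ⊎ (∀ i → S i ≡ Q i)

infixl 6 _△_
_△_ : ∀ {n} → (Fin n → Bool) → (Fin n → Bool) → (Fin n → Bool)
(S △ U) i = if U i then not (S i) else S i

△-inside : ∀ {n} (S U : Fin n → Bool) {i} → U i ≡ true → (S △ U) i ≡ not (S i)
△-inside S U {i} e = cong (λ b → if b then not (S i) else S i) e

△-outside : ∀ {n} (S U : Fin n → Bool) {i} → U i ≡ false → (S △ U) i ≡ S i
△-outside S U {i} e = cong (λ b → if b then not (S i) else S i) e

module Structure {N : ℕ} (G : Graph N) (n : ℕ) (cycleLike : CycleLike G n) where
  open CycleLike cycleLike
  open Degrees G

  flip : ∀ {i j} → adj G i j ≡ true → adj G j i ≡ true
  flip {i} {j} a = trans (adj-sym G j i) a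

  loopless : ∀ {i j} → adj G i j ≡ true → i ≢ j
  loopless {i} a refl = true≢false a (adj-irrefl G i)

  edge⇒∉ : ∀ {S} → Independent (adj G) S → ∀ {i j} → adj G i j ≡ true → S i ≡ true → S j ≡ false
  edge⇒∉ I {i} {j} a Si = ¬true (λ Sj → true≢false a (I i j Si Sj))

  card-∁-Maximum : ∀ {A} → Maximum G n A → card (∁ A) ≡ n
  card-∁-Maximum {A} (_ , c) = +-cancelˡ-≡ (card A) _ _ (trans (card-∁ A) (trans order (cong (_+ n) (sym c))))

  -- U is a union of components on which the graph is 2-regular and bipartite, with A and its
  -- complement as the sides.
  Switchable : (Fin N → Bool) → (Fin N → Bool) → Set
  Switchable A U = (∀ i j → adj G i j ≡ true → U i ≡ true → U j ≡ true × A i ≢ A j) × (∀ i → U i ≡ true → deg G i ≡ 2)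

  -- Every vertex of U has two neighbours, all in U and on the other side of A, so the two sides of
  -- U are equally large by `balanced-card`. `sizes` carries one side along in place of a
  -- subtraction.
  switch : ∀ A U → Maximum G n A → Switchable A U → Maximum G n (A △ U)
  switch A U (I , c) (closed , regular) = I△ , trans (+-cancelʳ-≡ (card A∩U) _ _ sizes) c
    where
    A∩U ∁A∩U : Fin N → Bool
    A∩U i = A i ∧ U i
    ∁A∩U i = not (A i) ∧ U i
    I△ : Independent (adj G) (A △ U)
    I△ i j Si Sj with U i in Ui | U j in Uj
    ... | false | false = I i j Si Sj
    ... | true  | false = ¬true (λ a → true≢false (proj₁ (closed i j a Ui)) Uj)
    ... | false | true  = ¬true (λ a → true≢false (proj₁ (closed j i (flip a) Uj)) Ui)
    ... | true  | true  = ¬true (λ a → proj₂ (closed i j a Ui) (trans (not-true Si) (sym (not-true Sj))))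
    inside : ∀ {x y} → x ≢ y → not x ≡ y
    inside {true}  {true}  p = contradiction refl p
    inside {true}  {false} p = refl
    inside {false} {true}  p = refl
    inside {false} {false} p = contradiction refl p
    balance : card A∩U ≡ card ∁A∩U
    balance = balanced-card A∩U ∁A∩U
      (λ v e → trans (degIn≡deg ∁A∩U v (λ u a → let (Uu , p) = closed v u a (proj₂ (∧-true e)) in
          cong₂ _∧_ (trans (inside (λ q → p (sym q))) (proj₁ (∧-true e))) Uu)) (regular v (proj₂ (∧-true e))))
      (λ v e → trans (degIn≡deg A∩U v (λ u a → let (Uu , p) = closed v u a (proj₂ (∧-true e)) in
          cong₂ _∧_ (trans (sym (inside p)) (proj₁ (∧-true e))) Uu)) (regular v (proj₂ (∧-true e))))
    pointwise : ∀ x u → ⟦ if u then not x else x ⟧ + ⟦ x ∧ u ⟧ ≡ ⟦ x ⟧ + ⟦ not x ∧ u ⟧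
    pointwise true  true  = refl
    pointwise true  false = refl
    pointwise false true  = refl
    pointwise false false = refl
    sizes : card (A △ U) + card A∩U ≡ card A + card A∩U
    sizes = begin
      card (A △ U) + card A∩U                    ≡⟨ sym (∑-distrib-+ (λ i → ⟦ (A △ U) i ⟧) (λ i → ⟦ A∩U i ⟧)) ⟩
      sum (λ i → ⟦ (A △ U) i ⟧ + ⟦ A∩U i ⟧)      ≡⟨ sum-cong-≗ (λ i → pointwise (A i) (U i)) ⟩
      sum (λ i → ⟦ A i ⟧ + ⟦ ∁A∩U i ⟧)           ≡⟨ ∑-distrib-+ (λ i → ⟦ A i ⟧) (λ i → ⟦ ∁A∩U i ⟧) ⟩
      card A + card ∁A∩U                         ≡⟨ cong (card A +_) (sym balance) ⟩
      card A + card A∩U                          ∎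
      where open ≡-Reasoning

  -- Otherwise A △ U would be a third maximum independent set.
  switchable-empty : ∀ A Q U → Maximum G n A → Maximum G n Q → ∀ a → A a ≡ true → Q a ≡ false → U a ≡ false →
    Switchable A U → ∀ i → U i ≡ false
  switchable-empty A Q U MA MQ a Aa Qa Ua s i with two A Q (A △ U) MA MQ (switch A U MA s) (λ h → true≢false (trans (sym (h a)) Aa) Qa)
  ... | inj₂ h = contradiction (trans (sym (h a)) (trans (△-outside A U Ua) Aa)) (λ e → true≢false e Qa)
  ... | inj₁ h = ¬true (λ Ui → not≢ (A i) (trans (sym (△-inside A U Ui)) (h i)))
    where
    not≢ : ∀ b → not b ≢ b
    not≢ true ()
    not≢ false ()

  no-triangles⇒2-regular : triangles G ≡ 0 → ∀ v → deg G v ≡ 2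
  no-triangles⇒2-regular e v = excess≡0 _ (sum≡0⇒≡0 (m+n≡0⇒m≡0 _ (trans excesses e)) v)

  has-element : ∀ {A} → Maximum G n A → ∃[ v ] A v ≡ true
  has-element {A} (_ , c) = card>0 A (subst (0 <_) (sym c) (≤-trans (s≤s z≤n) 2≤n))

  3≤N : 3 ≤ N
  3≤N = subst (3 ≤_) (sym order) (≤-trans (n≤1+n 3) (+-mono-≤ 2≤n 2≤n))

  cycle : ∀ A → Maximum G n A → (∀ v → A v ≡ false → 2 ≤ degIn G A v) → G ≅ C N
  cycle A MA@(I , c) dense = ≅-sym (record { bij = bijection ; preserve = φ-preserves })
    where
    e = sumOver (∁ A) (degIn G A)
    r = sumOver (∁ A) (degIn G (∁ A))
    2n≤e : n * 2 ≤ e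
    2n≤e = subst (_≤ e) (trans (sumOver-const (∁ A) 2) (cong (_* 2) (card-∁-Maximum MA)))
      (sumOver-mono (∁ A) (λ v h → dense v (∈∁⇒ A h)))
    r≡0 : r ≡ 0
    r≡0 = n≤0⇒n≡0 (+-cancelˡ-≤ (2 * (n * 2)) r 0 (begin
      2 * (n * 2) + r   ≤⟨ +-monoˡ-≤ r (*-monoʳ-≤ 2 2n≤e) ⟩
      2 * e + r         ≡⟨ trans (sym (edge-count A I)) size ⟩
      4 * n             ≡⟨ solve 1 (λ n → con 4 :* n := con 2 :* (n :* con 2) :+ con 0) refl n ⟩
      2 * (n * 2) + 0   ∎))
      where open ≤-Reasoning
    ∁-edge : ∀ i j → A i ≡ false → adj G i j ≡ true → A j ≡ true
    ∁-edge i j Ai a = trans (sym (not-involutive (A j))) (cong not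
      (degIn≡0⇒ (∁ A) i (sumOver≡0⇒ (∁ A) (degIn G (∁ A)) r≡0 i (∈∁ A Ai)) j a))
    bipartite : ∀ i j → adj G i j ≡ true → A i ≢ A j
    bipartite i j a p with A i in Ai
    ... | true  = true≢false (sym p) (edge⇒∉ I a Ai)
    ... | false = true≢false (∁-edge i j Ai a) (sym p)
    regular : ∀ v → deg G v ≡ 2
    regular = no-triangles⇒2-regular (bipartite⇒no-triangles G A bipartite)
    M∁ : Maximum G n (∁ A)
    M∁ = (λ i j Ai Aj → ¬true (λ a → true≢false (∁-edge i j (∈∁⇒ A Ai) a) (∈∁⇒ A Aj))) , card-∁-Maximum MA
    v₀ = proj₁ (has-element MA)
    Av₀ = proj₂ (has-element MA)
    v₀-edge = card>0 (adj G v₀) (subst (0 <_) (sym (regular v₀)) z<s)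
    open Walk G regular 3≤N (proj₂ v₀-edge) (λ U closed Uv₀ →
      switchable-empty A (∁ A) U MA M∁ v₀ Av₀ (cong not Av₀) Uv₀
        ((λ i j a Ui → closed i j a Ui , bipartite i j a) , (λ i _ → regular i)))

  -- With no neighbour in P, w could be added, against `above`; a single neighbour x can be traded
  -- for w.
  swap : ∀ P w → Maximum G n P → P w ≡ false → degIn G P w < 2 →
    ∃[ x ] P x ≡ true × adj G w x ≡ true × degIn G P w ≡ 1 × Maximum G n (P − x ⊕ w)
  swap P w (I , c) Pw small with degIn G P w in d
  ... | zero = contradiction (trans (card-⊕ P Pw) (cong suc c)) (above (P ⊕ w) I⊕)
    where
    I⊕ : Independent (adj G) (P ⊕ w)
    I⊕ i j Si Sj with ∈⊕ P {w} Si | ∈⊕ P {w} Sj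
    ... | inj₁ refl | inj₁ refl = adj-irrefl G i
    ... | inj₁ refl | inj₂ Pj   = ¬true (λ e → true≢false Pj (degIn≡0⇒ P i d j e))
    ... | inj₂ Pi   | inj₁ refl = ¬true (λ e → true≢false Pi (degIn≡0⇒ P j d i (flip e)))
    ... | inj₂ Pi   | inj₂ Pj   = I i j Pi Pj
  ... | suc (suc _) = contradiction small λ { (s≤s (s≤s ())) }
  ... | suc zero with card≡1 (λ u → P u ∧ adj G w u) d
  ...   | x , e , only = x , Px , proj₂ (∧-true e) , refl , I⊕ ,
          trans (card-⊕ (P − x) (trans (−-other P x≢w) Pw)) (trans (sym (card-− P Px)) c)
    where
    Px = proj₁ (∧-true e)
    x≢w : x ≢ w
    x≢w refl = true≢false Px Pw
    far : ∀ {i} → (P − x) i ≡ true → adj G w i ≡ false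
    far {i} Pi = ¬true (λ e′ → proj₁ (∈− P {x} Pi) (only i (cong₂ _∧_ (proj₂ (∈− P {x} Pi)) e′)))
    I⊕ : Independent (adj G) (P − x ⊕ w)
    I⊕ i j Si Sj with ∈⊕ (P − x) {w} Si | ∈⊕ (P − x) {w} Sj
    ... | inj₁ refl | inj₁ refl = adj-irrefl G i
    ... | inj₁ refl | inj₂ Pj   = far Pj
    ... | inj₂ Pi   | inj₁ refl = trans (adj-sym G i j) (far Pi)
    ... | inj₂ Pi   | inj₂ Pj   = I i j (proj₂ (∈− P {x} Pi)) (proj₂ (∈− P {x} Pj))

  avoided⇒2≤degIn : ∀ P w → Maximum G n P → (∀ S → Maximum G n S → S w ≡ false) → 2 ≤ degIn G P w
  avoided⇒2≤degIn P w MP avoided with degIn G P w <? 2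
  ... | no h  = ≮⇒≥ h
  ... | yes h with swap P w MP (avoided P MP) h
  ...   | x , _ , _ , _ , MS = contradiction (avoided _ MS) (true≢false (⊕-∈ (P − x) w))

-- The maximum independent sets are A and (A − a) ⊕ b for an edge ab; W is what they both avoid.
module Exchange {N : ℕ} (G : Graph N) (n : ℕ) (cycleLike : CycleLike G n)
  (A : Fin N → Bool) (MA : Maximum G n A) {a b : Fin N} (Aa : A a ≡ true) (Ab : A b ≡ false)
  (ba : adj G b a ≡ true) (degb : degIn G A b ≡ 1) (MA₂ : Maximum G n (A − a ⊕ b))
  where
  open CycleLike cycleLike
  open Degrees G
  open Structure G n cycleLike

  A₂ W : Fin N → Bool
  A₂ = A − a ⊕ b
  W = ∁ A − b

  a≢b : a ≢ b
  a≢b refl = true≢false Aa Ab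

  A₂a : A₂ a ≡ false
  A₂a = trans (⊕-other (A − a) (a≢b ∘ sym)) (−-∉ A a)

  W⇒∉A : ∀ {v} → W v ≡ true → A v ≡ false
  W⇒∉A e = ∈∁⇒ A (proj₂ (∈− (∁ A) {b} e))

  W⇒≢b : ∀ {v} → W v ≡ true → b ≢ v
  W⇒≢b e = proj₁ (∈− (∁ A) {b} e)

  W⇒≢a : ∀ {v} → W v ≡ true → a ≢ v
  W⇒≢a e refl = true≢false Aa (W⇒∉A e)

  ⇒W : ∀ {v} → A v ≡ false → b ≢ v → W v ≡ true
  ⇒W e q = trans (−-other (∁ A) q) (∈∁ A e)

  data Place (v : Fin N) : Set where
    inA : A v ≡ true → Place v
    isb : b ≡ v → Place v
    inW : W v ≡ true → Place v

  place : ∀ v → Place v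
  place v with A v in Av | b ≟ v
  ... | true  | _     = inA Av
  ... | false | yes p = isb p
  ... | false | no q  = inW (⇒W Av q)

  b-only : ∀ {u} → A u ≡ true → adj G b u ≡ true → a ≡ u
  b-only {u} Au e with card≡1 (λ u → A u ∧ adj G b u) degb
  ... | x , _ , only = trans (sym (only a (cong₂ _∧_ Aa ba))) (only u (cong₂ _∧_ Au e))

  a-neighbours : ∀ {u} → adj G a u ≡ true → b ≡ u ⊎ W u ≡ true
  a-neighbours {u} e with place u
  ... | inA Au = contradiction (edge⇒∉ (proj₁ MA) e Aa) (true≢false Au)
  ... | isb p  = inj₁ p
  ... | inW Wu = inj₂ Wu

  b-neighbours : ∀ {u} → adj G b u ≡ true → a ≡ u ⊎ W u ≡ true
  b-neighbours {u} e with place u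
  ... | inA Au = inj₁ (b-only Au e)
  ... | isb p  = contradiction p (loopless e)
  ... | inW Wu = inj₂ Wu

  A-neighbours : ∀ {v u} → A v ≡ true → a ≢ v → adj G v u ≡ true → W u ≡ true
  A-neighbours {v} {u} Av a≢v e with place u
  ... | inA Au   = contradiction (edge⇒∉ (proj₁ MA) e Av) (true≢false Au)
  ... | isb refl = contradiction (b-only Av (flip e)) a≢v
  ... | inW Wu   = Wu

  avoided : ∀ {v} → W v ≡ true → ∀ S → Maximum G n S → S v ≡ false
  avoided {v} Wv S MS with two A A₂ S MA MA₂ MS (λ h → true≢false (trans (sym (h a)) Aa) A₂a)
  ... | inj₁ h = trans (h v) (W⇒∉A Wv)
  ... | inj₂ h = trans (h v) (trans (⊕-other (A − a) (W⇒≢b Wv)) (trans (−-other A (W⇒≢a Wv)) (W⇒∉A Wv)))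

  card-W : suc (card W) ≡ n
  card-W = trans (sym (card-− (∁ A) (∈∁ A Ab))) (card-∁-Maximum MA)

  -- For v in W the neighbours are sorted into a, b, the rest of A, and W. Thus `s` counts the
  -- neighbours outside W, and `t` is its surplus over the minimum 2 given by `2≤s`.
  p q x y s t : Fin N → ℕ
  p v = ⟦ adj G v a ⟧
  q v = ⟦ adj G v b ⟧
  x v = degIn G (A − a) v
  y v = degIn G W v
  s v = p v + (q v + x v)
  t v = s v ∸ 2

  p+x : ∀ v → degIn G A v ≡ p v + x v
  p+x = degIn-− A Aa

  q+y : ∀ v → degIn G (∁ A) v ≡ q v + y v
  q+y = degIn-− (∁ A) (∈∁ A Ab)

  2≤p+x : ∀ {v} → W v ≡ true → 2 ≤ p v + x v
  2≤p+x {v} Wv = subst (2 ≤_) (p+x v) (avoided⇒2≤degIn A v MA (avoided Wv))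

  -- The same bound for the other maximum set, in which b takes the place of a.
  2≤q+x : ∀ {v} → W v ≡ true → 2 ≤ q v + x v
  2≤q+x {v} Wv = subst (2 ≤_) (degIn-⊕ (A − a) (trans (−-other A a≢b) Ab) v) (avoided⇒2≤degIn A₂ v MA₂ (avoided Wv))

  2≤s : ∀ {v} → W v ≡ true → 2 ≤ s v
  2≤s {v} Wv = ≤-trans (2≤q+x Wv) (m≤n+m _ (p v))

  deg-W : ∀ v → deg G v ≡ s v + y v
  deg-W v = trans (deg-partition A v) (trans (cong₂ _+_ (p+x v) (q+y v))
    (solve 4 (λ p x q y → p :+ x :+ (q :+ y) := p :+ (q :+ x) :+ y) refl (p v) (x v) (q v) (y v)))

  -- Since s ≥ 2 on W, the edge count leaves room for one vertex with s = 3 or for one edge inside W.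
  budget : 2 * sumOver W t + sumOver W y ≡ 2
  budget = +-cancelʳ-≡ (2 * (card W * 2) + 2) _ _ (begin
    2 * sumOver W t + sumOver W y + (2 * (card W * 2) + 2)
      ≡⟨ solve 3 (λ t y w → con 2 :* t :+ y :+ (con 2 :* w :+ con 2) := con 2 :+ (con 2 :* (t :+ w) :+ y)) refl (sumOver W t) (sumOver W y) (card W * 2) ⟩
    2 + (2 * (sumOver W t + card W * 2) + sumOver W y)
      ≡⟨ cong (λ z → 2 + (2 * z + sumOver W y)) (trans (cong (sumOver W t +_) (sym (sumOver-const W 2)))
           (trans (sym (sumOver-+ W t (λ _ → 2))) (sumOver-cong W (λ v Wv → m∸n+n≡m (2≤s Wv))))) ⟩
    2 + (2 * sumOver W s + sumOver W y)
      ≡⟨ cong (λ z → 2 + (2 * z + sumOver W y)) (trans (sumOver-cong W (λ v _ → solve 3 (λ p q x → p :+ (q :+ x) := (p :+ x) :+ q) refl (p v) (q v) (x v)))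
           (sumOver-+ W (λ v → p v + x v) q)) ⟩
    2 + (2 * (sumOver W (λ v → p v + x v) + sumOver W q) + sumOver W y)
      ≡⟨ solve 3 (λ e q y → con 2 :+ (con 2 :* (e :+ q) :+ y) := con 2 :* (con 1 :+ e) :+ (q :+ (q :+ y))) refl (sumOver W (λ v → p v + x v)) (sumOver W q) (sumOver W y) ⟩
    2 * (1 + sumOver W (λ v → p v + x v)) + (sumOver W q + (sumOver W q + sumOver W y))
      ≡⟨ cong₂ (λ u v → 2 * u + v) (sym inner) (sym outer) ⟩
    2 * sumOver (∁ A) (degIn G A) + sumOver (∁ A) (degIn G (∁ A))
      ≡⟨ trans (sym (edge-count A (proj₁ MA))) size ⟩
    4 * n
      ≡⟨ cong (4 *_) (sym card-W) ⟩
    4 * suc (card W)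
      ≡⟨ solve 1 (λ w → con 4 :* (con 1 :+ w) := con 2 :+ (con 2 :* (w :* con 2) :+ con 2)) refl (card W) ⟩
    2 + (2 * (card W * 2) + 2) ∎)
    where
    open ≡-Reasoning
    inner : sumOver (∁ A) (degIn G A) ≡ 1 + sumOver W (λ v → p v + x v)
    inner = trans (sumOver-− (∁ A) (degIn G A) (∈∁ A Ab)) (cong₂ _+_ degb (sumOver-cong W (λ v _ → p+x v)))
    b-degree : degIn G (∁ A) b ≡ sumOver W q
    b-degree = trans (q+y b) (trans (cong (λ z → ⟦ z ⟧ + y b) (adj-irrefl G b))
      (trans (degIn-sumOver W b) (sumOver-cong W (λ v _ → cong ⟦_⟧ (adj-sym G b v)))))
    outer : sumOver (∁ A) (degIn G (∁ A)) ≡ sumOver W q + (sumOver W q + sumOver W y)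
    outer = trans (sumOver-− (∁ A) (degIn G (∁ A)) (∈∁ A Ab))
      (cong₂ _+_ b-degree (trans (sumOver-cong W (λ v _ → q+y v)) (sumOver-+ W q y)))

  excess-total : ∀ k → triangles G ≤ 6 * k → sum (λ v → excess (deg G v)) ≤ 2 * k
  excess-total k le = *-cancelˡ-≤ 3 (subst₂ _≤_ (sym excesses) (solve 1 (λ k → con 6 :* k := con 3 :* (con 2 :* k)) refl k) le)

  -- With s = 2 the bound q + x ≥ 2 leaves no room for p; then p + x ≥ 2 forces x ≥ 2, which leaves
  -- no room for q.
  tight : ∀ {v} → W v ≡ true → t v ≡ 0 → p v ≡ 0 × q v ≡ 0 × x v ≡ 2
  tight {v} Wv tv≡0 = p≡0 , q≡0 , trans (cong (_+ x v) (sym q≡0)) q+x≡2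
    where
    s≡2 : s v ≡ 2
    s≡2 = trans (sym (m∸n+n≡m (2≤s Wv))) (cong (_+ 2) tv≡0)
    p≡0 : p v ≡ 0
    p≡0 = n≤0⇒n≡0 (+-cancelʳ-≤ (q v + x v) (p v) 0 (subst (_≤ q v + x v) (sym s≡2) (2≤q+x Wv)))
    2≤x : 2 ≤ x v
    2≤x = subst (λ u → 2 ≤ u + x v) p≡0 (2≤p+x Wv)
    q+x≡2 : q v + x v ≡ 2
    q+x≡2 = trans (cong (_+ (q v + x v)) (sym p≡0)) s≡2
    q≡0 : q v ≡ 0
    q≡0 = n≤0⇒n≡0 (+-cancelʳ-≤ (x v) (q v) 0 (subst (_≤ x v) (sym q+x≡2) 2≤x))

  -- The case where W is independent: a triangle with a pendant path

  module Pendant (Σt : sumOver W t ≡ 1) where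

    Σy : sumOver W y ≡ 0
    Σy = +-cancelˡ-≡ 2 _ _ (trans (cong (λ z → 2 * z + sumOver W y) (sym Σt)) budget)

    W-independent : Independent (adj G) W
    W-independent i j Wi Wj = ¬true (λ e → true≢false Wj (degIn≡0⇒ W i (sumOver≡0⇒ W y Σy i Wi) j e))

    single-independent : Independent (adj G) (λ v → does (b ≟ v))
    single-independent i j e f = trans (cong₂ (adj G) (sym (does-≟⇒≡ {x = b} e)) (sym (does-≟⇒≡ {x = b} f))) (adj-irrefl G b)

    -- A triangle has one vertex in A, the vertex b and one vertex in W; the first of these is then a.
    triangles-via-b : (F : Fin N → Fin N → Fin N → ℕ) →
      (∀ k → W k ≡ true → adj G k a ≡ true → adj G k b ≡ true → 1 ≤ F a b k) → triangles G ≤ 6 * sum₃ F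
    triangles-via-b F h = triangles≤-tripartite A (λ v → does (b ≟ v)) W
      (λ v Av bv → cong₂ _∧_ (cong not bv) (cong not Av)) (proj₁ MA) single-independent W-independent F at
      where
      at : ∀ i j k → A i ≡ true → does (b ≟ j) ≡ true → W k ≡ true →
        adj G i j ≡ true → adj G i k ≡ true → adj G j k ≡ true → 1 ≤ F i j k
      at i j k Ai bj Wk ij ik jk with does-≟⇒≡ {x = b} bj
      ... | refl with b-only Ai (flip ij)
      ...   | refl = h k Wk (flip ik) (flip jk)

    Apex : Set
    Apex = ∃[ c ] W c ≡ true × adj G c a ≡ true × adj G c b ≡ true

    no-apex⇒no-triangles : ¬ Apex → triangles G ≡ 0
    no-apex⇒no-triangles none = n≤0⇒n≡0 (≤-trans
      (triangles-via-b (λ _ _ _ → 0) (λ k Wk ka kb → contradiction (k , Wk , ka , kb) none))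
      (≤-reflexive (cong (6 *_) zero₃)))
      where
      zero₃ : sum₃ {N} (λ _ _ _ → 0) ≡ 0
      zero₃ = trans (sum₃-product {N} (λ _ → 0) (λ _ → 0) (λ _ → 0)) (cong (_* (sum {N} (λ _ → 0) * sum {N} (λ _ → 0))) (sum-replicate-zero N))

    -- As a lies outside `A₂`, an edge to a comes on top of the two edges that v sends into `A₂`.
    1≤t-p : ∀ {v} → W v ≡ true → adj G v a ≡ true → 1 ≤ t v
    1≤t-p {v} Wv e = ∸-monoˡ-≤ {3} {s v} 2 (+-mono-≤ {1} {p v} {2} (≤-reflexive (sym (cong ⟦_⟧ e))) (2≤q+x Wv))

    1≤t-q : ∀ {v} → W v ≡ true → adj G v b ≡ true → 1 ≤ t v
    1≤t-q {v} Wv e = ∸-monoˡ-≤ {3} {s v} 2 (begin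
      1 + 2                  ≤⟨ +-mono-≤ (≤-reflexive (sym (cong ⟦_⟧ e))) (2≤p+x Wv) ⟩
      q v + (p v + x v)      ≡⟨ solve 3 (λ q p x → q :+ (p :+ x) := p :+ (q :+ x)) refl (q v) (p v) (x v) ⟩
      p v + (q v + x v)      ∎)
      where open ≤-Reasoning

    -- If all degrees are 2, both a and b have a second neighbour, which lies in W. Without a common
    -- one these are two vertices, each with positive t.
    no-apex⇒2≤t : ¬ Apex → (∀ v → deg G v ≡ 2) → 2 ≤ sumOver W t
    no-apex⇒2≤t none regular with card≡2 (adj G a) (flip ba) (regular a) | card≡2 (adj G b) ba (regular b)
    ... | u , b≢u , au , _ | u′ , a≢u′ , bu′ , _ with a-neighbours au | b-neighbours bu′
    ...   | inj₁ e | _ = contradiction e b≢u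
    ...   | _ | inj₁ e = contradiction e a≢u′
    ...   | inj₂ Wu | inj₂ Wu′ = ≤-trans (+-mono-≤ (1≤t-p Wu (flip au)) (1≤t-q Wu′ (flip bu′)))
              (sumOver-term₂ W t Wu Wu′ (λ { refl → none (u , Wu , flip au , flip bu′) }))

    abstract
      -- Otherwise the graph has no triangles and is 2-regular, so W would have surplus 2 where `Σt`
      -- allows 1.
      apex : Apex
      apex with any? (λ v → (W v Bool.≟ true) ×-dec ((adj G v a Bool.≟ true) ×-dec (adj G v b Bool.≟ true)))
      ... | yes found = found
      ... | no none = contradiction (subst (2 ≤_) Σt (no-apex⇒2≤t none (no-triangles⇒2-regular (no-apex⇒no-triangles none)))) 1+n≰n

    c : Fin N
    c = proj₁ apex

    Wc : W c ≡ true
    Wc = proj₁ (proj₂ apex)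

    ca : adj G c a ≡ true
    ca = proj₁ (proj₂ (proj₂ apex))

    cb : adj G c b ≡ true
    cb = proj₂ (proj₂ (proj₂ apex))

    tc≡xc : t c ≡ x c
    tc≡xc = cong₂ (λ u v → ⟦ u ⟧ + (⟦ v ⟧ + x c) ∸ 2) ca cb

    xc≡1 : x c ≡ 1
    xc≡1 = ≤-antisym (subst₂ _≤_ tc≡xc Σt (sumOver-term W t Wc))
      (s≤s⁻¹ (subst (λ u → 2 ≤ ⟦ u ⟧ + x c) ca (2≤p+x Wc)))

    others : ∀ {v} → W v ≡ true → c ≢ v → p v ≡ 0 × q v ≡ 0 × x v ≡ 2
    others {v} Wv c≢v = tight Wv
      (n≤0⇒n≡0 (s≤s⁻¹ (subst₂ (λ u w → u + t v ≤ w) (trans tc≡xc xc≡1) Σt (sumOver-term₂ W t Wc Wv c≢v))))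

    excess≤2 : sum (λ v → excess (deg G v)) ≤ 2
    excess≤2 = excess-total 1 (≤-trans (triangles-via-b F (λ k Wk ka kb → at k Wk ka)) (≤-reflexive (cong (6 *_) total)))
      where
      -- The indicator of the triple (a, b, c); its total 1 stands for the one triangle.
      F : Fin N → Fin N → Fin N → ℕ
      F i j k = δ a i * (δ b j * δ c k)
      total : sum₃ F ≡ 1
      total = trans (sum₃-product (δ a) (δ b) (δ c)) (cong₂ _*_ (sum-δ₁ a) (cong₂ _*_ (sum-δ₁ b) (sum-δ₁ c)))
      at : ∀ k → W k ≡ true → adj G k a ≡ true → 1 ≤ F a b k
      at k Wk ka with c ≟ k
      ... | yes refl = ≤-reflexive (sym (cong₂ _*_ (δ-refl a) (cong (_* 1) (δ-refl b))))
      ... | no c≢k = contradiction (⟦⟧-injective (proj₁ (others Wk c≢k))) (true≢false ka)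

    deg-c : deg G c ≡ 3
    deg-c = trans (deg-W c) (trans (cong (s c +_) (sumOver≡0⇒ W y Σy c Wc)) (trans (+-identityʳ (s c))
      (cong₂ _+_ (cong ⟦_⟧ ca) (cong₂ _+_ (cong ⟦_⟧ cb) xc≡1))))

    -- Edges leaving A - a end in W. Seen from W, c sends one edge there and every other vertex two,
    -- which is one short of 2 per vertex since W and A - a have the same size. This deficit yields
    -- the end d of the pendant path.
    few-edges : sumOver (A − a) (deg G) < card (A − a) * 2
    few-edges = begin-strict
      sumOver (A − a) (deg G)             ≡⟨ sumOver-cong (A − a) (λ v h → sym (degIn≡deg W v (λ u e → A-neighbours (proj₂ (∈− A {a} h)) (proj₁ (∈− A {a} h)) e))) ⟩
      sumOver (A − a) (degIn G W)         ≡⟨ double-count (A − a) W ⟩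
      sumOver W x                         ≡⟨ sumOver-− W x Wc ⟩
      x c + sumOver (W − c) x             ≡⟨ cong₂ _+_ xc≡1 (sumOver-cong (W − c) (λ v h → proj₂ (proj₂ (others (proj₂ (∈− W {c} h)) (proj₁ (∈− W {c} h)))))) ⟩
      1 + sumOver (W − c) (λ _ → 2)       ≡⟨ cong suc (sumOver-const (W − c) 2) ⟩
      1 + card (W − c) * 2                <⟨ n<1+n _ ⟩
      suc (card (W − c)) * 2              ≡⟨ cong (_* 2) (trans (sym (card-− W Wc)) (suc-injective (trans card-W (trans (sym (proj₂ MA)) (card-− A Aa))))) ⟩
      card (A − a) * 2                    ∎
      where open ≤-Reasoning

    abstract
      low : ∃[ d ] (A − a) d ≡ true × deg G d < 2
      low with any? (λ v → ((A − a) v Bool.≟ true) ×-dec (deg G v <? 2))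
      ... | yes found = found
      ... | no none = contradiction few-edges (≤⇒≯ (subst (_≤ sumOver (A − a) (deg G)) (sumOver-const (A − a) 2)
        (sumOver-mono (A − a) (λ v h → ≮⇒≥ (λ lt → none (v , h , lt))))))

    d : Fin N
    d = proj₁ low

    Ad : A d ≡ true
    Ad = proj₂ (∈− A {a} (proj₁ (proj₂ low)))

    a≢d : a ≢ d
    a≢d = proj₁ (∈− A {a} (proj₁ (proj₂ low)))

    a≢c : a ≢ c
    a≢c = W⇒≢a Wc

    b≢c : b ≢ c
    b≢c = W⇒≢b Wc

    c≢d : c ≢ d
    c≢d e = true≢false Ad (W⇒∉A (subst (λ v → W v ≡ true) e Wc))

    b≢d : b ≢ d
    b≢d e = true≢false Ad (trans (cong A (sym e)) Ab)

    E : Fin N → ℕ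
    E v = excess (deg G v)

    -- Of the total 2, c takes 1 by its degree 3. The 1 that remains rules out degree 0 for d, whose
    -- excess would be 4, and is used up by its degree 1; all other vertices have degree 2.
    excess-rest : E c + (E d + sum (E ∖ c ∖ d)) ≤ 2
    excess-rest = subst (_≤ 2) (trans (sum-extract E c) (cong (E c +_) (trans (sum-extract (E ∖ c) d) (cong (_+ sum (E ∖ c ∖ d)) (∖-other E c≢d))))) excess≤2

    excess-rest′ : E d + sum (E ∖ c ∖ d) ≤ 1
    excess-rest′ = s≤s⁻¹ (subst (λ z → excess z + (E d + sum (E ∖ c ∖ d)) ≤ 2) deg-c excess-rest)

    deg-d : deg G d ≡ 1
    deg-d = at (deg G d) (proj₂ (proj₂ low)) (≤-trans (m≤m+n (E d) _) excess-rest′)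
      where
      at : ∀ k → k < 2 → excess k ≤ 1 → k ≡ 1
      at 0 _ (s≤s ())
      at 1 _ _ = refl
      at (suc (suc k)) (s≤s (s≤s ())) _

    deg-other : ∀ {v} → c ≢ v → d ≢ v → deg G v ≡ 2
    deg-other {v} c≢v d≢v = excess≡0 _ (trans (sym (trans (∖-other (E ∖ c) d≢v) (∖-other E c≢v))) (sum≡0⇒≡0 none v))
      where
      none : sum (E ∖ c ∖ d) ≡ 0
      none = n≤0⇒n≡0 (s≤s⁻¹ (subst (λ z → excess z + sum (E ∖ c ∖ d) ≤ 1) deg-d excess-rest′))

    -- The end d of the pendant path replaces c as a neighbour of a, which closes D up to a cycle.
    G′ : Graph N
    G′ = replaceEdge G c a≢d

    kept : ∀ {i j} → a ≢ i → c ≢ i → adj G i j ≡ true → adj G′ i j ≡ true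
    kept {i} {j} a≢i c≢i e = ∨-introˡ (cong₂ _∧_ e (cong not (pair-off a≢i c≢i j)))

    flip′ : ∀ {i j} → adj G′ i j ≡ true → adj G′ j i ≡ true
    flip′ {i} {j} e = trans (adj-sym G′ j i) e

    ba′ : adj G′ b a ≡ true
    ba′ = kept a≢b (b≢c ∘ sym) ba

    regular′ : ∀ v → deg G′ v ≡ 2
    regular′ v = at (a ≟ v) (c ≟ v) (d ≟ v)
      where
      row-a : ∀ j → adj G′ a j ≡ (adj G a − c ⊕ d) j
      row-a j = trans (cong₂ (λ u w → (adj G a j ∧ not u) ∨ w) (pair-left a≢c j) (pair-left a≢d j))
        (trans (∨-comm _ (does (d ≟ j))) (cong (does (d ≟ j) ∨_) (∧-comm (adj G a j) _)))
      row-c : ∀ j → adj G′ c j ≡ (adj G c − a) j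
      row-c j = trans (cong₂ (λ u w → (adj G c j ∧ not u) ∨ w) (pair-right a≢c j) (pair-off a≢c (c≢d ∘ sym) j))
        (trans (∨-identityʳ _) (∧-comm (adj G c j) _))
      row-d : ∀ j → adj G′ d j ≡ (adj G d ⊕ a) j
      row-d j = trans (cong₂ (λ u w → (adj G d j ∧ not u) ∨ w) (pair-off a≢d c≢d j) (pair-right a≢d j))
        (trans (∨-comm _ (does (a ≟ j))) (cong (does (a ≟ j) ∨_) (∧-identityʳ (adj G d j))))
      row : ∀ {v} → a ≢ v → c ≢ v → d ≢ v → ∀ j → adj G′ v j ≡ adj G v j
      row {v} a≢v c≢v d≢v j = trans (cong₂ (λ u w → (adj G v j ∧ not u) ∨ w) (pair-off a≢v c≢v j) (pair-off a≢v d≢v j))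
        (trans (∨-identityʳ _) (∧-identityʳ _))
      at : ∀ {v} → Dec (a ≡ v) → Dec (c ≡ v) → Dec (d ≡ v) → deg G′ v ≡ 2
      at (yes refl) _ _ = trans (card-cong row-a) (trans
        (card-⊕ (adj G a − c) (trans (−-other (adj G a) c≢d) (proj₁ MA a d Aa Ad)))
        (trans (sym (card-− (adj G a) (flip ca))) (deg-other (a≢c ∘ sym) (a≢d ∘ sym))))
      at (no _) (yes refl) _ = trans (card-cong row-c) (suc-injective (trans (sym (card-− (adj G c) ca)) deg-c))
      at (no _) (no _) (yes refl) = trans (card-cong row-d)
        (trans (card-⊕ (adj G d) (proj₁ MA d a Ad Aa)) (cong suc deg-d))
      at (no a≢v) (no c≢v) (no d≢v) = trans (card-cong (row a≢v c≢v d≢v)) (deg-other c≢v d≢v)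

    -- In `G′` the vertices b and d are adjacent to a, and c is adjacent to b, so U avoids all four.
    -- Edges of `G` at vertices other than a and c survive in `G′`, so U is a union of components of
    -- `G` too, and there it is switchable.
    connected′ : ∀ U → (∀ i j → adj G′ i j ≡ true → U i ≡ true → U j ≡ true) → U a ≡ false → ∀ i → U i ≡ false
    connected′ U closed Ua = switchable-empty A A₂ U MA MA₂ a Aa A₂a Ua (closedG , regularU)
      where
      spread : ∀ {i j} → adj G′ i j ≡ true → U j ≡ false → U i ≡ false
      spread {i} {j} e Uj = ¬true (λ Ui → true≢false (closed i j e Ui) Uj)
      Ub : U b ≡ false
      Ub = spread ba′ Ua
      Uc : U c ≡ false
      Uc = spread (flip′ (kept a≢b (b≢c ∘ sym) (flip cb))) Ub
      Ud : U d ≡ false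
      Ud = spread (flip′ (∨-introʳ {adj G a d ∧ not (pair a c a d)} (⇒pair a d))) Ua
      avoids : ∀ {u v} → U u ≡ false → U v ≡ true → u ≢ v
      avoids Uu Uv refl = true≢false Uv Uu
      closedG : ∀ i j → adj G i j ≡ true → U i ≡ true → U j ≡ true × A i ≢ A j
      closedG i j e Ui = Uj , bipartite (place i) (place j)
        where
        Uj : U j ≡ true
        Uj = closed i j (kept (avoids Ua Ui) (avoids Uc Ui) e) Ui
        bipartite : Place i → Place j → A i ≢ A j
        bipartite (inA Ai)  _         q = true≢false (trans (sym q) Ai) (edge⇒∉ (proj₁ MA) e Ai)
        bipartite (isb b≡i) _         q = avoids Ub Ui b≡i
        bipartite (inW Wi)  (inA Aj)  q = true≢false (trans q Aj) (W⇒∉A Wi)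
        bipartite (inW Wi)  (isb b≡j) q = avoids Ub Uj b≡j
        bipartite (inW Wi)  (inW Wj)  q = true≢false e (W-independent i j Wi Wj)
      regularU : ∀ i → U i ≡ true → deg G i ≡ 2
      regularU i Ui = deg-other (avoids Uc Ui) (avoids Ud Ui)

    -- Starting along ab fixes the labels: a gets 0 and b gets 1, so c, the other neighbour of b,
    -- gets 2, and d, the other neighbour of a, comes last.
    open Walk G′ regular′ 3≤N (flip′ ba′) connected′

    i₀ i₁ i₂ iₗ : Fin N
    i₀ = fromℕ< (≤-trans (s≤s z≤n) 3≤N)
    i₁ = fromℕ< (≤-trans (s≤s (s≤s z≤n)) 3≤N)
    i₂ = proj₁ (visit c)
    iₗ = proj₁ (visit d)

    i₀≡0 : toℕ i₀ ≡ 0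
    i₀≡0 = toℕ-fromℕ< _

    i₁≡1 : toℕ i₁ ≡ 1
    i₁≡1 = toℕ-fromℕ< _

    φ-0 : ∀ {i} → toℕ i ≡ 0 → φ i ≡ a
    φ-0 e = cong v e

    φ-1 : ∀ {i} → toℕ i ≡ 1 → φ i ≡ b
    φ-1 e = cong v e

    i₂≡2 : toℕ i₂ ≡ 2
    i₂≡2 = at (edge⇒Next i₁ i₂ (trans (cong₂ (adj G′) (φ-1 i₁≡1) (proj₂ (visit c))) (kept a≢b (b≢c ∘ sym) (flip cb))))
      where
      at : Next N i₁ i₂ ⊎ Next N i₂ i₁ → toℕ i₂ ≡ 2
      at (inj₁ (inj₁ e)) = trans (sym e) (cong suc i₁≡1)
      at (inj₁ (inj₂ (e , _))) = contradiction (trans (cong suc (sym i₁≡1)) e) (<⇒≢ 3≤N)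
      at (inj₂ (inj₁ e)) = contradiction (trans (sym (φ-0 (suc-injective (trans e i₁≡1)))) (proj₂ (visit c))) a≢c
      at (inj₂ (inj₂ (_ , e))) = contradiction (trans (sym i₁≡1) e) λ ()

    iₗ≡last : suc (toℕ iₗ) ≡ N
    iₗ≡last = at (edge⇒Next i₀ iₗ (trans (cong₂ (adj G′) (φ-0 i₀≡0) (proj₂ (visit d)))
      (∨-introʳ {adj G a d ∧ not (pair a c a d)} (⇒pair a d))))
      where
      at : Next N i₀ iₗ ⊎ Next N iₗ i₀ → suc (toℕ iₗ) ≡ N
      at (inj₁ (inj₁ e)) = contradiction (trans (sym (φ-1 (trans (sym e) (cong suc i₀≡0)))) (proj₂ (visit d))) b≢d
      at (inj₁ (inj₂ (e , _))) = contradiction (trans (cong suc (sym i₀≡0)) e) (<⇒≢ (≤-trans (s≤s (s≤s z≤n)) 3≤N))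
      at (inj₂ (inj₁ e)) = contradiction (trans e i₀≡0) λ ()
      at (inj₂ (inj₂ (e , _))) = e

    pendant : G ≅ D N
    pendant = ≅-sym (record { bij = bijection ; preserve = preserve })
      where
      open ≡-Reasoning
      preserve : ∀ i j → adj G (φ i) (φ j) ≡ adj (D N) i j
      preserve i j = begin
        adj G (φ i) (φ j)
          ≡⟨ replaceEdge-undo G c a≢d (flip ca) (proj₁ MA a d Aa Ad) (φ i) (φ j) ⟩
        (adj G′ (φ i) (φ j) ∧ not (pair a d (φ i) (φ j))) ∨ pair a c (φ i) (φ j)
          ≡⟨ cong₂ (λ u w → (u ∧ not w) ∨ pair a c (φ i) (φ j)) (φ-preserves i j) (pulled iₗ (proj₂ (visit d))) ⟩
        (adj (C N) i j ∧ not (pair i₀ iₗ i j)) ∨ pair a c (φ i) (φ j)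
          ≡⟨ cong ((adj (C N) i j ∧ not (pair i₀ iₗ i j)) ∨_) (pulled i₂ (proj₂ (visit c))) ⟩
        (adj (C N) i j ∧ not (pair i₀ iₗ i j)) ∨ pair i₀ i₂ i j
          ≡⟨ sym (D-from-C 3≤N i₀≡0 i₂≡2 iₗ≡last i j) ⟩
        adj (D N) i j ∎
        where
        pulled : ∀ k {u} → φ k ≡ u → pair a u (φ i) (φ j) ≡ pair i₀ k i j
        pulled k {u} e = trans (cong₂ (λ x y → pair x y (φ i) (φ j)) (sym (φ-0 i₀≡0)) (sym e)) (pair-injective φ φ-injective i₀ k i j)

  -- The case where W contains an edge: a diamond and a separate edge

  module Diamond (Σt : sumOver W t ≡ 0) where

    Σy : sumOver W y ≡ 2
    Σy = trans (cong (λ z → 2 * z + sumOver W y) (sym Σt)) budget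

    plain : ∀ {v} → W v ≡ true → p v ≡ 0 × q v ≡ 0 × x v ≡ 2
    plain {v} Wv = tight Wv (sumOver≡0⇒ W t Σt v Wv)

    ≁a : ∀ {v} → W v ≡ true → adj G v a ≡ false
    ≁a Wv = ⟦⟧-injective (proj₁ (plain Wv))

    ≁b : ∀ {v} → W v ≡ true → adj G v b ≡ false
    ≁b Wv = ⟦⟧-injective (proj₁ (proj₂ (plain Wv)))

    abstract
      edge-in-W : ∃[ w ] ∃[ w′ ] W w ≡ true × W w′ ≡ true × adj G w w′ ≡ true
      edge-in-W = proj₁ end , proj₁ other , proj₁ (proj₂ end) ,
        proj₁ (∧-true (proj₂ other)) , proj₂ (∧-true {W (proj₁ other)} (proj₂ other))
        where
        end : ∃[ w ] W w ≡ true × 0 < y w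
        end = sumOver>0 W y (subst (0 <_) (sym Σy) z<s)
        other : ∃[ w′ ] (W w′ ∧ adj G (proj₁ end) w′) ≡ true
        other = card>0 (λ u → W u ∧ adj G (proj₁ end) u) (proj₂ (proj₂ end))

    w w′ : Fin N
    w  = proj₁ edge-in-W
    w′ = proj₁ (proj₂ edge-in-W)

    Ww : W w ≡ true
    Ww = proj₁ (proj₂ (proj₂ edge-in-W))

    Ww′ : W w′ ≡ true
    Ww′ = proj₁ (proj₂ (proj₂ (proj₂ edge-in-W)))

    ww′ : adj G w w′ ≡ true
    ww′ = proj₂ (proj₂ (proj₂ (proj₂ edge-in-W)))

    w≢w′ : w ≢ w′
    w≢w′ = loopless ww′

    0<y : ∀ {v u} → W u ≡ true → adj G v u ≡ true → 0 < y v
    0<y {v} {u} Wu e = ∈⇒card>0 (λ u → W u ∧ adj G v u) {u} (cong₂ _∧_ Wu e)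

    y-w+w′ : y w + y w′ ≤ 2
    y-w+w′ = subst (y w + y w′ ≤_) Σy (sumOver-term₂ W y Ww Ww′ w≢w′)

    y-w : y w ≡ 1
    y-w = ≤-antisym (s≤s⁻¹ (≤-trans (≤-reflexive (+-comm 1 (y w))) (≤-trans (+-monoʳ-≤ (y w) (0<y Ww (flip ww′))) y-w+w′))) (0<y Ww′ ww′)

    y-w′ : y w′ ≡ 1
    y-w′ = ≤-antisym (s≤s⁻¹ (≤-trans (+-monoˡ-≤ (y w′) (0<y Ww′ ww′)) y-w+w′)) (0<y Ww (flip ww′))

    y-other : ∀ {v} → W v ≡ true → w ≢ v → w′ ≢ v → y v ≡ 0
    y-other {v} Wv p q = n≤0⇒n≡0 (s≤s⁻¹ (s≤s⁻¹ (subst₂ (λ i j → i + (j + y v) ≤ 2) y-w y-w′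
      (subst (y w + (y w′ + y v) ≤_) Σy (sumOver-term₃ W y Ww Ww′ Wv w≢w′ p q)))))

    partner : ∀ {v u u′} → y v ≡ 1 → W u ≡ true → adj G v u ≡ true → W u′ ≡ true → adj G v u′ ≡ true → u ≡ u′
    partner {v} {u} {u′} e Wu vu Wu′ vu′ with card≡1 (λ u → W u ∧ adj G v u) e
    ... | _ , _ , only = trans (sym (only u (cong₂ _∧_ Wu vu))) (only u′ (cong₂ _∧_ Wu′ vu′))

    W-edge : ∀ {i j} → W i ≡ true → W j ≡ true → adj G i j ≡ true → (w ≡ i × w′ ≡ j) ⊎ (w′ ≡ i × w ≡ j)
    W-edge {i} {j} Wi Wj e = at (w ≟ i) (w′ ≟ i)
      where
      at : Dec (w ≡ i) → Dec (w′ ≡ i) → (w ≡ i × w′ ≡ j) ⊎ (w′ ≡ i × w ≡ j)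
      at (yes r) _ = inj₁ (r , partner y-w Ww′ ww′ Wj (trans (cong (λ v → adj G v j) r) e))
      at (no _) (yes r) = inj₂ (r , partner y-w′ Ww (flip ww′) Wj (trans (cong (λ v → adj G v j) r) e))
      at (no r) (no r′) = contradiction (y-other Wi r r′) (λ z → <⇒≢ (0<y Wj e) (sym z))

    s-W : ∀ {v} → W v ≡ true → s v ≡ 2
    s-W Wv = cong₂ _+_ (proj₁ (plain Wv)) (cong₂ _+_ (proj₁ (proj₂ (plain Wv))) (proj₂ (proj₂ (plain Wv))))

    deg-w : deg G w ≡ 3
    deg-w = trans (deg-W w) (cong₂ _+_ (s-W Ww) y-w)

    deg-w′ : deg G w′ ≡ 3
    deg-w′ = trans (deg-W w′) (cong₂ _+_ (s-W Ww′) y-w′)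

    a-only : ∀ {u} → adj G a u ≡ true → b ≡ u
    a-only e = [ id , (λ Wu → contradiction (≁a Wu) (true≢false (flip e))) ]′ (a-neighbours e)

    b-only′ : ∀ {u} → adj G b u ≡ true → a ≡ u
    b-only′ e = [ id , (λ Wu → contradiction (≁b Wu) (true≢false (flip e))) ]′ (b-neighbours e)

    deg-a : deg G a ≡ 1
    deg-a = card-single (adj G a) (flip ba) (λ u → a-only)

    deg-b : deg G b ≡ 1
    deg-b = card-single (adj G b) ba (λ u → b-only′)

    w≢a : w ≢ a
    w≢a = W⇒≢a Ww ∘ sym

    w≢b : w ≢ b
    w≢b = W⇒≢b Ww ∘ sym

    w′≢a : w′ ≢ a
    w′≢a = W⇒≢a Ww′ ∘ sym

    w′≢b : w′ ≢ b
    w′≢b = W⇒≢b Ww′ ∘ sym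

    common : Fin N → Bool
    common i = A i ∧ (adj G w i ∧ adj G w′ i)

    -- W is not independent here, so w is moved into the class of b, to which it is not adjacent. As
    -- b has no neighbour in W, a rainbow triangle must use w, then w′ as the only neighbour of w in
    -- W, and a common neighbour of both in A.
    triangles≤common : triangles G ≤ 6 * card common
    triangles≤common = ≤-trans (triangles≤-tripartite A Y (W − w) cover (proj₁ MA) IY IZ F at)
      (≤-reflexive (cong (6 *_) total))
      where
      Y : Fin N → Bool
      Y v = does (b ≟ v) ∨ does (w ≟ v)
      Y⇒ : ∀ {v} → Y v ≡ true → b ≡ v ⊎ w ≡ v
      Y⇒ {v} e = [ inj₁ ∘ does-≟⇒≡ {x = b} , inj₂ ∘ does-≟⇒≡ {x = w} ]′ (∨-true {does (b ≟ v)} e)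
      cover : ∀ v → A v ≡ false → Y v ≡ false → (W − w) v ≡ true
      cover v Av Yv = trans (−-other W {w} w≢v) (⇒W Av b≢v)
        where
        b≢v : b ≢ v
        b≢v e = true≢false (∨-introˡ (dec-true (b ≟ v) e)) Yv
        w≢v : w ≢ v
        w≢v e = true≢false (∨-introʳ {does (b ≟ v)} (dec-true (w ≟ v) e)) Yv
      IY : Independent (adj G) Y
      IY i j Yi Yj = at (Y⇒ Yi) (Y⇒ Yj)
        where
        at : b ≡ i ⊎ w ≡ i → b ≡ j ⊎ w ≡ j → adj G i j ≡ false
        at (inj₁ refl) (inj₁ refl) = adj-irrefl G b
        at (inj₁ refl) (inj₂ refl) = trans (adj-sym G b w) (≁b Ww)
        at (inj₂ refl) (inj₁ refl) = ≁b Ww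
        at (inj₂ refl) (inj₂ refl) = adj-irrefl G w
      IZ : Independent (adj G) (W − w)
      IZ i j Zi Zj = ¬true (λ e → [ (λ r → proj₁ (∈− W {w} Zi) (proj₁ r)) , (λ r → proj₁ (∈− W {w} Zj) (proj₂ r)) ]′
        (W-edge (proj₂ (∈− W {w} Zi)) (proj₂ (∈− W {w} Zj)) e))
      F : Fin N → Fin N → Fin N → ℕ
      F i j k = ⟦ common i ⟧ * (δ w j * δ w′ k)
      total : sum₃ F ≡ card common
      total = trans (sum₃-product (λ i → ⟦ common i ⟧) (δ w) (δ w′))
        (trans (cong (card common *_) (cong₂ _*_ (sum-δ₁ w) (sum-δ₁ w′))) (*-identityʳ (card common)))
      at : ∀ i j k → A i ≡ true → Y j ≡ true → (W − w) k ≡ true →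
        adj G i j ≡ true → adj G i k ≡ true → adj G j k ≡ true → 1 ≤ F i j k
      at i j k Ai Yj Zk ij ik jk = at′ (Y⇒ Yj)
        where
        Wk : W k ≡ true
        Wk = proj₂ (∈− W {w} Zk)
        at″ : w ≡ j → w′ ≡ k → 1 ≤ F i j k
        at″ refl refl = ≤-reflexive (sym (cong₂ _*_ (cong ⟦_⟧ (cong₂ _∧_ Ai (cong₂ _∧_ (flip ij) (flip ik)))) (cong₂ _*_ (δ-refl w) (δ-refl w′))))
        at′ : b ≡ j ⊎ w ≡ j → 1 ≤ F i j k
        at′ (inj₁ e) = contradiction (≁b Wk) (true≢false (flip (trans (cong (λ v → adj G v k) e) jk)))
        at′ (inj₂ e) = at″ e (partner y-w Ww′ ww′ Wk (trans (cong (λ v → adj G v k) e) jk))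

    E rest : Fin N → ℕ
    E v = excess (deg G v)
    rest = E ∖ w ∖ w′ ∖ a ∖ b

    excess-split : sum E ≡ 4 + sum rest
    excess-split = begin
      sum E
        ≡⟨ extract w deg-w ⟩
      1 + sum (E ∖ w)
        ≡⟨ cong suc (sum-extract (E ∖ w) w′) ⟩
      1 + ((E ∖ w) w′ + sum (E ∖ w ∖ w′))
        ≡⟨ cong (λ z → 1 + (z + sum (E ∖ w ∖ w′))) (trans (∖-other E w≢w′) (cong excess deg-w′)) ⟩
      2 + sum (E ∖ w ∖ w′)
        ≡⟨ cong (2 +_) (sum-extract (E ∖ w ∖ w′) a) ⟩
      2 + ((E ∖ w ∖ w′) a + sum (E ∖ w ∖ w′ ∖ a))
        ≡⟨ cong (λ z → 2 + (z + sum (E ∖ w ∖ w′ ∖ a))) (trans (∖-other (E ∖ w) w′≢a) (trans (∖-other E w≢a) (cong excess deg-a))) ⟩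
      3 + sum (E ∖ w ∖ w′ ∖ a)
        ≡⟨ cong (3 +_) (sum-extract (E ∖ w ∖ w′ ∖ a) b) ⟩
      3 + ((E ∖ w ∖ w′ ∖ a) b + sum rest)
        ≡⟨ cong (λ z → 3 + (z + sum rest)) (trans (∖-other (E ∖ w ∖ w′) a≢b) (trans (∖-other (E ∖ w) w′≢b) (trans (∖-other E w≢b) (cong excess deg-b)))) ⟩
      4 + sum rest ∎
      where
      open ≡-Reasoning
      extract : ∀ v → deg G v ≡ 3 → sum E ≡ 1 + sum (E ∖ v)
      extract v e = trans (sum-extract E v) (cong (λ z → excess z + sum (E ∖ v)) e)

    -- Since w has just two neighbours in A, the right side is at most 4. The inequality is
    -- therefore tight, which fixes both the size of `common` and all remaining degrees.
    total≤ : 4 + sum rest ≤ 2 * card common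
    total≤ = subst (_≤ 2 * card common) excess-split (excess-total (card common) triangles≤common)

    common⊆w : common ⊆ (λ i → A i ∧ adj G w i)
    common⊆w i e = cong₂ _∧_ (proj₁ (∧-true e)) (proj₁ (∧-true {adj G w i} (proj₂ (∧-true {A i} e))))

    common⊆w′ : common ⊆ (λ i → A i ∧ adj G w′ i)
    common⊆w′ i e = cong₂ _∧_ (proj₁ (∧-true e)) (proj₂ (∧-true {adj G w i} (proj₂ (∧-true {A i} e))))

    degIn-A : ∀ {v} → W v ≡ true → degIn G A v ≡ 2
    degIn-A {v} Wv = trans (p+x v) (cong₂ _+_ (proj₁ (plain Wv)) (proj₂ (proj₂ (plain Wv))))

    card-common≤2 : card common ≤ 2
    card-common≤2 = ≤-trans (card-mono common⊆w) (≤-reflexive (degIn-A Ww))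

    card-common : card common ≡ 2
    card-common = ≤-antisym card-common≤2 (*-cancelˡ-≤ 2 (≤-trans (m≤m+n 4 (sum rest)) total≤))

    w-common : ∀ {i} → A i ≡ true → adj G w i ≡ true → common i ≡ true
    w-common {i} Ai e = trans (⊆-card⇒≡ common⊆w (≤-reflexive (trans (degIn-A Ww) (sym card-common))) i) (cong₂ _∧_ Ai e)

    w′-common : ∀ {i} → A i ≡ true → adj G w′ i ≡ true → common i ≡ true
    w′-common {i} Ai e = trans (⊆-card⇒≡ common⊆w′ (≤-reflexive (trans (degIn-A Ww′) (sym card-common))) i) (cong₂ _∧_ Ai e)

    deg-other : ∀ {v} → w ≢ v → w′ ≢ v → a ≢ v → b ≢ v → deg G v ≡ 2
    deg-other {v} w≢v w′≢v a≢v b≢v = excess≡0 _ (trans (sym shift) (sum≡0⇒≡0 none v))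
      where
      none : sum rest ≡ 0
      none = n≤0⇒n≡0 (+-cancelˡ-≤ 4 (sum rest) 0 (≤-trans total≤ (*-monoʳ-≤ 2 card-common≤2)))
      shift : rest v ≡ E v
      shift = trans (∖-other (E ∖ w ∖ w′ ∖ a) b≢v) (trans (∖-other (E ∖ w ∖ w′) a≢v) (trans (∖-other (E ∖ w) w′≢v) (∖-other E w≢v)))

    abstract
      two-common : ∃[ u ] ∃[ u′ ] u ≢ u′ × common u ≡ true × common u′ ≡ true × (∀ i → common i ≡ true → u ≡ i ⊎ u′ ≡ i)
      two-common = proj₁ one , proj₁ other , proj₁ (proj₂ other) , proj₂ one , proj₂ (proj₂ other)
        where
        one : ∃[ u ] common u ≡ true
        one = card>0 common (subst (0 <_) (sym card-common) z<s)
        other : ∃[ u′ ] proj₁ one ≢ u′ × common u′ ≡ true × (∀ i → common i ≡ true → proj₁ one ≡ i ⊎ u′ ≡ i)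
        other = card≡2 common (proj₂ one) card-common

    u u′ : Fin N
    u  = proj₁ two-common
    u′ = proj₁ (proj₂ two-common)

    u≢u′ : u ≢ u′
    u≢u′ = proj₁ (proj₂ (proj₂ two-common))

    cu : common u ≡ true
    cu = proj₁ (proj₂ (proj₂ (proj₂ two-common)))

    cu′ : common u′ ≡ true
    cu′ = proj₁ (proj₂ (proj₂ (proj₂ (proj₂ two-common))))

    common-only : ∀ i → common i ≡ true → u ≡ i ⊎ u′ ≡ i
    common-only = proj₂ (proj₂ (proj₂ (proj₂ (proj₂ two-common))))

    common-A : ∀ {i} → common i ≡ true → A i ≡ true
    common-A e = proj₁ (∧-true e)

    common-w : ∀ {i} → common i ≡ true → adj G w i ≡ true
    common-w {i} e = proj₂ (∧-true {A i} (common⊆w i e))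

    common-w′ : ∀ {i} → common i ≡ true → adj G w′ i ≡ true
    common-w′ {i} e = proj₂ (∧-true {A i} (common⊆w′ i e))

    common-≢a : ∀ {i} → common i ≡ true → a ≢ i
    common-≢a ci e = true≢false (common-w ci) (trans (cong (adj G w) (sym e)) (≁a Ww))

    common-≢b : ∀ {i} → common i ≡ true → b ≢ i
    common-≢b ci e = true≢false (common-A ci) (trans (cong A (sym e)) Ab)

    common-neighbours : ∀ {i j} → common i ≡ true → adj G i j ≡ true → w ≡ j ⊎ w′ ≡ j
    common-neighbours {i} {j} ci = card≡2-only (adj G i) w≢w′ (flip (common-w ci)) (flip (common-w′ ci))
      (deg-other (loopless (common-w ci)) (loopless (common-w′ ci)) (common-≢a ci) (common-≢b ci)) j

    -- Listed to match the labels of `K4-e ∪ K 2`: the non-adjacent pair of `K4-e` is 2, 3, the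
    -- places of u and u′, and a, b form the `K 2`.
    six : List (Fin N)
    six = w ∷ w′ ∷ u ∷ u′ ∷ a ∷ b ∷ []

    g : Fin 6 → Fin N
    g = lookupₗ six

    Six : Fin N → Set
    Six v = ∃[ i ] g i ≡ v

    six? : ∀ v → Dec (Six v)
    six? v = any? (λ i → g i ≟ v)

    Six-closed : ∀ {i j} → Six i → adj G i j ≡ true → Six j
    Six-closed {j = j} (0F , refl) e = at (place j)
      where
      at : Place j → Six j
      at (inA Aj) = [ 2F ,_ , 3F ,_ ]′ (common-only j (w-common Aj e))
      at (isb r)  = 5F , r
      at (inW Wj) = 1F , partner y-w Ww′ ww′ Wj e
    Six-closed {j = j} (1F , refl) e = at (place j)
      where
      at : Place j → Six j
      at (inA Aj) = [ 2F ,_ , 3F ,_ ]′ (common-only j (w′-common Aj e))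
      at (isb r)  = 5F , r
      at (inW Wj) = 0F , partner y-w′ Ww (flip ww′) Wj e
    Six-closed (2F , refl) e = [ 0F ,_ , 1F ,_ ]′ (common-neighbours cu e)
    Six-closed (3F , refl) e = [ 0F ,_ , 1F ,_ ]′ (common-neighbours cu′ e)
    Six-closed (4F , refl) e = 5F , a-only e
    Six-closed (5F , refl) e = 4F , b-only′ e

    U : Fin N → Bool
    U v = not (does (six? v))

    U⇒ : ∀ {v} → U v ≡ true → ¬ Six v
    U⇒ {v} e h = true≢false e (cong not (dec-true (six? v) h))

    ⇒U : ∀ {v} → ¬ Six v → U v ≡ true
    ⇒U {v} h = cong not (dec-false (six? v) h)

    -- The six vertices are closed under adjacency and include the four whose degree differs from 2.
    -- They also contain ww′, the only edge that does not cross between A and its complement.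
    U-switchable : Switchable A U
    U-switchable =
      (λ i j e Ui → ⇒U (λ h → U⇒ Ui (Six-closed h (flip e))) , (λ r → bipartite i j e Ui r (place i) (place j))) ,
      (λ i Ui → deg-other (λ r → U⇒ Ui (0F , r)) (λ r → U⇒ Ui (1F , r)) (λ r → U⇒ Ui (4F , r)) (λ r → U⇒ Ui (5F , r)))
      where
      bipartite : ∀ i j → adj G i j ≡ true → U i ≡ true → A i ≡ A j → Place i → Place j → ⊥
      bipartite i j e Ui r (inA Ai) _        = true≢false (trans (sym r) Ai) (edge⇒∉ (proj₁ MA) e Ai)
      bipartite i j e Ui r (isb s)  _        = U⇒ Ui (5F , s)
      bipartite i j e Ui r (inW Wi) (inA Aj) = true≢false (trans r Aj) (W⇒∉A Wi)
      bipartite i j e Ui r (inW Wi) (isb s)  = U⇒ Ui (Six-closed (5F , s) (flip e))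
      bipartite i j e Ui r (inW Wi) (inW Wj) = [ (λ s → U⇒ Ui (0F , proj₁ s)) , (λ s → U⇒ Ui (1F , proj₁ s)) ]′ (W-edge Wi Wj e)

    all-six : ∀ v → Six v
    all-six v = at (six? v) refl
      where
      Ua : U a ≡ false
      Ua = cong not (dec-true (six? a) (4F , refl))
      at : (h : Dec (Six v)) → does h ≡ does (six? v) → Six v
      at (yes h) _ = h
      at (no _)  e = contradiction (switchable-empty A A₂ U MA MA₂ a Aa A₂a Ua U-switchable v) (true≢false (cong not (sym e)))

    six-unique : Unique six
    six-unique =
      (w≢w′ ∷ loopless (common-w cu) ∷ loopless (common-w cu′) ∷ w≢a ∷ w≢b ∷ []) ∷
      (loopless (common-w′ cu) ∷ loopless (common-w′ cu′) ∷ w′≢a ∷ w′≢b ∷ []) ∷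
      (u≢u′ ∷ (common-≢a cu ∘ sym) ∷ (common-≢b cu ∘ sym) ∷ []) ∷
      ((common-≢a cu′ ∘ sym) ∷ (common-≢b cu′ ∘ sym) ∷ []) ∷
      (a≢b ∷ []) ∷ [] ∷ []

    bijection : Fin 6 ↔ Fin N
    bijection = mk↔ₛ′ g (λ v → proj₁ (all-six v)) (λ v → proj₂ (all-six v))
      (λ i → lookup-injective six-unique _ i (proj₂ (all-six (g i))))

    _≁_ : Fin N → Fin N → Set
    i ≁ j = adj G i j ≡ false

    ≁-sym : ∀ {i j} → i ≁ j → j ≁ i
    ≁-sym {i} {j} e = trans (adj-sym G j i) e

    common-≁b : ∀ {i} → common i ≡ true → i ≁ b
    common-≁b ci = ¬true (λ e → common-≢a ci (b-only (common-A ci) (flip e)))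

    common-≁A : ∀ {i j} → common i ≡ true → A j ≡ true → i ≁ j
    common-≁A ci Aj = proj₁ MA _ _ (common-A ci) Aj

    preserves : ∀ i j → adj G (g i) (g j) ≡ adj (K4-e ∪ K 2) i j
    preserves 0F 0F = adj-irrefl G w
    preserves 0F 1F = ww′
    preserves 0F 2F = common-w cu
    preserves 0F 3F = common-w cu′
    preserves 0F 4F = ≁a Ww
    preserves 0F 5F = ≁b Ww
    preserves 1F 0F = flip ww′
    preserves 1F 1F = adj-irrefl G w′
    preserves 1F 2F = common-w′ cu
    preserves 1F 3F = common-w′ cu′
    preserves 1F 4F = ≁a Ww′
    preserves 1F 5F = ≁b Ww′
    preserves 2F 0F = flip (common-w cu)
    preserves 2F 1F = flip (common-w′ cu)
    preserves 2F 2F = adj-irrefl G u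
    preserves 2F 3F = common-≁A cu (common-A cu′)
    preserves 2F 4F = common-≁A cu Aa
    preserves 2F 5F = common-≁b cu
    preserves 3F 0F = flip (common-w cu′)
    preserves 3F 1F = flip (common-w′ cu′)
    preserves 3F 2F = common-≁A cu′ (common-A cu)
    preserves 3F 3F = adj-irrefl G u′
    preserves 3F 4F = common-≁A cu′ Aa
    preserves 3F 5F = common-≁b cu′
    preserves 4F 0F = ≁-sym (≁a Ww)
    preserves 4F 1F = ≁-sym (≁a Ww′)
    preserves 4F 2F = ≁-sym (common-≁A cu Aa)
    preserves 4F 3F = ≁-sym (common-≁A cu′ Aa)
    preserves 4F 4F = adj-irrefl G a
    preserves 4F 5F = flip ba
    preserves 5F 0F = ≁-sym (≁b Ww)
    preserves 5F 1F = ≁-sym (≁b Ww′)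
    preserves 5F 2F = ≁-sym (common-≁b cu)
    preserves 5F 3F = ≁-sym (common-≁b cu′)
    preserves 5F 4F = ba
    preserves 5F 5F = adj-irrefl G b

    diamond : n ≡ 3 × G ≅ (K4-e ∪ K 2)
    diamond = n≡3 , ≅-sym (record { bij = bijection ; preserve = preserves })
      where
      n≡3 : n ≡ 3
      n≡3 = *-cancelˡ-≡ n 3 2 (trans (cong (n +_) (+-identityʳ n)) (trans (sym order) (sym (↔⇒≡ bijection))))

-- Assembling the cases and the theorem

classify : ∀ {N n} (G : Graph N) → CycleLike G n → ∃[ A ] Maximum G n A →
  G ≅ C N ⊎ G ≅ D N ⊎ (n ≡ 3 × G ≅ (K4-e ∪ K 2))
classify {N} {n} G cl (A , MA) = at (any? (λ v → (A v Bool.≟ false) ×-dec (degIn G A v <? 2)))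
  where
  open Structure G n cl
  at : Dec (∃[ v ] (A v ≡ false × degIn G A v < 2)) → G ≅ C N ⊎ G ≅ D N ⊎ (n ≡ 3 × G ≅ (K4-e ∪ K 2))
  at (no none) = inj₁ (cycle A MA (λ v Av → ≮⇒≥ (λ lt → none (v , Av , lt))))
  at (yes (b , Ab , lt)) = exchange (swap A b MA Ab lt)
    where
    exchange : ∃[ a ] A a ≡ true × adj G b a ≡ true × degIn G A b ≡ 1 × Maximum G n (A − a ⊕ b) →
      G ≅ C N ⊎ G ≅ D N ⊎ (n ≡ 3 × G ≅ (K4-e ∪ K 2))
    exchange (a , Aa , ba , degb , MA₂) = split (sumOver W t) refl
      where
      open Exchange G n cl A MA Aa Ab ba degb MA₂
      split : ∀ k → sumOver W t ≡ k → G ≅ C N ⊎ G ≅ D N ⊎ (n ≡ 3 × G ≅ (K4-e ∪ K 2))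
      split 0 e = inj₂ (inj₂ (Diamond.diamond e))
      split 1 e = inj₂ (inj₁ (Pendant.pendant e))
      -- The term 2 · `sumOver W t` alone would be at least 4, beyond the budget of 2.
      split (suc (suc k)) e = contradiction (trans (cong (λ z → 2 * z + sumOver W y) (sym e)) budget)
        (λ z → <⇒≢ (≤-trans (s≤s (s≤s (s≤s z≤n))) (≤-trans (*-monoʳ-≤ 2 {2} (s≤s (s≤s z≤n))) (m≤m+n (2 * suc (suc k)) _))) (sym z))

-- Exposes the form 3 + r of the order in which the coefficients of `C` and `D` are computed.
double : ∀ t → 2 * (2 + t) ≡ 4 + (t + t)
double = solve 1 (λ t → con 2 :* (con 2 :+ t) := con 4 :+ (t :+ t)) refl

cycleLike : ∀ t (H : Graph (2 * (2 + t))) → SameIndepPoly H (C (2 * (2 + t))) →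
  CycleLike H (2 + t) × ∃[ A ] Maximum H (2 + t) A
cycleLike t H same = record
  { order    = cong (n +_) (+-identityʳ n)
  ; 2≤n      = s≤s (s≤s z≤n)
  ; size     = trans (degree-sum H (C (2 * n)) (same 2)) (trans (trans (sum-cong-≗ deg-two) (sum-const (2 * n) 2))
                 (solve 1 (λ n → con 2 :* n :* con 2 := con 4 :* n) refl n))
  ; excesses = sum-excess H (C (2 * n)) (same 2) (same 3) deg-two
                 (triangles-C {2 * n} (trans (cong even (cong (n +_) (+-identityʳ n))) (even-double n)))
  ; above    = no-independent-set H (suc n) (trans (same (suc n))
                 (subst (λ m → indepCoeff (C m) (suc n) ≡ 0) (sym (double t)) (indepCoeff-C-above t)))
  ; two      = λ P Q S (IP , cP) (IQ , cQ) (IS , cS) P≢Q → choose {P} {Q} {S} P≢Q (only P IP cP) (only Q IQ cQ) (only S IS cS)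
  } , A , IA , cA
  where
  n = 2 + t
  deg-two : ∀ v → deg (C (2 * n)) v ≡ 2
  deg-two = deg-C (subst (3 ≤_) (sym (double t)) (s≤s (s≤s (s≤s z≤n))))
  sets = two-independent-sets H n (trans (same n) (subst (λ m → indepCoeff (C m) n ≡ 2) (sym (double t)) (indepCoeff-C-top t)))
  A = proj₁ sets
  B = proj₁ (proj₂ sets)
  IA = proj₁ (proj₂ (proj₂ sets))
  cA = proj₁ (proj₂ (proj₂ (proj₂ sets)))
  only = proj₂ (proj₂ (proj₂ (proj₂ (proj₂ (proj₂ (proj₂ sets))))))
  -- The field `two` lets any two distinct maximum sets play the two roles, as the second set arises
  -- only during the argument; here they are matched with the two sets that the coefficient
  -- provides.
  choose : ∀ {P Q S} → ¬ (∀ i → P i ≡ Q i) → (∀ i → P i ≡ A i) ⊎ (∀ i → P i ≡ B i) → (∀ i → Q i ≡ A i) ⊎ (∀ i → Q i ≡ B i) →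
    (∀ i → S i ≡ A i) ⊎ (∀ i → S i ≡ B i) → (∀ i → S i ≡ P i) ⊎ (∀ i → S i ≡ Q i)
  choose P≢Q (inj₁ p) (inj₁ q) _        = contradiction (λ i → trans (p i) (sym (q i))) P≢Q
  choose P≢Q (inj₂ p) (inj₂ q) _        = contradiction (λ i → trans (p i) (sym (q i))) P≢Q
  choose P≢Q (inj₁ p) (inj₂ q) (inj₁ s) = inj₁ (λ i → trans (s i) (sym (p i)))
  choose P≢Q (inj₁ p) (inj₂ q) (inj₂ s) = inj₂ (λ i → trans (s i) (sym (q i)))
  choose P≢Q (inj₂ p) (inj₁ q) (inj₁ s) = inj₂ (λ i → trans (s i) (sym (q i)))
  choose P≢Q (inj₂ p) (inj₁ q) (inj₂ s) = inj₁ (λ i → trans (s i) (sym (p i)))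

theorem11 : (n : ℕ) → 2 ≤ n → (m : ℕ) → (H : Graph m) →
    SameIndepPoly H (C (2 * n)) ⇔
    (H ≅ C (2 * n) ⊎ H ≅ D (2 * n) ⊎ (n ≡ 3 × H ≅ (K4-e ∪ K 2)))
theorem11 (suc (suc t)) (s≤s (s≤s _)) m H = mk⇔ to from
  where
  N = 2 * (2 + t)
  Options : Set
  Options = H ≅ C N ⊎ H ≅ D N ⊎ (2 + t ≡ 3 × H ≅ (K4-e ∪ K 2))
  to : SameIndepPoly H (C N) → Options
  -- The coefficient i₁ is the number of vertices, so `H` has order `N` and can be compared with the
  -- cycle on the same vertex type.
  to same with trans (sym (indepCoeff₁ H)) (trans (same 1) (indepCoeff₁ (C N)))
  ... | refl = classify H (proj₁ (cycleLike t H same)) (proj₂ (cycleLike t H same))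
  from : Options → SameIndepPoly H (C N)
  from (inj₁ iso) = ≅⇒SameIndepPoly H (C N) iso
  from (inj₂ (inj₁ iso)) r = trans (≅⇒SameIndepPoly H (D N) iso r)
    (subst (λ k → indepCoeff (D k) r ≡ indepCoeff (C k) r) (sym (double t)) (SameIndepPoly-D-C (suc (t + t)) r))
  from (inj₂ (inj₂ (refl , iso))) r = trans (≅⇒SameIndepPoly H (K4-e ∪ K 2) iso r) (SameIndepPoly-K4-e∪K2 r)
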